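{- Let $d \le 4$ be a positive integer. Then $\operatorname{rc}(X) \ge d+1$ holds for every $d$-dimensional finite lattice-convex set $X \subseteq \mathbb{Z}^d$.
   Context: A set $X \subseteq \mathbb{Z}^d$ is lattice-convex if $\operatorname{conv}(X) \cap \mathbb{Z}^d = X$; it is $d$-dimensional if its affine hull is $\mathbb{R}^d$. We say $X$ is described by $k$ linear inequalities within $\mathbb{Z}^d$ if $X = \{x \in \mathbb{Z}^d : Ax \le b,\ Ux = v\}$ for some real matrices $A, U$ and real vectors $b, v$, where $Ax \le b$ consists of $k$ inequalities (the number of equations $Ux=v$ is arbitrary and not counted). The relaxation complexity $\operatorname{rc}(X)$ is the minimal $k$ such that $X$ can be described by $k$ linear inequalities within $\mathbb{Z}^d$. -}

module Defs where

open import Level using (0ℓ)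
open import Algebra.Bundles using (RawMonoid; CommutativeMonoid)
open import Data.Integer.Base using (ℤ)
import Data.List.Membership.Propositional as List
open import Data.Nat.Base as ℕ using (ℕ)
import Data.Nat.Properties as ℕ
open import Data.Nat.Induction using (<-rec)
open import Data.Product.Base using (∃-syntax; Σ-syntax; _×_; _,_; proj₁; proj₂)
open import Data.Rational.Base as ℚ using (ℚ; 0ℚ; 1ℚ; ½)
import Data.Rational.Properties as ℚ
open import Algebra.Properties.CommutativeSemigroup
  (CommutativeMonoid.commutativeSemigroup ℚ.+-0-commutativeMonoid)
  using (interchange; x∙yz≈y∙xz)
open import Data.Vec.Base using (Vec; lookup)
open import Data.Vec.Functional using (Vector)
open import Function.Bundles using (_⇔_)
open import Relation.Binary.PropositionalEquality using (_≡_; refl; sym; trans; cong; cong₂; subst; module ≡-Reasoning)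
open import Relation.Nullary using (¬_)
open import Relation.Nullary.Decidable using (decidable-stable)
open import Relation.Unary using (Pred; _∈_)

Close : (ℕ → ℚ) → ℚ → Set
Close x ε = ∃[ N ] ∀ m n → N ℕ.≤ m → N ℕ.≤ n → ℚ.∣ x m ℚ.- x n ∣ ℚ.≤ ε

IsCauchy : (ℕ → ℚ) → Set
IsCauchy x = ∀ (ε : ℚ) → 0ℚ ℚ.< ε → Close x ε

record ℝ : Set where
  constructor mkℝ
  field
    seq    : ℕ → ℚ
    cauchy : IsCauchy seq

open ℝ public

infix  4 _≈_ _≤_
infixl 6 _+_
infixl 7 _*_

_≈_ : ℝ → ℝ → Set
x ≈ y = ∀ (ε : ℚ) → 0ℚ ℚ.< ε →
  ∃[ N ] ∀ n → N ℕ.≤ n → ℚ.∣ seq x n ℚ.- seq y n ∣ ℚ.≤ ε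

_≤_ : ℝ → ℝ → Set
x ≤ y = ∀ (ε : ℚ) → 0ℚ ℚ.< ε →
  ∃[ N ] ∀ n → N ℕ.≤ n → seq x n ℚ.≤ seq y n ℚ.+ ε

fromℚ : ℚ → ℝ
fromℚ q = mkℝ (λ _ → q) λ ε 0<ε → 0 , λ _ _ _ _ →
  subst (ℚ._≤ ε) (sym (cong ℚ.∣_∣ (ℚ.+-inverseʳ q))) (ℚ.<⇒≤ 0<ε)

fromℤ : ℤ → ℝ
fromℤ z = fromℚ (z ℚ./ 1)

0ℝ 1ℝ : ℝ
0ℝ = fromℚ 0ℚ
1ℝ = fromℚ 1ℚ

private
  ½*-pos : ∀ {ε} → 0ℚ ℚ.< ε → 0ℚ ℚ.< ½ ℚ.* ε
  ½*-pos {ε} 0<ε = subst (ℚ._< ½ ℚ.* ε) (ℚ.*-zeroʳ ½) (ℚ.*-monoʳ-<-pos ½ 0<ε)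

  ½*+½* : ∀ ε → ½ ℚ.* ε ℚ.+ ½ ℚ.* ε ≡ ε
  ½*+½* ε = trans (sym (ℚ.*-distribʳ-+ ε ½ ½)) (ℚ.*-identityˡ ε)

  +-diff : ∀ a b c d → (a ℚ.+ b) ℚ.- (c ℚ.+ d) ≡ (a ℚ.- c) ℚ.+ (b ℚ.- d)
  +-diff a b c d = trans (cong (a ℚ.+ b ℚ.+_) (ℚ.neg-distrib-+ c d))
                         (interchange a b (ℚ.- c) (ℚ.- d))

  -‿cancel : ∀ a b → a ≡ b ℚ.+ (a ℚ.- b)
  -‿cancel a b = begin
      a                           ≡⟨ ℚ.+-identityʳ a ⟨
      a ℚ.+ 0ℚ                    ≡⟨ cong (a ℚ.+_) (ℚ.+-inverseʳ b) ⟨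
      a ℚ.+ (b ℚ.- b)             ≡⟨ x∙yz≈y∙xz a b (ℚ.- b) ⟩
      b ℚ.+ (a ℚ.- b)             ∎
    where open ≡-Reasoning

  telescope : ∀ p q r → p ℚ.- r ≡ (p ℚ.- q) ℚ.+ (q ℚ.- r)
  telescope p q r = begin
      p ℚ.- r                     ≡⟨ cong (ℚ._- r) (-‿cancel p q) ⟩
      (q ℚ.+ (p ℚ.- q)) ℚ.- r     ≡⟨ cong (ℚ._- r) (ℚ.+-comm q (p ℚ.- q)) ⟩
      ((p ℚ.- q) ℚ.+ q) ℚ.- r     ≡⟨ ℚ.+-assoc (p ℚ.- q) q (ℚ.- r) ⟩
      (p ℚ.- q) ℚ.+ (q ℚ.- r)     ∎
    where open ≡-Reasoning

  *-distribˡ-- : ∀ a b c → a ℚ.* (b ℚ.- c) ≡ a ℚ.* b ℚ.- a ℚ.* c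
  *-distribˡ-- a b c = trans (ℚ.*-distribˡ-+ a b (ℚ.- c))
                             (cong (a ℚ.* b ℚ.+_) (sym (ℚ.neg-distribʳ-* a c)))

  *-diff : ∀ a b c d → (a ℚ.* b) ℚ.- (c ℚ.* d) ≡ a ℚ.* (b ℚ.- d) ℚ.+ d ℚ.* (a ℚ.- c)
  *-diff a b c d = begin
      a ℚ.* b ℚ.- c ℚ.* d
        ≡⟨ telescope (a ℚ.* b) (a ℚ.* d) (c ℚ.* d) ⟩
      (a ℚ.* b ℚ.- a ℚ.* d) ℚ.+ (a ℚ.* d ℚ.- c ℚ.* d)
        ≡⟨ cong₂ (λ u v → (a ℚ.* b ℚ.- a ℚ.* d) ℚ.+ (u ℚ.- v)) (ℚ.*-comm a d) (ℚ.*-comm c d) ⟩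
      (a ℚ.* b ℚ.- a ℚ.* d) ℚ.+ (d ℚ.* a ℚ.- d ℚ.* c)
        ≡⟨ cong₂ ℚ._+_ (*-distribˡ-- a b d) (*-distribˡ-- d a c) ⟨
      a ℚ.* (b ℚ.- d) ℚ.+ d ℚ.* (a ℚ.- c) ∎
    where open ≡-Reasoning

  ∣+∣-mono : ∀ a b {α β} → ℚ.∣ a ∣ ℚ.≤ α → ℚ.∣ b ∣ ℚ.≤ β → ℚ.∣ a ℚ.+ b ∣ ℚ.≤ α ℚ.+ β
  ∣+∣-mono a b {α} {β} a≤α b≤β =
    ℚ.≤-trans (ℚ.∣p+q∣≤∣p∣+∣q∣ a b) (ℚ.+-mono-≤ {ℚ.∣ a ∣} {α} {ℚ.∣ b ∣} {β} a≤α b≤β)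

  halves : ∀ p a b ε → p ≡ a ℚ.+ b →
           ℚ.∣ a ∣ ℚ.≤ ½ ℚ.* ε → ℚ.∣ b ∣ ℚ.≤ ½ ℚ.* ε → ℚ.∣ p ∣ ℚ.≤ ε
  halves p a b ε p≡a+b a≤ b≤ =
    subst (ℚ.∣ p ∣ ℚ.≤_) (½*+½* ε)
      (subst (λ t → ℚ.∣ t ∣ ℚ.≤ ½ ℚ.* ε ℚ.+ ½ ℚ.* ε) (sym p≡a+b) (∣+∣-mono a b a≤ b≤))

  ∣*∣-mono : ∀ a b {B δ} → ℚ.∣ a ∣ ℚ.≤ B → 0ℚ ℚ.< B → ℚ.∣ b ∣ ℚ.≤ δ → ℚ.∣ a ℚ.* b ∣ ℚ.≤ B ℚ.* δ
  ∣*∣-mono a b {B} {δ} a≤B 0<B b≤δ =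
    subst (ℚ._≤ B ℚ.* δ) (sym (ℚ.∣p*q∣≡∣p∣*∣q∣ a b))
      (ℚ.≤-trans (ℚ.*-monoʳ-≤-nonNeg ℚ.∣ b ∣ {{ℚ.∣-∣-nonNeg b}} a≤B)
                 (ℚ.*-monoˡ-≤-nonNeg B {{ℚ.nonNegative (ℚ.<⇒≤ 0<B)}} b≤δ))

  +-cauchy : ∀ x y → IsCauchy x → IsCauchy y → IsCauchy (λ n → x n ℚ.+ y n)
  +-cauchy x y cx cy ε 0<ε with cx (½ ℚ.* ε) (½*-pos 0<ε) | cy (½ ℚ.* ε) (½*-pos 0<ε)
  ... | M , p | N , q = M ℕ.⊔ N , λ m n m≥ n≥ →
    halves _ (x m ℚ.- x n) (y m ℚ.- y n) ε (+-diff (x m) (y m) (x n) (y n))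
      (p m n (ℕ.m⊔n≤o⇒m≤o M N m≥) (ℕ.m⊔n≤o⇒m≤o M N n≥))
      (q m n (ℕ.m⊔n≤o⇒n≤o M N m≥) (ℕ.m⊔n≤o⇒n≤o M N n≥))

  0<1 : 0ℚ ℚ.< 1ℚ
  0<1 = ℚ.positive⁻¹ 1ℚ

  BoundedBy : (ℕ → ℚ) → ℚ → Set
  BoundedBy x B = 0ℚ ℚ.< B × ∃[ N ] ∀ n → N ℕ.≤ n → ℚ.∣ x n ∣ ℚ.≤ B

  bounded : ∀ x → IsCauchy x → ∃[ B ] BoundedBy x B
  bounded x cx with cx 1ℚ 0<1
  ... | N , p = ℚ.∣ x N ∣ ℚ.+ 1ℚ ,
      ℚ.+-mono-≤-< {0ℚ} {ℚ.∣ x N ∣} {0ℚ} {1ℚ} (ℚ.0≤∣p∣ (x N)) 0<1 ,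
      N , λ n n≥ → subst (λ t → ℚ.∣ t ∣ ℚ.≤ ℚ.∣ x N ∣ ℚ.+ 1ℚ) (sym (-‿cancel (x n) (x N)))
                 (∣+∣-mono (x N) (x n ℚ.- x N) ℚ.≤-refl (p n N n≥ ℕ.≤-refl))

  shrink : ∀ B ε → 0ℚ ℚ.< B → 0ℚ ℚ.< ε → Σ[ δ ∈ ℚ ] (0ℚ ℚ.< δ × B ℚ.* δ ≡ ε)
  shrink B ε 0<B 0<ε = 1/B ℚ.* ε ,
      subst (ℚ._< 1/B ℚ.* ε) (ℚ.*-zeroʳ 1/B) (ℚ.*-monoʳ-<-pos 1/B 0<ε) ,
      trans (sym (ℚ.*-assoc B 1/B ε)) (trans (cong (ℚ._* ε) (ℚ.*-inverseʳ B)) (ℚ.*-identityˡ ε))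
    where
    instance
      B>0 : ℚ.Positive B
      B>0 = ℚ.positive 0<B
      B≢0 : ℚ.NonZero B
      B≢0 = ℚ.pos⇒nonZero B
    1/B : ℚ
    1/B = ℚ.1/ B
    instance
      1/B>0 : ℚ.Positive 1/B
      1/B>0 = ℚ.1/pos⇒pos B

  *-close : ∀ x y {B C β γ} ε → B ℚ.* β ≡ ½ ℚ.* ε → C ℚ.* γ ≡ ½ ℚ.* ε →
            BoundedBy x B → BoundedBy y C → Close x γ → Close y β →
            Close (λ n → x n ℚ.* y n) ε
  *-close x y ε Bβ Cγ (0<B , K , x≤B) (0<C , L , y≤C) (M , p) (N , q) =
    (K ℕ.⊔ L) ℕ.⊔ (M ℕ.⊔ N) , λ m n m≥ n≥ →
    let m≥KL = ℕ.m⊔n≤o⇒m≤o (K ℕ.⊔ L) (M ℕ.⊔ N) m≥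
        n≥KL = ℕ.m⊔n≤o⇒m≤o (K ℕ.⊔ L) (M ℕ.⊔ N) n≥
        m≥MN = ℕ.m⊔n≤o⇒n≤o (K ℕ.⊔ L) (M ℕ.⊔ N) m≥
        n≥MN = ℕ.m⊔n≤o⇒n≤o (K ℕ.⊔ L) (M ℕ.⊔ N) n≥
        Δx   = x m ℚ.- x n
        Δy   = y m ℚ.- y n
    in halves _ (x m ℚ.* Δy) (y n ℚ.* Δx) ε (*-diff (x m) (y m) (x n) (y n))
         (subst (ℚ.∣ x m ℚ.* Δy ∣ ℚ.≤_) Bβ
           (∣*∣-mono (x m) Δy (x≤B m (ℕ.m⊔n≤o⇒m≤o K L m≥KL)) 0<B
             (q m n (ℕ.m⊔n≤o⇒n≤o M N m≥MN) (ℕ.m⊔n≤o⇒n≤o M N n≥MN))))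
         (subst (ℚ.∣ y n ℚ.* Δx ∣ ℚ.≤_) Cγ
           (∣*∣-mono (y n) Δx (y≤C n (ℕ.m⊔n≤o⇒n≤o K L n≥KL)) 0<C
             (p m n (ℕ.m⊔n≤o⇒m≤o M N m≥MN) (ℕ.m⊔n≤o⇒m≤o M N n≥MN))))

  *-cauchy : ∀ x y → IsCauchy x → IsCauchy y → IsCauchy (λ n → x n ℚ.* y n)
  *-cauchy x y cx cy ε 0<ε =
    let B , x≤B = bounded x cx
        C , y≤C = bounded y cy
        β , 0<β , Bβ = shrink B (½ ℚ.* ε) (proj₁ x≤B) (½*-pos 0<ε)
        γ , 0<γ , Cγ = shrink C (½ ℚ.* ε) (proj₁ y≤C) (½*-pos 0<ε)
    in *-close x y ε Bβ Cγ x≤B y≤C (cx γ 0<γ) (cy β 0<β)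

_+_ : ℝ → ℝ → ℝ
x + y = mkℝ (λ n → seq x n ℚ.+ seq y n) (+-cauchy (seq x) (seq y) (cauchy x) (cauchy y))

_*_ : ℝ → ℝ → ℝ
x * y = mkℝ (λ n → seq x n ℚ.* seq y n) (*-cauchy (seq x) (seq y) (cauchy x) (cauchy y))

+-0-rawMonoid : RawMonoid 0ℓ 0ℓ
+-0-rawMonoid = record { Carrier = ℝ ; _≈_ = _≈_ ; _∙_ = _+_ ; ε = 0ℝ }

open import Algebra.Definitions.RawMonoid +-0-rawMonoid public using (sum)

Point : ℕ → Set
Point d = Vector ℝ d

infix 4 _≋_

_≋_ : ∀ {d} → Point d → Point d → Set
y ≋ z = ∀ j → y j ≈ z j

LatticePoint : ℕ → Set
LatticePoint d = Vec ℤ d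

ι : ∀ {d} → LatticePoint d → Point d
ι x j = fromℤ (lookup x j)

Matrix : ℕ → ℕ → Set
Matrix m d = Vector (Vector ℝ d) m

infixl 7 _·_

_·_ : ∀ {m d} → Matrix m d → Point d → Point m
(A · y) i = sum (λ j → A i j * y j)

linComb : ∀ {n d} → Vector ℝ n → Vector (Point d) n → Point d
linComb c p j = sum (λ i → c i * p i j)

conv : ∀ {d} → Pred (Point d) 0ℓ → Pred (Point d) 0ℓ
conv S y = ∃[ n ] Σ[ c ∈ Vector ℝ n ] Σ[ p ∈ Vector (Point _) n ]
  ((∀ i → p i ∈ S) × (∀ i → 0ℝ ≤ c i) × sum c ≈ 1ℝ × linComb c p ≋ y)

aff : ∀ {d} → Pred (Point d) 0ℓ → Pred (Point d) 0ℓ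
aff S y = ∃[ n ] Σ[ c ∈ Vector ℝ n ] Σ[ p ∈ Vector (Point _) n ]
  ((∀ i → p i ∈ S) × sum c ≈ 1ℝ × linComb c p ≋ y)

LatticeSet : ℕ → Set₁
LatticeSet d = Pred (LatticePoint d) 0ℓ

embed : ∀ {d} → LatticeSet d → Pred (Point d) 0ℓ
embed X y = ∃[ x ] (x ∈ X × ι x ≋ y)

Finite : ∀ {d} → LatticeSet d → Set
Finite X = ∃[ xs ] ∀ x → x ∈ X ⇔ x List.∈ xs

LatticeConvex : ∀ {d} → LatticeSet d → Set
LatticeConvex X = ∀ x → ι x ∈ conv (embed X) ⇔ x ∈ X

FullDimensional : ∀ {d} → LatticeSet d → Set
FullDimensional X = ∀ y → y ∈ aff (embed X)

-- k counts the inequalities only; the number l of equations is free.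
DescribedBy : ∀ {d} → ℕ → LatticeSet d → Set
DescribedBy {d} k X =
  Σ[ A ∈ Matrix k d ] Σ[ b ∈ Point k ]
  ∃[ l ] Σ[ U ∈ Matrix l d ] Σ[ v ∈ Point l ]
  ∀ x → x ∈ X ⇔ ((∀ i → (A · ι x) i ≤ b i) × U · ι x ≋ v)

-- The minimum is specified as a relation: DescribedBy k X quantifies over real
-- matrices, so there is no evident constructive search for the least k.
IsRC : ∀ {d} → LatticeSet d → ℕ → Set
IsRC X r = DescribedBy r X × (∀ k → DescribedBy k X → r ℕ.≤ k)

-- The relational form loses nothing constructively: a lower bound on rc(X)
-- bounds the size of every description of X.
rc-lower-bound : ∀ {d} (X : LatticeSet d) m →
  (∀ r → IsRC X r → m ℕ.≤ r) → ∀ k → DescribedBy k X → m ℕ.≤ k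
rc-lower-bound X m lb k D =
  decidable-stable (m ℕ.≤? k) λ m≰k → none k (ℕ.≰⇒> m≰k) D
  where
  none : ∀ k → k ℕ.< m → ¬ DescribedBy k X
  none = <-rec (λ k → k ℕ.< m → ¬ DescribedBy k X) λ k rec k<m Dk →
    ℕ.<⇒≱ k<m (lb k (Dk , λ l Dl → ℕ.≮⇒≥ λ l<k → rec l<k (ℕ.<-trans l<k k<m) Dl))

module Submission where

open import Defs
open import Data.Bool.Base using (if_then_else_)
open import Data.Empty using (⊥; ⊥-elim)
open import Data.Fin.Base using (Fin; zero; suc; toℕ; fromℕ; fromℕ<; inject₁; punchIn; punchOut; combine; remQuot; finToFun; funToFin; inject≤)
import Data.Fin.Properties as Fin
open import Data.Integer.Base as ℤ using (ℤ; +_; -[1+_]; 0ℤ; 1ℤ)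
import Data.Integer.Properties as ℤ
open import Data.Integer.DivMod using (_%ℕ_; _/ℕ_; n%ℕd<d; a≡a%ℕn+[a/ℕn]*n)
open import Data.Integer.Tactic.RingSolver using (solve-∀)
open import Data.List.Base as List using (List; []; _∷_; _++_; length; cartesianProductWith)
open import Data.List.Membership.Propositional using (find)
import Data.List.Membership.Propositional.Properties as Mem
open import Data.List.Relation.Unary.All as All using (All; []; _∷_)
open import Data.List.Relation.Unary.AllPairs using (AllPairs; []; _∷_)
open import Data.List.Relation.Unary.Any as Any using (Any)
import Data.List.Relation.Unary.Any.Properties as Any
open import Data.Nat.Base as ℕ using (ℕ; zero; suc; z≤n; s≤s)
import Data.Nat.Properties as ℕ
open import Data.Product.Base using (∃; ∃₂; _×_; _,_; proj₁; proj₂)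
open import Data.Rational.Base as ℚ using (ℚ; 0ℚ; 1ℚ; ½; mkℚ)
import Data.Rational.Properties as ℚ
open import Data.Rational.Solver using (module +-*-Solver)
import Data.Rational.Unnormalised.Base as ℚᵘ
import Data.Rational.Unnormalised.Properties as ℚᵘ
open import Data.Sum.Base using (_⊎_; inj₁; inj₂; [_,_]′)
open import Data.Vec.Base using (lookup; tabulate)
open import Data.Vec.Properties using (lookup∘tabulate)
open import Function.Base using (_∘_)
open import Function.Bundles using (Equivalence)
open import Relation.Binary.PropositionalEquality
  using (_≡_; _≢_; _≗_; refl; sym; trans; cong; cong₂; subst; subst₂; module ≡-Reasoning)
open import Relation.Nullary using (¬_; Dec; yes; no; does; ¬¬-excluded-middle; decidable-stable)
open import Relation.Nullary.Decidable using (_⊎-dec_; _→-dec_; dec-true; dec-false; from-yes)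
open import Algebra.Bundles using (CommutativeRing)
import Algebra.Properties.Semiring.Sum ℤ.+-*-semiring as ∑
import Algebra.Properties.Semiring.Sum (CommutativeRing.semiring ℚ.+-*-commutativeRing) as ∑ℚ

-- Suppose d ≤ 4 inequalities cut a finite full-dimensional X out of ℤ^d. If no integer direction is
-- a recession direction, Dirichlet's theorem gives nonzero integer vectors z on which all d linear
-- forms are arbitrarily small. At every x ∈ X some form of a tight row must be strictly positive on
-- z and some strictly negative: otherwise x + z or x - z lies in X again, and as X is finite and z
-- short, ± z is a recession direction.
-- Hence every point has at least two tight rows, and for d ≤ 3 two of d + 1 affinely independent
-- points have all rows but one in common, so that their difference is a recession direction.
-- For d = 4, take five affinely independent points. Two forms are positive and two negative on z,
-- and no three of the points share two tight rows. Two short vectors w₁, w₂ that are independent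
-- modulo 2 leave four classes of ℤ⁴ modulo 2ℤ⁴ + ⟨w₁, w₂⟩, so two of any five lattice points have a
-- midpoint that is a lattice point up to a short vector. If their common tight rows do not have both
-- signs, adding ± z to the midpoint gives a lattice point interior to the polyhedron, which is
-- impossible. So congruent points lie on a common edge; a lattice point near the middle of that edge
-- in another class replaces one of them, and doing this twice yields five pairwise incongruent points.

-- Signs of constructive reals are undecidable, but the goal is a contradiction, so every case
-- distinction may be made under a double negation. Thresholds for "short" are integer vectors
-- compared through the cones; the extra coordinate on which all rows are positive guarantees that
-- thresholds exist. Dirichlet's theorem wants more vectors than forms, whereas d + 1 points give d
-- differences for d rows; the absence of recession directions makes up for the missing vector. In
-- dimension four two tight rows leave two others, so counting the exceptional row no longer works.
-- The argument runs on separated scales instead: on each row `z₀` is 64 times below the slack `η`,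
-- and `w₁`, `w₂` are 16 times below `z₀`. A midpoint corrected by the `wᵢ` then violates a row by
-- less than |z₀|, and a single shift by ± z₀ repairs every row. The second short vector is chosen
-- far below the first, which makes both independent of every edge direction; this is what lets a
-- walk along an edge leave its class. Two replacements suffice because congruent pairs of points
-- are disjoint and five indices have room for two of them.

infixl 1 _>>=_

_>>=_ : ∀ {A B : Set} → ¬ ¬ A → (A → ¬ ¬ B) → ¬ ¬ B
(m >>= f) k = m λ a → f a k

return : ∀ {A : Set} → A → ¬ ¬ A
return a k = k a

em : (A : Set) → ¬ ¬ Dec A
em A = ¬¬-excluded-middle

-- Finiteness of the index is what lets a double negation pass through the product: the choices are
-- collected one by one.
¬¬-Π : ∀ {n} {B : Fin n → Set} → (∀ i → ¬ ¬ B i) → ¬ ¬ (∀ i → B i)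
¬¬-Π {zero} f k = k λ ()
¬¬-Π {suc n} f = do
  b ← f zero
  bs ← ¬¬-Π (f ∘ suc)
  return λ { zero → b ; (suc i) → bs i }

-- Integer vectors

V : ℕ → Set
V n = Fin n → ℤ

infixl 6 _⊕_ _⊖_
infix  8 ⊝_
infixr 7 _•_

𝟘 : ∀ {n} → V n
𝟘 _ = 0ℤ

_⊕_ _⊖_ : ∀ {n} → V n → V n → V n
(u ⊕ v) j = u j ℤ.+ v j
(u ⊖ v) j = u j ℤ.- v j

⊝_ : ∀ {n} → V n → V n
(⊝ v) j = ℤ.- v j

_•_ : ∀ {n} → ℤ → V n → V n
(a • v) j = a ℤ.* v j

lin : ∀ {m n} → V m → (Fin m → V n) → V n
lin c g j = ∑.sum λ i → c i ℤ.* g i j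

NonZero : ∀ {n} → V n → Set
NonZero v = ∃ λ i → v i ≢ 0ℤ

lin-⊕ : ∀ {m n} (a b : V m) (g : Fin m → V n) → lin (a ⊕ b) g ≗ lin a g ⊕ lin b g
lin-⊕ a b g j = trans (∑.sum-cong-≗ λ i → ℤ.*-distribʳ-+ (g i j) (a i) (b i))
                      (∑.∑-distrib-+ (λ i → a i ℤ.* g i j) (λ i → b i ℤ.* g i j))

lin-• : ∀ {m n} k (a : V m) (g : Fin m → V n) → lin (k • a) g ≗ k • lin a g
lin-• k a g j = trans (∑.sum-cong-≗ λ i → ℤ.*-assoc k (a i) (g i j))
                      (sym (∑.*-distribˡ-sum k λ i → a i ℤ.* g i j))

lin-⊝ : ∀ {m n} (a : V m) (g : Fin m → V n) → lin (⊝ a) g ≗ ⊝ lin a g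
lin-⊝ {m} a g j = begin
    lin (⊝ a) g j                ≡⟨ ∑.sum-cong-≗ {m} (λ i → eq (a i) (g i j)) ⟩
    lin (ℤ.- 1ℤ • a) g j         ≡⟨ lin-• (ℤ.- 1ℤ) a g j ⟩
    ℤ.- 1ℤ ℤ.* lin a g j         ≡⟨ ℤ.-1*i≡-i (lin a g j) ⟩
    ℤ.- lin a g j                ∎
  where
  open ≡-Reasoning
  eq : ∀ x y → (ℤ.- x) ℤ.* y ≡ (ℤ.- 1ℤ ℤ.* x) ℤ.* y
  eq = solve-∀

lin-⊖ : ∀ {m n} (a b : V m) (g : Fin m → V n) → lin (a ⊖ b) g ≗ lin a g ⊖ lin b g
lin-⊖ a b g j = trans (lin-⊕ a (⊝ b) g j) (cong (ℤ._+_ (lin a g j)) (lin-⊝ b g j))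

lin-gen-⊝ : ∀ {m n} (a : V m) (g : Fin m → V n) → lin a (λ i → ⊝ g i) ≗ ⊝ lin a g
lin-gen-⊝ {m} a g j = trans (∑.sum-cong-≗ {m} λ i → eq (a i) (g i j)) (lin-⊝ a g j)
  where
  eq : ∀ x y → x ℤ.* (ℤ.- y) ≡ (ℤ.- x) ℤ.* y
  eq = solve-∀

lin-gen-• : ∀ {m n} k (a : V m) (g : Fin m → V n) → lin a (λ i → k • g i) ≗ k • lin a g
lin-gen-• {m} k a g j = trans (∑.sum-cong-≗ {m} λ i → eq k (a i) (g i j)) (lin-• k a g j)
  where
  eq : ∀ k x y → x ℤ.* (k ℤ.* y) ≡ (k ℤ.* x) ℤ.* y
  eq = solve-∀

lin-lin : ∀ {l m n} (a : V l) (b : Fin l → V m) (g : Fin m → V n) →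
          lin (lin a b) g ≗ lin a (λ i → lin (b i) g)
lin-lin {l} {m} a b g j = begin
    ∑.sum (λ i → ∑.sum (λ k → a k ℤ.* b k i) ℤ.* g i j)
      ≡⟨ ∑.sum-cong-≗ {m} (λ i → ∑.*-distribʳ-sum (g i j) λ k → a k ℤ.* b k i) ⟩
    ∑.sum (λ i → ∑.sum (λ k → a k ℤ.* b k i ℤ.* g i j))
      ≡⟨ ∑.∑-comm {m} {l} (λ i k → a k ℤ.* b k i ℤ.* g i j) ⟩
    ∑.sum (λ k → ∑.sum (λ i → a k ℤ.* b k i ℤ.* g i j))
      ≡⟨ ∑.sum-cong-≗ {l} (λ k → trans (∑.sum-cong-≗ {m} λ i → ℤ.*-assoc (a k) (b k i) (g i j))
           (sym (∑.*-distribˡ-sum (a k) λ i → b k i ℤ.* g i j))) ⟩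
    ∑.sum (λ k → a k ℤ.* ∑.sum (λ i → b k i ℤ.* g i j)) ∎
  where open ≡-Reasoning

δ : ∀ {n} → Fin n → V n
δ zero    zero    = 1ℤ
δ zero    (suc j) = 0ℤ
δ (suc i) zero    = 0ℤ
δ (suc i) (suc j) = δ i j

δ-same : ∀ {n} (i : Fin n) → δ i i ≡ 1ℤ
δ-same zero    = refl
δ-same (suc i) = δ-same i

δ-diff : ∀ {n} {i j : Fin n} → i ≢ j → δ i j ≡ 0ℤ
δ-diff {i = zero}  {zero}  i≢j = ⊥-elim (i≢j refl)
δ-diff {i = zero}  {suc j} i≢j = refl
δ-diff {i = suc i} {zero}  i≢j = refl
δ-diff {i = suc i} {suc j} i≢j = δ-diff (i≢j ∘ cong suc)

lin-𝟘 : ∀ {m n} (g : Fin m → V n) → lin 𝟘 g ≗ 𝟘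
lin-𝟘 {m} g j = trans (∑.sum-cong-≗ {m} λ i → ℤ.*-zeroˡ (g i j)) (∑.sum-replicate-zero m)

lin-δ : ∀ {m n} (i : Fin m) (g : Fin m → V n) → lin (δ i) g ≗ g i
lin-δ zero g j = trans (cong (ℤ._+_ (1ℤ ℤ.* g zero j)) (lin-𝟘 (g ∘ suc) j)) (eq (g zero j))
  where
  eq : ∀ x → 1ℤ ℤ.* x ℤ.+ 0ℤ ≡ x
  eq = solve-∀
lin-δ (suc i) g j = trans (cong (ℤ._+_ (0ℤ ℤ.* g zero j)) (lin-δ i (g ∘ suc) j)) (eq (g zero j) (g (suc i) j))
  where
  eq : ∀ x y → 0ℤ ℤ.* x ℤ.+ y ≡ y
  eq = solve-∀

lin-cong : ∀ {m n} {a b : V m} (g : Fin m → V n) → a ≗ b → lin a g ≗ lin b g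
lin-cong {m} g a≗b j = ∑.sum-cong-≗ {m} λ i → cong (ℤ._* g i j) (a≗b i)

≢⇒NonZero : ∀ {n} {v : V n} → ¬ (v ≗ 𝟘) → NonZero v
≢⇒NonZero {n} {v} = Fin.¬∀⟶∃¬ n (λ i → v i ≡ 0ℤ) (λ i → v i ℤ.≟ 0ℤ)

Indep : ∀ {m n} → (Fin m → V n) → Set
Indep g = ∀ c → lin c g ≗ 𝟘 → c ≗ 𝟘

1≢0 : 1ℤ ≢ 0ℤ
1≢0 ()

fin-bound : ∀ {k} (f : Fin k → ℕ) → ∃ λ B → ∀ i → f i ℕ.≤ B
fin-bound {zero} f = 0 , λ ()
fin-bound {suc k} f with fin-bound (f ∘ suc)
... | B , p = f zero ℕ.⊔ B , λ { zero → ℕ.m≤m⊔n (f zero) B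
                               ; (suc i) → ℕ.≤-trans (p i) (ℕ.m≤n⊔m (f zero) B) }

-- Simultaneous approximation

-- C ∋ v stands for f v ≥ 0 with f a real functional, so that the arithmetic of the proof takes place
-- in ℤⁿ. Signs of reals are only decidable under double negation.
record Cone (n : ℕ) : Set₁ where
  infix 4 _∋_
  field
    _∋_    : V n → Set
    resp   : ∀ {u v} → u ≗ v → _∋_ u → _∋_ v
    add    : ∀ {u v} → _∋_ u → _∋_ v → _∋_ (u ⊕ v)
    total  : ∀ {v} → ¬ _∋_ v → _∋_ (⊝ v)
    stable : ∀ {v} → ¬ ¬ _∋_ v → _∋_ v
    arch   : ∀ {v} → ¬ _∋_ (⊝ v) → ∀ u → ¬ ¬ ∃ λ (k : ℕ) → _∋_ (+ k • v ⊕ u)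

  Pos Null : V n → Set
  Pos v  = ¬ _∋_ (⊝ v)
  Null v = _∋_ v × _∋_ (⊝ v)

  0∈ : _∋_ 𝟘
  0∈ = stable λ ∌0 → ∌0 (resp (λ _ → refl) (total ∌0))

  total⁻ : ∀ {v} → ¬ _∋_ (⊝ v) → _∋_ v
  total⁻ {v} ∌ = resp (λ j → ℤ.neg-involutive (v j)) (total ∌)

  mul∈ : ∀ k {v} → _∋_ v → _∋_ (+ k • v)
  mul∈ zero    {v} p = resp (λ j → sym (ℤ.*-zeroˡ (v j))) 0∈
  mul∈ (suc k) {v} p = resp (λ j → sym (ℤ.suc-* (+ k) (v j))) (add p (mul∈ k p))

  -- If v were outside, `total` would put -v inside, and adding k copies of it to (k + 1)v would
  -- give v back.
  div∈ : ∀ k {v} → _∋_ (+ suc k • v) → _∋_ v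
  div∈ k {v} p = stable λ ∌v →
    ∌v (resp (λ j → eq (+ k) (v j)) (add p (mul∈ k (total ∌v))))
    where
    eq : ∀ k x → (1ℤ ℤ.+ k) ℤ.* x ℤ.+ k ℤ.* (ℤ.- x) ≡ x
    eq = solve-∀

  arch-mono : ∀ {k l η u} → k ℕ.≤ l → _∋_ η → _∋_ (+ k • η ⊕ u) → _∋_ (+ l • η ⊕ u)
  arch-mono {k} {l} {η} {u} k≤l η∈ p =
    resp (λ j → trans (eq (+ k) (+ (l ℕ.∸ k)) (η j) (u j))
                      (cong (λ t → t ℤ.* η j ℤ.+ u j) (cong +_ (ℕ.m+[n∸m]≡n k≤l))))
         (add p (mul∈ (l ℕ.∸ k) η∈))
    where
    eq : ∀ k d x y → (k ℤ.* x ℤ.+ y) ℤ.+ d ℤ.* x ≡ (k ℤ.+ d) ℤ.* x ℤ.+ y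
    eq = solve-∀

  sum∈ : ∀ {m} (g : Fin m → V n) → (∀ i → _∋_ (g i)) → _∋_ (λ j → ∑.sum λ i → g i j)
  sum∈ {zero}  g p = 0∈
  sum∈ {suc m} g p = add (p zero) (sum∈ (g ∘ suc) (p ∘ suc))

  -- Each term aᵢ(Bη + gᵢ) is topped up by (N - aᵢ)Bη, which makes the bound independent of the
  -- coefficients.
  lin-bound : ∀ {m} (N B : ℕ) (η : V n) (a : Fin m → ℕ) (g : Fin m → V n) → _∋_ η →
              (∀ i → a i ℕ.≤ N) → (∀ i → _∋_ (+ B • η ⊕ g i)) →
              _∋_ (+ (m ℕ.* (N ℕ.* B)) • η ⊕ lin (λ i → + a i) g)
  lin-bound {zero}  N B η a g η∈ a≤N p = resp (λ j → cong (ℤ._+ 0ℤ) (sym (ℤ.*-zeroˡ (η j)))) 0∈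
  lin-bound {suc m} N B η a g η∈ a≤N p =
    resp (λ j → eq′ j)
      (add (add (mul∈ (a zero) (p zero)) (mul∈ (N ℕ.∸ a zero) (mul∈ B η∈)))
           (lin-bound {m} N B η (a ∘ suc) (g ∘ suc) η∈ (a≤N ∘ suc) (p ∘ suc)))
    where
    rest : V n
    rest = lin (λ i → + a (suc i)) (g ∘ suc)
    T : ℕ
    T = m ℕ.* (N ℕ.* B)
    eq : ∀ a d b x y t z →
         (a ℤ.* (b ℤ.* x ℤ.+ y) ℤ.+ d ℤ.* (b ℤ.* x)) ℤ.+ (t ℤ.* x ℤ.+ z) ≡
         ((a ℤ.+ d) ℤ.* b ℤ.+ t) ℤ.* x ℤ.+ (a ℤ.* y ℤ.+ z)
    eq = solve-∀
    coef : (+ a zero ℤ.+ + (N ℕ.∸ a zero)) ℤ.* + B ℤ.+ + T ≡ + (N ℕ.* B ℕ.+ T)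
    coef = cong (ℤ._+ + T) (trans (cong (λ t → + t ℤ.* + B) (ℕ.m+[n∸m]≡n (a≤N zero))) (sym (ℤ.pos-* N B)))
    eq′ : ∀ j → _ ≡ _
    eq′ j = trans (eq (+ a zero) (+ (N ℕ.∸ a zero)) (+ B) (η j) (g zero j) (+ T) (rest j))
                  (cong (λ t → t ℤ.* η j ℤ.+ lin (λ i → + a i) g j) coef)

  -- The sign of r - tη cannot be computed, so the interval of length η that contains r is found by
  -- descending from M with excluded middle.
  cell : ∀ M {η r} → _∋_ r → ¬ _∋_ (r ⊖ + M • η) →
         ¬ ¬ ∃ λ (t : Fin M) → _∋_ (r ⊖ + toℕ t • η) × (¬ _∋_ (r ⊖ + suc (toℕ t) • η))
  cell zero {η} {r} r∈ r< = ⊥-elim (r< (resp (λ j → eq (r j) (η j)) r∈))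
    where
    eq : ∀ x y → x ≡ x ℤ.- 0ℤ ℤ.* y
    eq = solve-∀
  cell (suc M) {η} {r} r∈ r< = em (_∋_ (r ⊖ + M • η)) >>= λ
    { (yes p) → return (fromℕ M
                , subst (λ t → _∋_ (r ⊖ + t • η)) (sym (Fin.toℕ-fromℕ M)) p
                , subst (λ t → ¬ _∋_ (r ⊖ + suc t • η)) (sym (Fin.toℕ-fromℕ M)) r<)
    ; (no ¬p) → cell M r∈ ¬p >>= λ (t , p , q) → return (inject₁ t
                , subst (λ t → _∋_ (r ⊖ + t • η)) (sym (Fin.toℕ-inject₁ t)) p
                , subst (λ t → ¬ _∋_ (r ⊖ + suc t • η)) (sym (Fin.toℕ-inject₁ t)) q) }

open Cone public using (_∋_; Pos; Null)

-- |v| < η in the order given by C.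
record Small {n} (C : Cone n) (η v : V n) : Set where
  constructor _,_
  field
    upper : ¬ C ∋ v ⊖ η
    lower : ¬ C ∋ ⊝ v ⊖ η

module _ {n} (C : Cone n) where
  open Cone C hiding (_∋_; Pos; Null)

  small-⊝ : ∀ {η v} → Small C η v → Small C η (⊝ v)
  small-⊝ {η} {v} (p , q) = q , λ r → p (resp (λ j → cong (ℤ._- η j) (ℤ.neg-involutive (v j))) r)

  small-resp : ∀ {η u v} → u ≗ v → Small C η u → Small C η v
  small-resp {η} u≗v (p , q) =
    (λ r → p (resp (λ j → cong (ℤ._- η j) (sym (u≗v j))) r)) ,
    (λ r → q (resp (λ j → cong (λ x → ℤ.- x ℤ.- η j) (sym (u≗v j))) r))

  small⁺ : ∀ {η v} → Small C η v → C ∋ η ⊕ v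
  small⁺ {η} {v} (p , q) = total⁻ λ r → q (resp (λ j → eq (η j) (v j)) r)
    where
    eq : ∀ x y → ℤ.- (x ℤ.+ y) ≡ ℤ.- y ℤ.- x
    eq = solve-∀

  small⁻ : ∀ {η v} → Small C η v → C ∋ η ⊖ v
  small⁻ {η} {v} (p , q) = total⁻ λ r → p (resp (λ j → eq (η j) (v j)) r)
    where
    eq : ∀ x y → ℤ.- (x ℤ.- y) ≡ y ℤ.- x
    eq = solve-∀


-- There are N^m coefficient vectors and (2T + 1)^k boxes. As 2T + 1 ≤ K·N with K independent of N,
-- the choice N = K^k + 1 gives (K·N)^k < N·N^k ≤ N^m.
pow-bound : ∀ {k m} B → k ℕ.< m →
  let N = suc (suc (2 ℕ.* (m ℕ.* B)) ℕ.^ k)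
      T = m ℕ.* (N ℕ.* B)
  in suc (T ℕ.+ T) ℕ.^ k ℕ.< N ℕ.^ m
pow-bound {k} {m} B k<m = begin-strict
    suc (T ℕ.+ T) ℕ.^ k   ≤⟨ ℕ.^-monoˡ-≤ k M≤ ⟩
    (K ℕ.* N) ℕ.^ k       ≡⟨ ^-distribʳ-* k ⟩
    K ℕ.^ k ℕ.* N ℕ.^ k   <⟨ ℕ.*-monoˡ-< (N ℕ.^ k) ⦃ ℕ.m^n≢0 N k ⦄ (ℕ.n<1+n (K ℕ.^ k)) ⟩
    N ℕ.* N ℕ.^ k         ≤⟨ ℕ.^-monoʳ-≤ N k<m ⟩
    N ℕ.^ m               ∎
  where
  open ℕ.≤-Reasoning
  K N T : ℕ
  K = suc (2 ℕ.* (m ℕ.* B))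
  N = suc (K ℕ.^ k)
  T = m ℕ.* (N ℕ.* B)
  ^-distribʳ-* : ∀ e → (K ℕ.* N) ℕ.^ e ≡ K ℕ.^ e ℕ.* N ℕ.^ e
  ^-distribʳ-* zero    = refl
  ^-distribʳ-* (suc e) = trans (cong ((K ℕ.* N) ℕ.*_) (^-distribʳ-* e))
                               (ℕ.[m*n]*[o*p]≡[m*o]*[n*p] K N (K ℕ.^ e) (N ℕ.^ e))
  T≡ : T ≡ (m ℕ.* B) ℕ.* N
  T≡ = trans (cong (m ℕ.*_) (ℕ.*-comm N B)) (sym (ℕ.*-assoc m B N))
  M≤ : suc (T ℕ.+ T) ℕ.≤ K ℕ.* N
  M≤ = ℕ.+-mono-≤ (s≤s (z≤n {K ℕ.^ k})) (ℕ.≤-reflexive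
    (trans (cong₂ ℕ._+_ T≡ T≡) (trans (sym (ℕ.*-distribʳ-+ N (m ℕ.* B) (m ℕ.* B)))
      (cong (λ t → (m ℕ.* B ℕ.+ t) ℕ.* N) (sym (ℕ.+-identityʳ (m ℕ.* B)))))))

module Dirichlet {n m k} (k<m : k ℕ.< m) (C : Fin k → Cone n) (η : Fin k → V n)
                 (pos : ∀ j → Pos (C j) (η j)) (g : Fin m → V n) where
  module C j = Cone (C j)

  Bounded : ℕ → Set
  Bounded B = ∀ j i → C j ∋ + B • η j ⊕ g i × C j ∋ + B • η j ⊕ ⊝ g i

  η∈ : ∀ j → C j ∋ η j
  η∈ j = C.total⁻ j (pos j)

  bounded : ¬ ¬ ∃ Bounded
  bounded = do
    b ← ¬¬-Π λ j → ¬¬-Π λ i → C.arch j (pos j) (g i) >>= λ p → C.arch j (pos j) (⊝ g i) >>= λ q →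
          return {∃ λ B → C j ∋ + B • η j ⊕ g i × C j ∋ + B • η j ⊕ ⊝ g i}
            (proj₁ p ℕ.⊔ proj₁ q
            , C.arch-mono j (ℕ.m≤m⊔n (proj₁ p) (proj₁ q)) (η∈ j) (proj₂ p)
            , C.arch-mono j (ℕ.m≤n⊔m (proj₁ p) (proj₁ q)) (η∈ j) (proj₂ q))
    let row = λ j → fin-bound (λ i → proj₁ (b j i))
        all = fin-bound (λ j → proj₁ (row j))
        ≤B  = λ j i → ℕ.≤-trans (proj₂ (row j) i) (proj₂ all j)
    return (proj₁ all , λ j i → C.arch-mono j (≤B j i) (η∈ j) (proj₁ (proj₂ (b j i)))
                              , C.arch-mono j (≤B j i) (η∈ j) (proj₂ (proj₂ (b j i))))

  module Boxes (B : ℕ) (bnd : Bounded B) where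
    N T M : ℕ
    N = suc (suc (2 ℕ.* (m ℕ.* B)) ℕ.^ k)
    T = m ℕ.* (N ℕ.* B)
    M = suc (T ℕ.+ T)

    coord : Fin (N ℕ.^ m) → Fin m → ℕ
    coord x i = toℕ (finToFun x i)

    coord≤ : ∀ x i → coord x i ℕ.≤ N
    coord≤ x i = ℕ.<⇒≤ (Fin.toℕ<n (finToFun x i))

    a : Fin (N ℕ.^ m) → V m
    a x i = + coord x i

    -- The combination has absolute value at most Tη; the shift by Tη moves it into [0, Mη), where M
    -- = 2T + 1 makes the right end strict.
    r : Fin (N ℕ.^ m) → Fin k → V n
    r x j = + T • η j ⊕ lin (a x) g

    r∈ : ∀ x j → C j ∋ r x j
    r∈ x j = C.lin-bound j N B (η j) (coord x) g (η∈ j) (coord≤ x) (λ i → proj₁ (bnd j i))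

    r< : ∀ x j → ¬ C j ∋ (r x j ⊖ + M • η j)
    r< x j p = pos j (C.resp j (λ l → trans
        (cong (λ t → + T ℤ.* η j l ℤ.+ lin (a x) g l ℤ.- + M ℤ.* η j l ℤ.+ (+ T ℤ.* η j l ℤ.+ t))
              (lin-gen-⊝ (a x) g l))
        (eq (+ T) (η j l) (lin (a x) g l)))
      (C.add j p (C.lin-bound j N B (η j) (coord x) (λ i → ⊝ g i) (η∈ j) (coord≤ x) (λ i → proj₂ (bnd j i)))))
      where
      eq : ∀ t x y → t ℤ.* x ℤ.+ y ℤ.- (1ℤ ℤ.+ (t ℤ.+ t)) ℤ.* x ℤ.+ (t ℤ.* x ℤ.+ (ℤ.- y)) ≡ ℤ.- x
      eq = solve-∀

    CellOf : Fin k → Fin (N ℕ.^ m) → Fin M → Set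
    CellOf j x t = C j ∋ r x j ⊖ + toℕ t • η j × (¬ C j ∋ (r x j ⊖ + suc (toℕ t) • η j))

    same-cell : ∀ j x y t → CellOf j x t → CellOf j y t → ¬ C j ∋ (lin (a x ⊖ a y) g ⊖ η j)
    same-cell j x y t (_ , x<) (≤y , _) p = x< (C.resp j (λ l → trans
        (cong (λ s → + T ℤ.* η j l ℤ.+ lin (a y) g l ℤ.- + toℕ t ℤ.* η j l ℤ.+ (s ℤ.- η j l)) (lin-⊖ (a x) (a y) g l))
        (eq (+ T) (+ toℕ t) (η j l) (lin (a x) g l) (lin (a y) g l))) (C.add j ≤y p))
      where
      eq : ∀ T t e x y → T ℤ.* e ℤ.+ y ℤ.- t ℤ.* e ℤ.+ (x ℤ.- y ℤ.- e) ≡ T ℤ.* e ℤ.+ x ℤ.- (1ℤ ℤ.+ t) ℤ.* e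
      eq = solve-∀

    result : ¬ ¬ ∃ λ c → NonZero c × ∀ j → Small (C j) (η j) (lin c g)
    result = do
      cells ← ¬¬-Π λ j → ¬¬-Π λ x → C.cell j M (r∈ x j) (r< x j)
      let code = λ x → funToFin (λ j → proj₁ (cells j x))
          (x , y , x<y , eq) = Fin.pigeonhole (pow-bound B k<m) code
          x≢y = λ (x≡y : x ≡ y) → Fin.<⇒≢ x<y x≡y
          t≡ = λ j → trans (sym (Fin.finToFun-funToFin (λ j → proj₁ (cells j x)) j))
                 (trans (cong (λ u → finToFun u j) eq) (Fin.finToFun-funToFin (λ j → proj₁ (cells j y)) j))
          inX = λ j → proj₂ (cells j x)
          inY = λ j → subst (CellOf j y) (sym (t≡ j)) (proj₂ (cells j y))
      return (a x ⊖ a y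
        , ≢⇒NonZero (λ a≗ → x≢y (trans (sym (Fin.funToFin-finToFin {m} {N} x)) (trans
            (funToFin-cong λ i → Fin.toℕ-injective (ℤ.+-injective (ℤ.i-j≡0⇒i≡j _ _ (a≗ i))))
            (Fin.funToFin-finToFin {m} {N} y))))
        , λ j → same-cell j x y (proj₁ (cells j x)) (inX j) (inY j)
              , λ p → same-cell j y x (proj₁ (cells j x)) (inY j) (inX j) (C.resp j (λ l → cong (ℤ._- η j l)
                        (trans (cong ℤ.-_ (lin-⊖ (a x) (a y) g l))
                          (trans (neg-swap (lin (a x) g l) (lin (a y) g l)) (sym (lin-⊖ (a y) (a x) g l))))) p))
      where
      funToFin-cong : ∀ {m N} {f h : Fin m → Fin N} → f ≗ h → funToFin f ≡ funToFin h
      funToFin-cong {zero}  f≗h = refl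
      funToFin-cong {suc m} f≗h = cong₂ combine (f≗h zero) (funToFin-cong (f≗h ∘ suc))
      neg-swap : ∀ x y → ℤ.- (x ℤ.- y) ≡ y ℤ.- x
      neg-swap = solve-∀

-- Only the coefficients are claimed to be nonzero. That the combination itself does not vanish is
-- argued at each use, from the independence of the family.
dirichlet : ∀ {n m k} → k ℕ.< m → (C : Fin k → Cone n) (η : Fin k → V n) →
            (∀ j → Pos (C j) (η j)) → (g : Fin m → V n) →
            ¬ ¬ ∃ λ c → NonZero c × ∀ j → Small (C j) (η j) (lin c g)
dirichlet k<m C η pos g = bounded >>= λ (B , bnd) → Boxes.result B bnd
  where open Dirichlet k<m C η pos g

-- Vectors that are small or null in the order of a cone

module _ {n} (C : Cone n) where
  open Cone C hiding (_∋_; Pos; Null)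

  small-mono : ∀ {η θ v} → C ∋ θ ⊖ η → Small C η v → Small C θ v
  small-mono {η} {θ} {v} η≤θ (p , q) =
    (λ r → p (resp (λ j → eq (v j) (θ j) (η j)) (add r η≤θ))) ,
    (λ r → q (resp (λ j → eq (ℤ.- v j) (θ j) (η j)) (add r η≤θ)))
    where
    eq : ∀ v θ η → v ℤ.- θ ℤ.+ (θ ℤ.- η) ≡ v ℤ.- η
    eq = solve-∀

  pos∈ : ∀ {v} → Pos C v → C ∋ v
  pos∈ = total⁻

  -- A multiple of u above η > 0 forces u itself to be nonnegative, so every larger multiple is
  -- above η too. This is applied to v and to -v.
  small-∣ : ∀ {k l η v} → k ℕ.≤ l → Pos C η → Small C η (+ l • v) → Small C η (+ k • v)
  small-∣ {k} {l} {η} {v} k≤l pη (p , q) =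
    (λ r → p (bigger v r)) ,
    (λ r → q (resp (λ j → cong (ℤ._- η j) (sym (ℤ.neg-distribʳ-* (+ l) (v j))))
      (bigger (⊝ v) (resp (λ j → cong (ℤ._- η j) (ℤ.neg-distribʳ-* (+ k) (v j))) r))))
    where
    l≡ : + k ℤ.+ + (l ℕ.∸ k) ≡ + l
    l≡ = cong +_ (ℕ.m+[n∸m]≡n k≤l)
    eq : ∀ k d x e → k ℤ.* x ℤ.- e ℤ.+ d ℤ.* x ≡ (k ℤ.+ d) ℤ.* x ℤ.- e
    eq = solve-∀
    eq₀ : ∀ k x e → k ℤ.* x ℤ.- e ℤ.+ e ≡ k ℤ.* x
    eq₀ = solve-∀
    base : ∀ k u → C ∋ + k • u ⊖ η → C ∋ u
    base zero u r = ⊥-elim (pη (resp (λ j → trans (cong (ℤ._- η j) (ℤ.*-zeroˡ (u j))) (ℤ.+-identityˡ (ℤ.- η j))) r))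
    base (suc k) u r = div∈ k (resp (λ j → eq₀ (+ suc k) (u j) (η j)) (add r (pos∈ pη)))
    bigger : ∀ u → C ∋ + k • u ⊖ η → C ∋ + l • u ⊖ η
    bigger u r = resp (λ j → trans (eq (+ k) (+ (l ℕ.∸ k)) (u j) (η j)) (cong (λ t → t ℤ.* u j ℤ.- η j) l≡))
                   (add r (mul∈ (l ℕ.∸ k) (base k u r)))

  null-• : ∀ a {v} → Null C v → Null C (a • v)
  null-• a {v} (p , q) = go a , resp (λ j → sym (ℤ.neg-distribˡ-* a (v j))) (go (ℤ.- a))
    where
    eq : ∀ a x → a ℤ.* (ℤ.- x) ≡ (ℤ.- a) ℤ.* x
    eq = solve-∀
    go : ∀ a → C ∋ a • v
    go (+ a)    = mul∈ a p
    go -[1+ a ] = resp (λ j → eq (+ suc a) (v j)) (mul∈ (suc a) q)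

  null-𝟘 : Null C 𝟘
  null-𝟘 = 0∈ , resp (λ _ → refl) 0∈

  null-resp : ∀ {u v} → u ≗ v → Null C u → Null C v
  null-resp u≗v (p , q) = resp u≗v p , resp (λ j → cong ℤ.-_ (u≗v j)) q

  null-div : ∀ a {v} → a ≢ 0ℤ → Null C (a • v) → Null C v
  null-div (+ zero)  a≢0 _ = ⊥-elim (a≢0 refl)
  null-div (+ suc a) {v} _ (p , q) = div∈ a p , div∈ a (resp (λ j → ℤ.neg-distribʳ-* (+ suc a) (v j)) q)
  null-div -[1+ a ]  {v} _ (p , q) =
    div∈ a (resp (λ j → eq (+ suc a) (v j)) q) , div∈ a (resp (λ j → eq′ (+ suc a) (v j)) p)
    where
    eq : ∀ a x → ℤ.- ((ℤ.- a) ℤ.* x) ≡ a ℤ.* x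
    eq = solve-∀
    eq′ : ∀ a x → (ℤ.- a) ℤ.* x ≡ a ℤ.* (ℤ.- x)
    eq′ = solve-∀

  null-lin : ∀ {m} (c : V m) (h : Fin m → V n) → (∀ l → Null C (h l)) → Null C (lin c h)
  null-lin {zero}  c h nh = null-𝟘
  null-lin {suc m} c h nh =
    let (p , q) = null-• (c zero) (nh zero)
        (p′ , q′) = null-lin (c ∘ suc) (h ∘ suc) (nh ∘ suc)
    in add p p′ , resp (λ j → sym (ℤ.neg-distrib-+ (c zero ℤ.* h zero j) (lin (c ∘ suc) (h ∘ suc) j))) (add q q′)

  sum-shift∈ : ∀ {k} {η} (u : Fin k → V n) → (∀ i → C ∋ η ⊕ u i) → C ∋ + k • η ⊕ (λ j → ∑.sum λ i → u i j)
  sum-shift∈ {zero}  {η} u p = resp (λ j → cong (ℤ._+ 0ℤ) (sym (ℤ.*-zeroˡ (η j)))) 0∈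
  sum-shift∈ {suc k} {η} u p = resp (λ j → eq (+ k) (η j) (u zero j) (∑.sum λ i → u (suc i) j))
                                 (add (p zero) (sum-shift∈ (u ∘ suc) (p ∘ suc)))
    where
    eq : ∀ k x y z → x ℤ.+ y ℤ.+ (k ℤ.* x ℤ.+ z) ≡ (1ℤ ℤ.+ k) ℤ.* x ℤ.+ (y ℤ.+ z)
    eq = solve-∀

  -- A finite list has a least nonzero absolute value, and η is taken no larger than that. Smallness
  -- then means vanishing for the members of the list.
  small-threshold : ∀ {η₀} → Pos C η₀ → (L : List (V n)) →
                    ¬ ¬ ∃ λ η → Pos C η × All (λ v → Small C η v → Null C v) L
  small-threshold {η₀} p₀ [] = return (η₀ , p₀ , [])
  small-threshold p₀ (v ∷ L) = do
    (η , pη , all) ← small-threshold p₀ L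
    yes v∈ ← em (C ∋ v)
      where no v∉ → shrink η pη all (⊝ v) (λ r → v∉ (resp (λ j → ℤ.neg-involutive (v j)) r))
                      (λ η (p , q) → q) λ (p , q) → q (resp (λ j → sym (ℤ.+-inverseʳ (ℤ.- v j))) 0∈)
    yes ⊝v∈ ← em (C ∋ ⊝ v)
      where no ⊝v∉ → shrink η pη all v ⊝v∉
                      (λ η (p , q) → p) λ (p , q) → p (resp (λ j → sym (ℤ.+-inverseʳ (v j))) 0∈)
    return (η , pη , (λ _ → v∈ , ⊝v∈) ∷ all)
    where
    Goal : Set
    Goal = ∃ λ η → Pos C η × All (λ v → Small C η v → Null C v) (v ∷ L)
    shrink : ∀ η → Pos C η → All (λ v → Small C η v → Null C v) L → ∀ a → Pos C a →
             (∀ η → Small C η v → ¬ C ∋ a ⊖ η) → ¬ Small C a v → ¬ ¬ Goal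
    -- Here a is |v|. The smaller of the old threshold and a is kept; the entries already treated
    -- survive because smallness is monotone.
    shrink η pη all a pa below ¬small = em (C ∋ a ⊖ η) >>= λ
      { (yes η≤a) → return (η , pη , (λ s → ⊥-elim (below η s η≤a)) ∷ all)
      ; (no η≰a)  → return (a , pa , (λ s → ⊥-elim (¬small s)) ∷
          All.map (λ f s → f (small-mono (resp (λ j → eq (η j) (a j)) (total η≰a)) s)) all) }
      where
      eq : ∀ x y → ℤ.- (y ℤ.- x) ≡ x ℤ.- y
      eq = solve-∀

-- If no lattice vector can be made small in all m functionals, the vectors that Dirichlet makes
-- small in all but one of them add up to a vector in the interior of every cone.
module SmallAll {n k} (C : Fin (suc k) → Cone n) (η : Fin (suc k) → V n)
                (pos : ∀ j → Pos (C j) (η j)) (g : Fin (suc k) → V n) (s : ℕ)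
                (escape : ∀ c → NonZero c → ¬ (∀ j → C j ∋ lin c g)) where
  private module C j = Cone (C j)

  AllSmall : Set
  AllSmall = ∃ λ c → NonZero c × ∀ j → Small (C j) (η j) (+ suc s • lin c g)

  -- The factor suc k balances the later sum: (k + 1) copies of the large term bring at least (k +
  -- 1)η, and the k other terms together lose less than kη.
  scale : ℕ
  scale = suc k ℕ.* suc s

  OnlyLarge : Fin (suc k) → V (suc k) → Set
  OnlyLarge i c = C i ∋ + suc s • lin c g ⊖ η i ×
                  (∀ j → j ≢ i → Small (C j) (η j) (+ scale • lin c g))

  -- Dirichlet's theorem is applied to the k rows other than i. If row i were small as well,
  -- everything would be; so it is large, and the sign of c can be chosen to make it positive.
  only-large : ¬ AllSmall → ∀ i → ¬ ¬ ∃ (OnlyLarge i)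
  only-large ¬all i = do
    (c , c≢0 , small) ← dirichlet (ℕ.n<1+n k) (C ∘ punchIn i) (η ∘ punchIn i) (pos ∘ punchIn i)
                          (λ l → + scale • g l)
    let small′ : ∀ j → j ≢ i → Small (C j) (η j) (+ scale • lin c g)
        small′ j j≢i = subst (λ t → Small (C t) (η t) (+ scale • lin c g)) (Fin.punchIn-punchOut (j≢i ∘ sym))
          (small-resp (C _) (lin-gen-• (+ scale) c g) (small (punchOut (j≢i ∘ sym))))
    no ≱ ← em (C i ∋ + suc s • lin c g ⊖ η i)
      where yes p → return (c , p , small′)
    no ≰ ← em (C i ∋ ⊝ (+ suc s • lin c g) ⊖ η i)
      where yes p → return (⊝ c
                    , C.resp i (λ l → cong (ℤ._- η i l) (neg (+ suc s) c l)) p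
                    , λ j j≢i → small-resp (C j) (neg (+ scale) c) (small-⊝ (C j) (small′ j j≢i)))
    λ _ → ¬all (c , c≢0 , λ j → by {c} j (≱ , ≰) (small′ j))
    where
    neg : ∀ t c l → ℤ.- (t ℤ.* lin c g l) ≡ t ℤ.* lin (⊝ c) g l
    neg t c l = trans (ℤ.neg-distribʳ-* t (lin c g l)) (cong (t ℤ.*_) (sym (lin-⊝ c g l)))
    by : ∀ {c} j → Small (C i) (η i) (+ suc s • lin c g) →
         (j ≢ i → Small (C j) (η j) (+ scale • lin c g)) → Small (C j) (η j) (+ suc s • lin c g)
    by j p q with j Fin.≟ i
    ... | yes refl = p
    ... | no j≢i   = small-∣ (C j) (ℕ.m≤m+n (suc s) (k ℕ.* suc s)) (pos j) (q j≢i)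

  small-all : ¬ ¬ AllSmall
  small-all ¬all = ¬¬-Π (only-large ¬all) λ large →
    let c : V (suc k)
        c = lin (λ _ → 1ℤ) (proj₁ ∘ large)
        v : Fin (suc k) → V n
        v i = lin (proj₁ (large i)) g
        z≗ : lin c g ≗ λ l → ∑.sum λ i → v i l
        z≗ l = trans (lin-lin (λ _ → 1ℤ) (proj₁ ∘ large) g l) (∑.sum-cong-≗ {suc k} λ i → ℤ.*-identityˡ (v i l))
        -- On row j the summand with index j contributes at least (k + 1)η and each other one more
        -- than -η. What remains is η, so the sum is nonzero and inside every cone.
        big : ∀ j → C j ∋ + scale • lin c g ⊖ η j
        big j = C.resp j (λ l → begin
              + suc k ℤ.* (+ suc s ℤ.* v j l ℤ.- η j l) ℤ.+
                    (+ k ℤ.* η j l ℤ.+ ∑.sum λ i → + scale ℤ.* v (punchIn j i) l)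
                ≡⟨ cong (λ t → + suc k ℤ.* (+ suc s ℤ.* v j l ℤ.- η j l) ℤ.+ (+ k ℤ.* η j l ℤ.+ t))
                     (sym (∑.*-distribˡ-sum (+ scale) λ i → v (punchIn j i) l)) ⟩
              + suc k ℤ.* (+ suc s ℤ.* v j l ℤ.- η j l) ℤ.+
                    (+ k ℤ.* η j l ℤ.+ + scale ℤ.* ∑.sum λ i → v (punchIn j i) l)
                ≡⟨ cong (λ t → + suc k ℤ.* (+ suc s ℤ.* v j l ℤ.- η j l) ℤ.+
                      (+ k ℤ.* η j l ℤ.+ t ℤ.* ∑.sum λ i → v (punchIn j i) l))
                     (ℤ.pos-* (suc k) (suc s)) ⟩
              _ ≡⟨ eq (+ k) (+ suc s) (v j l) (η j l) (∑.sum λ i → v (punchIn j i) l) ⟩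
              (1ℤ ℤ.+ + k) ℤ.* + suc s ℤ.* (v j l ℤ.+ ∑.sum λ i → v (punchIn j i) l) ℤ.- η j l
                ≡⟨ cong₂ (λ a b → a ℤ.* b ℤ.- η j l) (sym (ℤ.pos-* (suc k) (suc s)))
                     (sym (trans (z≗ l) (∑.sum-remove {i = j} λ i → v i l))) ⟩
              + scale ℤ.* lin c g l ℤ.- η j l ∎)
            (C.add j (C.mul∈ j (suc k) (proj₁ (proj₂ (large j))))
                     (sum-shift∈ (C j) (λ i → + scale • v (punchIn j i))
                        λ i → small⁺ (C j) (proj₂ (proj₂ (large (punchIn j i))) j (Fin.punchInᵢ≢i j i ∘ sym))))
        c≢0 : NonZero c
        c≢0 = ≢⇒NonZero λ c≗0 → pos zero (C.resp zero (λ l →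
                trans (cong (λ t → + scale ℤ.* t ℤ.- η zero l) (trans (lin-cong g c≗0 l) (lin-𝟘 g l)))
                      (eq₀ (+ scale) (η zero l))) (big zero))
    in escape c c≢0 λ j → C.div∈ j (s ℕ.+ k ℕ.* suc s)
         (C.resp j (λ l → eq₁ (+ scale ℤ.* lin c g l) (η j l)) (C.add j (big j) (C.total⁻ j (pos j))))
    where
    open ≡-Reasoning
    eq : ∀ k s x e y → (1ℤ ℤ.+ k) ℤ.* (s ℤ.* x ℤ.- e) ℤ.+ (k ℤ.* e ℤ.+ ((1ℤ ℤ.+ k) ℤ.* s) ℤ.* y) ≡
                       (1ℤ ℤ.+ k) ℤ.* s ℤ.* (x ℤ.+ y) ℤ.- e
    eq = solve-∀
    eq₀ : ∀ t e → t ℤ.* 0ℤ ℤ.- e ≡ ℤ.- e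
    eq₀ = solve-∀
    eq₁ : ∀ t e → t ℤ.- e ℤ.+ e ≡ t
    eq₁ = solve-∀

open SmallAll using (small-all)

-- Integer linear dependencies

coordinate : ∀ {n} → Fin n → Cone n
coordinate i = record
  { _∋_    = λ v → 0ℤ ℤ.≤ v i
  ; resp   = λ u≗v → subst (0ℤ ℤ.≤_) (u≗v i)
  ; add    = ℤ.+-mono-≤
  ; total  = λ ≰ → ℤ.neg-mono-≤ (ℤ.<⇒≤ (ℤ.≰⇒> ≰))
  ; stable = λ {v} → decidable-stable (0ℤ ℤ.≤? v i)
  ; arch   = λ {v} pv u → return (ℤ.∣ u i ∣ , arch (v i) (u i) pv)
  }
  where
  arch : ∀ x y → ¬ 0ℤ ℤ.≤ ℤ.- x → 0ℤ ℤ.≤ + ℤ.∣ y ∣ ℤ.* x ℤ.+ y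
  arch (+ zero)   y       h = ⊥-elim (h (ℤ.+≤+ z≤n))
  arch -[1+ x ]   y       h = ⊥-elim (h (ℤ.+≤+ z≤n))
  arch (+ suc x) (+ y)    h = subst (λ t → 0ℤ ℤ.≤ t ℤ.+ + y) (ℤ.pos-* y (suc x)) (ℤ.+≤+ z≤n)
  arch (+ suc x) -[1+ y ] h = subst (λ t → 0ℤ ℤ.≤ t ℤ.+ -[1+ y ]) (ℤ.pos-* (suc y) (suc x))
    (ℤ.i≤j⇒0≤j-i (ℤ.+≤+ (ℕ.m≤m*n (suc y) (suc x))))

-- Dirichlet's theorem for the coordinate forms with threshold 1: an integer of absolute value below
-- 1 is 0.
siegel : ∀ {k m} → k ℕ.< m → (g : Fin m → V k) → ¬ ¬ ∃ λ c → NonZero c × lin c g ≗ 𝟘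
siegel k<m g = do
  (c , c≢0 , small) ← dirichlet k<m coordinate (λ _ _ → 1ℤ) (λ _ ()) g
  return (c , c≢0 , λ j → <1⇒≡0 _ (Small.upper (small j)) (Small.lower (small j)))
  where
  <1⇒≡0 : ∀ x → ¬ 0ℤ ℤ.≤ x ℤ.- 1ℤ → ¬ 0ℤ ℤ.≤ ℤ.- x ℤ.- 1ℤ → x ≡ 0ℤ
  <1⇒≡0 (+ zero)  p q = refl
  <1⇒≡0 (+ suc x) p q = ⊥-elim (p (ℤ.i≤j⇒0≤j-i (ℤ.+≤+ (s≤s z≤n))))
  <1⇒≡0 -[1+ x ]  p q = ⊥-elim (q (ℤ.i≤j⇒0≤j-i {1ℤ} {+ suc x} (ℤ.+≤+ (s≤s z≤n))))

-- Real functionals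

int : ℤ → ℚ
int i = i ℚ./ 1

private
  int≃ : ∀ i → ℚ.toℚᵘ (int i) ℚᵘ.≃ ℚᵘ.mkℚᵘ i 0
  int≃ i = ℚ.toℚᵘ-fromℚᵘ (ℚᵘ.mkℚᵘ i 0)

int-+ : ∀ i j → int (i ℤ.+ j) ≡ int i ℚ.+ int j
int-+ i j = ℚ.toℚᵘ-injective (begin
    ℚ.toℚᵘ (int (i ℤ.+ j))                ≈⟨ int≃ (i ℤ.+ j) ⟩
    ℚᵘ.mkℚᵘ (i ℤ.+ j) 0                   ≈⟨ ℚᵘ.*≡* (eq i j) ⟩
    ℚᵘ.mkℚᵘ i 0 ℚᵘ.+ ℚᵘ.mkℚᵘ j 0          ≈⟨ ℚᵘ.+-cong (int≃ i) (int≃ j) ⟨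
    ℚ.toℚᵘ (int i) ℚᵘ.+ ℚ.toℚᵘ (int j)    ≈⟨ ℚ.toℚᵘ-homo-+ (int i) (int j) ⟨
    ℚ.toℚᵘ (int i ℚ.+ int j)              ∎)
  where
  open ℚᵘ.≃-Reasoning
  eq : ∀ i j → (i ℤ.+ j) ℤ.* 1ℤ ≡ (i ℤ.* 1ℤ ℤ.+ j ℤ.* 1ℤ) ℤ.* 1ℤ
  eq = solve-∀

int-* : ∀ i j → int (i ℤ.* j) ≡ int i ℚ.* int j
int-* i j = ℚ.toℚᵘ-injective (begin
    ℚ.toℚᵘ (int (i ℤ.* j))                ≈⟨ int≃ (i ℤ.* j) ⟩
    ℚᵘ.mkℚᵘ i 0 ℚᵘ.* ℚᵘ.mkℚᵘ j 0          ≈⟨ ℚᵘ.*-cong (int≃ i) (int≃ j) ⟨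
    ℚ.toℚᵘ (int i) ℚᵘ.* ℚ.toℚᵘ (int j)    ≈⟨ ℚ.toℚᵘ-homo-* (int i) (int j) ⟨
    ℚ.toℚᵘ (int i ℚ.* int j)              ∎)
  where open ℚᵘ.≃-Reasoning

int-neg : ∀ i → int (ℤ.- i) ≡ ℚ.- int i
int-neg i = ℚ.toℚᵘ-injective (begin
    ℚ.toℚᵘ (int (ℤ.- i))   ≈⟨ int≃ (ℤ.- i) ⟩
    ℚᵘ.- ℚᵘ.mkℚᵘ i 0       ≈⟨ ℚᵘ.-‿cong (int≃ i) ⟨
    ℚᵘ.- ℚ.toℚᵘ (int i)    ≈⟨ ℚ.toℚᵘ-homo‿- (int i) ⟨
    ℚ.toℚᵘ (ℚ.- int i)     ∎)
  where open ℚᵘ.≃-Reasoning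

int-mono : ∀ {i j} → i ℤ.≤ j → int i ℚ.≤ int j
int-mono {i} {j} i≤j = ℚ.toℚᵘ-cancel-≤
  (ℚᵘ.≤-respˡ-≃ (ℚᵘ.≃-sym (int≃ i)) (ℚᵘ.≤-respʳ-≃ (ℚᵘ.≃-sym (int≃ j)) (ℚᵘ.*≤* (ℤ.*-monoʳ-≤-nonNeg 1ℤ i≤j))))

int-sum : ∀ {n} (f : Fin n → ℤ) → int (∑.sum f) ≡ ∑ℚ.sum (int ∘ f)
int-sum {zero}  f = refl
int-sum {suc n} f = trans (int-+ (f zero) (∑.sum (f ∘ suc))) (cong (int (f zero) ℚ.+_) (int-sum (f ∘ suc)))

archimedean : ∀ p → ∃ λ k → p ℚ.≤ int (+ k)
archimedean p@(mkℚ n d _) = ℤ.∣ n ∣ , ℚ.toℚᵘ-cancel-≤ (ℚᵘ.≤-respʳ-≃ (ℚᵘ.≃-sym (int≃ (+ ℤ.∣ n ∣))) (ℚᵘ.*≤* (begin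
    n ℤ.* 1ℤ                 ≡⟨ ℤ.*-identityʳ n ⟩
    n                        ≤⟨ i≤∣i∣ n ⟩
    + ℤ.∣ n ∣                ≤⟨ ℤ.+≤+ (ℕ.m≤m*n ℤ.∣ n ∣ (suc d)) ⟩
    + (ℤ.∣ n ∣ ℕ.* suc d)    ≡⟨ ℤ.pos-* ℤ.∣ n ∣ (suc d) ⟩
    + ℤ.∣ n ∣ ℤ.* + suc d    ∎)))
  where
  open ℤ.≤-Reasoning
  i≤∣i∣ : ∀ i → i ℤ.≤ + ℤ.∣ i ∣
  i≤∣i∣ (+ n)    = ℤ.≤-refl
  i≤∣i∣ -[1+ n ] = ℤ.-≤+

0≤+ : ∀ {p q} → 0ℚ ℚ.≤ p → 0ℚ ℚ.≤ q → 0ℚ ℚ.≤ p ℚ.+ q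
0≤+ = ℚ.+-mono-≤ {0ℚ} {_} {0ℚ}

0≤∸ : ∀ {p q} → p ℚ.≤ q → 0ℚ ℚ.≤ q ℚ.- p
0≤∸ {p} {q} p≤q = subst (ℚ._≤ q ℚ.- p) (ℚ.+-inverseʳ p) (ℚ.+-monoˡ-≤ (ℚ.- p) p≤q)

∸0≤ : ∀ {p q} → 0ℚ ℚ.≤ q ℚ.- p → p ℚ.≤ q
∸0≤ {p} {q} h = subst (p ℚ.≤_) (eq p q) (subst (ℚ._≤ p ℚ.+ (q ℚ.- p)) (ℚ.+-identityʳ p) (ℚ.+-monoʳ-≤ p h))
  where
  open +-*-Solver
  eq : ∀ p q → p ℚ.+ (q ℚ.- p) ≡ q
  eq = solve 2 (λ p q → p :+ (q :- p) := q) refl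

p≤∣p∣ : ∀ p → p ℚ.≤ ℚ.∣ p ∣
p≤∣p∣ (mkℚ (+ n) d c)    = ℚ.≤-refl
p≤∣p∣ (mkℚ -[1+ n ] d c) = ℚ.*≤* ℤ.-≤+

abs⁺ : ∀ p q {r} → ℚ.∣ p ℚ.- q ∣ ℚ.≤ r → 0ℚ ℚ.≤ r ℚ.+ (q ℚ.- p)
abs⁺ p q {r} h = subst (0ℚ ℚ.≤_) (eq p q r) (0≤∸ (ℚ.≤-trans (p≤∣p∣ (p ℚ.- q)) h))
  where
  open +-*-Solver
  eq : ∀ p q r → r ℚ.- (p ℚ.- q) ≡ r ℚ.+ (q ℚ.- p)
  eq = solve 3 (λ p q r → r :- (p :- q) := r :+ (q :- p)) refl

abs-swap : ∀ p q → ℚ.∣ p ℚ.- q ∣ ≡ ℚ.∣ q ℚ.- p ∣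
abs-swap p q = trans (sym (ℚ.∣-p∣≡∣p∣ (p ℚ.- q))) (cong ℚ.∣_∣ (eq p q))
  where
  open +-*-Solver
  eq : ∀ p q → ℚ.- (p ℚ.- q) ≡ q ℚ.- p
  eq = solve 2 (λ p q → :- (p :- q) := q :- p) refl

half-pos : ∀ {ε} → 0ℚ ℚ.< ε → 0ℚ ℚ.< ½ ℚ.* ε
half-pos {ε} 0<ε = subst (ℚ._< ½ ℚ.* ε) (ℚ.*-zeroʳ ½) (ℚ.*-monoʳ-<-pos ½ 0<ε)

half+half : ∀ ε → ½ ℚ.* ε ℚ.+ ½ ℚ.* ε ≡ ε
half+half ε = trans (sym (ℚ.*-distribʳ-+ ε ½ ½)) (ℚ.*-identityˡ ε)

-- Signs of Cauchy sequences

Eventually : (ℕ → Set) → Set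
Eventually Q = ∃ λ N → ∀ n → N ℕ.≤ n → Q n

both : ∀ {Q R S : ℕ → Set} → (∀ n → Q n → R n → S n) → Eventually Q → Eventually R → Eventually S
both f (M , q) (N , r) = M ℕ.⊔ N , λ n ≥ → f n (q n (ℕ.m⊔n≤o⇒m≤o M N ≥)) (r n (ℕ.m⊔n≤o⇒n≤o M N ≥))

both-never : ∀ {Q R : ℕ → Set} → (∀ n → Q n → ¬ R n) → Eventually Q → ¬ Eventually R
both-never f (M , q) (N , r) = f (M ℕ.⊔ N) (q _ (ℕ.m≤m⊔n M N)) (r _ (ℕ.m≤n⊔m M N))

NonNegSeq : (ℕ → ℚ) → Set
NonNegSeq s = ∀ ε → 0ℚ ℚ.< ε → Eventually λ n → 0ℚ ℚ.≤ s n ℚ.+ ε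

BelowZero : (ℕ → ℚ) → ℚ → Set
BelowZero s ε = Eventually λ n → 0ℚ ℚ.≤ ℚ.- s n ℚ.- ε

-- A single sample known up to ε/4 decides. With the cut at -3ε/4, the tail stays above -ε on one
-- side and below -ε/2 on the other.
dichotomy : ∀ s → IsCauchy s → ∀ ε → 0ℚ ℚ.< ε →
            (Eventually λ n → 0ℚ ℚ.≤ s n ℚ.+ ε) ⊎ BelowZero s (½ ℚ.* ε)
dichotomy s cs ε 0<ε with cs (½ ℚ.* (½ ℚ.* ε)) (half-pos (half-pos 0<ε))
... | N , close with 0ℚ ℚ.≤? s N ℚ.+ (½ ℚ.* ε ℚ.+ ½ ℚ.* (½ ℚ.* ε))
...   | yes h = inj₁ (N , λ n n≥ → subst (0ℚ ℚ.≤_)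
          (trans (eq (s n) (s N) (½ ℚ.* ε) (½ ℚ.* (½ ℚ.* ε)))
            (cong (s n ℚ.+_) (trans (cong (½ ℚ.* ε ℚ.+_) (half+half (½ ℚ.* ε))) (half+half ε))))
          (0≤+ h (abs⁺ (s N) (s n) (close N n ℕ.≤-refl n≥))))
  where
  open +-*-Solver
  eq : ∀ a b h q → (b ℚ.+ (h ℚ.+ q)) ℚ.+ (q ℚ.+ (a ℚ.- b)) ≡ a ℚ.+ (h ℚ.+ (q ℚ.+ q))
  eq = solve 4 (λ a b h q → (b :+ (h :+ q)) :+ (q :+ (a :- b)) := a :+ (h :+ (q :+ q))) refl
...   | no ¬h = inj₂ (N , λ n n≥ → subst (0ℚ ℚ.≤_) (eq (s n) (s N) (½ ℚ.* ε) (½ ℚ.* (½ ℚ.* ε)))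
          (0≤+ (0≤∸ (ℚ.<⇒≤ (ℚ.≰⇒> ¬h))) (abs⁺ (s n) (s N) (close n N n≥ ℕ.≤-refl))))
  where
  open +-*-Solver
  eq : ∀ a b h q → (0ℚ ℚ.- (b ℚ.+ (h ℚ.+ q))) ℚ.+ (q ℚ.+ (b ℚ.- a)) ≡ ℚ.- a ℚ.- h
  eq = solve 4 (λ a b h q → (con 0ℚ :- (b :+ (h :+ q))) :+ (q :+ (b :- a)) := :- a :- h) refl

0≰-pos : ∀ {p} → 0ℚ ℚ.< p → ¬ 0ℚ ℚ.≤ ℚ.- p
0≰-pos 0<p h = ℚ.<-irrefl refl (ℚ.<-≤-trans (ℚ.neg-antimono-< 0<p) h)

below⇒¬nonNeg : ∀ s {ε} → 0ℚ ℚ.< ε → BelowZero s ε → ¬ NonNegSeq s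
below⇒¬nonNeg s {ε} 0<ε b nn = both-never
  (λ n p q → 0≰-pos (half-pos 0<ε) (subst (0ℚ ℚ.≤_)
    (trans (cong (λ e → (ℚ.- s n ℚ.- e) ℚ.+ (s n ℚ.+ ½ ℚ.* ε)) (sym (half+half ε))) (eq (s n) (½ ℚ.* ε))) (0≤+ p q)))
  b (nn (½ ℚ.* ε) (half-pos 0<ε))
  where
  open +-*-Solver
  eq : ∀ a h → (ℚ.- a ℚ.- (h ℚ.+ h)) ℚ.+ (a ℚ.+ h) ≡ ℚ.- h
  eq = solve 2 (λ a h → (:- a :- (h :+ h)) :+ (a :+ h) := :- h) refl

nonNeg-stable : ∀ s → IsCauchy s → ¬ ¬ NonNegSeq s → NonNegSeq s
nonNeg-stable s cs nn ε 0<ε with dichotomy s cs ε 0<ε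
... | inj₁ h = h
... | inj₂ b = ⊥-elim (nn (below⇒¬nonNeg s (half-pos 0<ε) b))

-- If no ε were a witness, `dichotomy` would take its first alternative for every ε, which is
-- nonnegativity.
¬nonNeg⇒below : ∀ s → IsCauchy s → ¬ NonNegSeq s → ¬ ¬ ∃ λ ε → 0ℚ ℚ.< ε × BelowZero s ε
¬nonNeg⇒below s cs ¬nn k = ¬nn λ ε 0<ε → case (dichotomy s cs ε 0<ε) ε 0<ε
  where
  case : ∀ {A : Set} {ε} → A ⊎ BelowZero s (½ ℚ.* ε) → ∀ ε′ → 0ℚ ℚ.< ε → A
  case (inj₁ a) _ _ = a
  case (inj₂ b) _ 0<ε = ⊥-elim (k (_ , half-pos 0<ε , b))

below⇒nonNeg-neg : ∀ s {ε} → 0ℚ ℚ.< ε → BelowZero s ε → NonNegSeq (λ n → ℚ.- s n)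
below⇒nonNeg-neg s {ε} 0<ε (N , b) ε′ 0<ε′ = N , λ n n≥ →
  subst (0ℚ ℚ.≤_) (eq (s n) ε ε′) (0≤+ (b n n≥) (0≤+ (ℚ.<⇒≤ 0<ε) (ℚ.<⇒≤ 0<ε′)))
  where
  open +-*-Solver
  eq : ∀ a e f → (ℚ.- a ℚ.- e) ℚ.+ (e ℚ.+ f) ≡ ℚ.- a ℚ.+ f
  eq = solve 3 (λ a e f → (:- a :- e) :+ (e :+ f) := :- a :+ f) refl

neg-cauchy : ∀ s → IsCauchy s → IsCauchy (λ n → ℚ.- s n)
neg-cauchy s cs ε 0<ε with cs ε 0<ε
... | N , p = N , λ m n m≥ n≥ → subst (ℚ._≤ ε) (trans (abs-swap (s m) (s n)) (cong ℚ.∣_∣ (eq (s m) (s n))))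
      (p m n m≥ n≥)
  where
  open +-*-Solver
  eq : ∀ a b → b ℚ.- a ≡ ℚ.- a ℚ.- ℚ.- b
  eq = solve 2 (λ a b → b :- a := :- a :- :- b) refl

nonNeg-total : ∀ s → IsCauchy s → ¬ NonNegSeq s → NonNegSeq (λ n → ℚ.- s n)
nonNeg-total s cs ¬nn = nonNeg-stable (λ n → ℚ.- s n) (neg-cauchy s cs) λ ¬nn′ →
  ¬nonNeg⇒below s cs ¬nn λ (ε , 0<ε , b) → ¬nn′ (below⇒nonNeg-neg s 0<ε b)

nonNeg-add : ∀ s t → NonNegSeq s → NonNegSeq t → NonNegSeq (λ n → s n ℚ.+ t n)
nonNeg-add s t ns nt ε 0<ε = both (λ n p q → subst (0ℚ ℚ.≤_)
    (trans (eq (s n) (t n) (½ ℚ.* ε)) (cong (s n ℚ.+ t n ℚ.+_) (half+half ε))) (0≤+ p q))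
  (ns (½ ℚ.* ε) (half-pos 0<ε)) (nt (½ ℚ.* ε) (half-pos 0<ε))
  where
  open +-*-Solver
  eq : ∀ a b h → (a ℚ.+ h) ℚ.+ (b ℚ.+ h) ≡ (a ℚ.+ b) ℚ.+ (h ℚ.+ h)
  eq = solve 3 (λ a b h → (a :+ h) :+ (b :+ h) := (a :+ b) :+ (h :+ h)) refl

nonNeg-resp : ∀ {s t} → s ≗ t → NonNegSeq s → NonNegSeq t
nonNeg-resp s≗t ns ε 0<ε with ns ε 0<ε
... | N , p = N , λ n n≥ → subst (λ x → 0ℚ ℚ.≤ x ℚ.+ ε) (s≗t n) (p n n≥)

bounded-below : ∀ s → IsCauchy s → ∃ λ B → Eventually λ n → 0ℚ ℚ.≤ s n ℚ.+ B
bounded-below s cs with cs 1ℚ (ℚ.positive⁻¹ 1ℚ)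
... | N , p = 1ℚ ℚ.- s N , N , λ n n≥ → subst (0ℚ ℚ.≤_) (eq (s n) (s N)) (abs⁺ (s N) (s n) (p N n ℕ.≤-refl n≥))
  where
  open +-*-Solver
  eq : ∀ a b → 1ℚ ℚ.+ (a ℚ.- b) ≡ a ℚ.+ (1ℚ ℚ.- b)
  eq = solve 2 (λ a b → con 1ℚ :+ (a :- b) := a :+ (con 1ℚ :- b)) refl

-- s is eventually above ε > 0, so k = ⌈B/ε⌉ copies of s outweigh a lower bound -B of t.
nonNeg-arch : ∀ s t → IsCauchy s → IsCauchy t → ¬ NonNegSeq (λ n → ℚ.- s n) →
              ¬ ¬ ∃ λ k → NonNegSeq (λ n → int (+ k) ℚ.* s n ℚ.+ t n)
nonNeg-arch s t cs ct ¬nn = do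
  (ε , 0<ε , above) ← ¬nonNeg⇒below (λ n → ℚ.- s n) (neg-cauchy s cs) ¬nn
  let (B , lower) = bounded-below t ct
      instance
        ε>0 : ℚ.Positive ε
        ε>0 = ℚ.positive 0<ε
        ε≢0 : ℚ.NonZero ε
        ε≢0 = ℚ.pos⇒nonZero ε
      (k , B/ε≤k) = archimedean (B ℚ.* ℚ.1/ ε)
      B≤kε : B ℚ.≤ int (+ k) ℚ.* ε
      B≤kε = subst (ℚ._≤ int (+ k) ℚ.* ε)
        (trans (ℚ.*-assoc B (ℚ.1/ ε) ε) (trans (cong (B ℚ.*_) (ℚ.*-inverseˡ ε)) (ℚ.*-identityʳ B)))
        (ℚ.*-monoʳ-≤-nonNeg ε ⦃ ℚ.nonNegative (ℚ.<⇒≤ 0<ε) ⦄ B/ε≤k)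
      k≥0 : ℚ.NonNegative (int (+ k))
      k≥0 = ℚ.nonNegative (int-mono {0ℤ} {+ k} (ℤ.+≤+ z≤n))
  return (k , λ ε′ 0<ε′ → both (λ n p q → subst (0ℚ ℚ.≤_) (eq (s n) (t n) (int (+ k)) ε B ε′)
      (0≤+ (0≤+ (subst (ℚ._≤ int (+ k) ℚ.* (ℚ.- (ℚ.- s n) ℚ.- ε)) (ℚ.*-zeroʳ (int (+ k)))
                   (ℚ.*-monoˡ-≤-nonNeg (int (+ k)) ⦃ k≥0 ⦄ p)) (0≤∸ B≤kε)) (0≤+ q (ℚ.<⇒≤ 0<ε′))))
    above lower)
  where
  open +-*-Solver
  eq : ∀ s t k e b f → k ℚ.* (ℚ.- (ℚ.- s) ℚ.- e) ℚ.+ (k ℚ.* e ℚ.- b) ℚ.+ ((t ℚ.+ b) ℚ.+ f) ≡ k ℚ.* s ℚ.+ t ℚ.+ f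
  eq = solve 6 (λ s t k e b f → k :* (:- (:- s) :- e) :+ (k :* e :- b) :+ ((t :+ b) :+ f) := k :* s :+ t :+ f) refl

seq-sum : ∀ {n} (x : Fin n → ℝ) k → seq (sum x) k ≡ ∑ℚ.sum (λ i → seq (x i) k)
seq-sum {zero}  x k = refl
seq-sum {suc n} x k = cong (seq (x zero) k ℚ.+_) (seq-sum (x ∘ suc) k)

module Functional {n} (coef : Fin n → ℝ) where
  value : V n → ℝ
  value v = sum λ j → coef j * fromℤ (v j)

  value-seq : ∀ v k → seq (value v) k ≡ ∑ℚ.sum (λ j → seq (coef j) k ℚ.* int (v j))
  value-seq v k = seq-sum (λ j → coef j * fromℤ (v j)) k

  value-cong : ∀ {u v} → u ≗ v → seq (value u) ≗ seq (value v)
  value-cong {u} {v} u≗v k = trans (value-seq u k)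
    (trans (∑ℚ.sum-cong-≗ {n} λ j → cong (λ x → seq (coef j) k ℚ.* int x) (u≗v j)) (sym (value-seq v k)))

  value-⊕ : ∀ u v k → seq (value (u ⊕ v)) k ≡ seq (value u) k ℚ.+ seq (value v) k
  value-⊕ u v k = begin
    seq (value (u ⊕ v)) k
      ≡⟨ value-seq (u ⊕ v) k ⟩
    ∑ℚ.sum (λ j → seq (coef j) k ℚ.* int (u j ℤ.+ v j))
      ≡⟨ ∑ℚ.sum-cong-≗ {n} (λ j → trans (cong (seq (coef j) k ℚ.*_) (int-+ (u j) (v j)))
           (ℚ.*-distribˡ-+ (seq (coef j) k) (int (u j)) (int (v j)))) ⟩
    ∑ℚ.sum (λ j → seq (coef j) k ℚ.* int (u j) ℚ.+ seq (coef j) k ℚ.* int (v j))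
      ≡⟨ ∑ℚ.∑-distrib-+ (λ j → seq (coef j) k ℚ.* int (u j)) (λ j → seq (coef j) k ℚ.* int (v j)) ⟩
    ∑ℚ.sum (λ j → seq (coef j) k ℚ.* int (u j)) ℚ.+ ∑ℚ.sum (λ j → seq (coef j) k ℚ.* int (v j))
      ≡⟨ cong₂ ℚ._+_ (value-seq u k) (value-seq v k) ⟨
    seq (value u) k ℚ.+ seq (value v) k ∎
    where open ≡-Reasoning

  value-• : ∀ c v k → seq (value (c • v)) k ≡ int c ℚ.* seq (value v) k
  value-• c v k = begin
    seq (value (c • v)) k
      ≡⟨ value-seq (c • v) k ⟩
    ∑ℚ.sum (λ j → seq (coef j) k ℚ.* int (c ℤ.* v j))
      ≡⟨ ∑ℚ.sum-cong-≗ {n} (λ j → trans (cong (seq (coef j) k ℚ.*_) (int-* c (v j)))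
            (eq (seq (coef j) k) (int c) (int (v j)))) ⟩
    ∑ℚ.sum (λ j → int c ℚ.* (seq (coef j) k ℚ.* int (v j)))
      ≡⟨ ∑ℚ.*-distribˡ-sum (int c) (λ j → seq (coef j) k ℚ.* int (v j)) ⟨
    int c ℚ.* ∑ℚ.sum (λ j → seq (coef j) k ℚ.* int (v j))
      ≡⟨ cong (int c ℚ.*_) (value-seq v k) ⟨
    int c ℚ.* seq (value v) k ∎
    where
    open ≡-Reasoning
    open +-*-Solver
    eq : ∀ a c v → a ℚ.* (c ℚ.* v) ≡ c ℚ.* (a ℚ.* v)
    eq = solve 3 (λ a c v → a :* (c :* v) := c :* (a :* v)) refl

  value-⊝ : ∀ v k → seq (value (⊝ v)) k ≡ ℚ.- seq (value v) k
  value-⊝ v k = trans (value-cong (λ j → sym (ℤ.-1*i≡-i (v j))) k)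
    (trans (value-• (ℤ.- 1ℤ) v k) (eq (seq (value v) k)))
    where
    open +-*-Solver
    eq : ∀ x → ℚ.- 1ℚ ℚ.* x ≡ ℚ.- x
    eq = solve 1 (λ x → :- con 1ℚ :* x := :- x) refl

  halfspace : Cone n
  halfspace = record
    { _∋_    = λ v → NonNegSeq (seq (value v))
    ; resp   = λ u≗v → nonNeg-resp (value-cong u≗v)
    ; add    = λ {u} {v} p q → nonNeg-resp (λ k → sym (value-⊕ u v k))
          (nonNeg-add (seq (value u)) (seq (value v)) p q)
    ; total  = λ {v} ¬p → nonNeg-resp (λ k → sym (value-⊝ v k)) (nonNeg-total (seq (value v)) (cauchy (value v)) ¬p)
    ; stable = λ {v} → nonNeg-stable (seq (value v)) (cauchy (value v))
    ; arch   = λ {v} ¬p u → nonNeg-arch (seq (value v)) (seq (value u)) (cauchy (value v)) (cauchy (value u))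
                 (λ p → ¬p (nonNeg-resp (λ k → sym (value-⊝ v k)) p)) >>= λ (k , p) →
                 return (k , nonNeg-resp (λ m → sym (trans (value-⊕ (+ k • v) u m)
                   (cong (ℚ._+ seq (value u) m) (value-• (+ k) v m)))) p)
    }

-- Affine hulls

0≈ : ∀ p {ε} → 0ℚ ℚ.< ε → ℚ.∣ p ℚ.- p ∣ ℚ.≤ ε
0≈ p 0<ε = subst (ℚ._≤ _) (sym (cong ℚ.∣_∣ (ℚ.+-inverseʳ p))) (ℚ.<⇒≤ 0<ε)

≗⇒≈ : ∀ x y → seq x ≗ seq y → x ≈ y
≗⇒≈ x y x≗y ε 0<ε = 0 , λ n _ → subst (λ q → ℚ.∣ seq x n ℚ.- q ∣ ℚ.≤ ε) (x≗y n) (0≈ (seq x n) 0<ε)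

≈-sym : ∀ x y → x ≈ y → y ≈ x
≈-sym x y x≈y ε 0<ε with x≈y ε 0<ε
... | N , p = N , λ n n≥ → subst (ℚ._≤ ε) (abs-swap (seq x n) (seq y n)) (p n n≥)

abs-+ : ∀ p q {r ε} → r ≡ p ℚ.+ q → ℚ.∣ p ∣ ℚ.≤ ½ ℚ.* ε → ℚ.∣ q ∣ ℚ.≤ ½ ℚ.* ε → ℚ.∣ r ∣ ℚ.≤ ε
abs-+ p q {r} {ε} r≡ p≤ q≤ = subst (λ t → ℚ.∣ t ∣ ℚ.≤ ε) (sym r≡)
  (ℚ.≤-trans (ℚ.∣p+q∣≤∣p∣+∣q∣ p q) (subst (ℚ.∣ p ∣ ℚ.+ ℚ.∣ q ∣ ℚ.≤_) (half+half ε) (ℚ.+-mono-≤ p≤ q≤)))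

≈-trans : ∀ x y z → x ≈ y → y ≈ z → x ≈ z
≈-trans x y z x≈y y≈z ε 0<ε = both (λ n → abs-+ (seq x n ℚ.- seq y n) (seq y n ℚ.- seq z n)
      (eq (seq x n) (seq y n) (seq z n)))
  (x≈y (½ ℚ.* ε) (half-pos 0<ε)) (y≈z (½ ℚ.* ε) (half-pos 0<ε))
  where
  open +-*-Solver
  eq : ∀ a b c → a ℚ.- c ≡ (a ℚ.- b) ℚ.+ (b ℚ.- c)
  eq = solve 3 (λ a b c → a :- c := (a :- b) :+ (b :- c)) refl

+-cong≈ : ∀ x x′ y y′ → x ≈ x′ → y ≈ y′ → x + y ≈ x′ + y′
+-cong≈ x x′ y y′ x≈ y≈ ε 0<ε = both (λ n → abs-+ (seq x n ℚ.- seq x′ n) (seq y n ℚ.- seq y′ n)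
      (eq (seq x n) (seq x′ n) (seq y n) (seq y′ n)))
  (x≈ (½ ℚ.* ε) (half-pos 0<ε)) (y≈ (½ ℚ.* ε) (half-pos 0<ε))
  where
  open +-*-Solver
  eq : ∀ a b c d → (a ℚ.+ c) ℚ.- (b ℚ.+ d) ≡ (a ℚ.- b) ℚ.+ (c ℚ.- d)
  eq = solve 4 (λ a b c d → (a :+ c) :- (b :+ d) := (a :- b) :+ (c :- d)) refl

sum-cong≈ : ∀ {n} (x y : Fin n → ℝ) → (∀ i → x i ≈ y i) → sum x ≈ sum y
sum-cong≈ {zero}  x y x≈y = ≗⇒≈ 0ℝ 0ℝ (λ _ → refl)
sum-cong≈ {suc n} x y x≈y = +-cong≈ (x zero) (y zero) (sum (x ∘ suc)) (sum (y ∘ suc))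
                              (x≈y zero) (sum-cong≈ (x ∘ suc) (y ∘ suc) (x≈y ∘ suc))

bounded : ∀ s → IsCauchy s → ∃ λ B → 0ℚ ℚ.< B × Eventually λ n → ℚ.∣ s n ∣ ℚ.≤ B
bounded s cs with cs 1ℚ (ℚ.positive⁻¹ 1ℚ)
... | N , p = ℚ.∣ s N ∣ ℚ.+ 1ℚ
            , ℚ.+-mono-≤-< {0ℚ} {ℚ.∣ s N ∣} {0ℚ} {1ℚ} (ℚ.0≤∣p∣ (s N)) (ℚ.positive⁻¹ 1ℚ)
            , N , λ n n≥ → subst (λ t → ℚ.∣ t ∣ ℚ.≤ ℚ.∣ s N ∣ ℚ.+ 1ℚ) (eq (s n) (s N))
                (ℚ.≤-trans (ℚ.∣p+q∣≤∣p∣+∣q∣ (s N) (s n ℚ.- s N)) (ℚ.+-monoʳ-≤ ℚ.∣ s N ∣ (p n N n≥ ℕ.≤-refl)))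
  where
  open +-*-Solver
  eq : ∀ a b → b ℚ.+ (a ℚ.- b) ≡ a
  eq = solve 2 (λ a b → b :+ (a :- b) := a) refl

quotient : ∀ B ε → 0ℚ ℚ.< B → 0ℚ ℚ.< ε → ∃ λ δ → 0ℚ ℚ.< δ × B ℚ.* δ ≡ ε
quotient B ε 0<B 0<ε = ℚ.1/ B ℚ.* ε
  , subst (ℚ._< ℚ.1/ B ℚ.* ε) (ℚ.*-zeroʳ (ℚ.1/ B)) (ℚ.*-monoʳ-<-pos (ℚ.1/ B) 0<ε)
  , trans (sym (ℚ.*-assoc B (ℚ.1/ B) ε)) (trans (cong (ℚ._* ε) (ℚ.*-inverseʳ B)) (ℚ.*-identityˡ ε))
  where
  instance
    B>0 : ℚ.Positive B
    B>0 = ℚ.positive 0<B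
    B≢0 : ℚ.NonZero B
    B≢0 = ℚ.pos⇒nonZero B
    1/B>0 : ℚ.Positive (ℚ.1/ B)
    1/B>0 = ℚ.1/pos⇒pos B

abs-* : ∀ p q B δ → 0ℚ ℚ.< B → ℚ.∣ p ∣ ℚ.≤ B → ℚ.∣ q ∣ ℚ.≤ δ → ℚ.∣ p ℚ.* q ∣ ℚ.≤ B ℚ.* δ
abs-* p q B δ 0<B p≤ q≤ = subst (ℚ._≤ B ℚ.* δ) (sym (ℚ.∣p*q∣≡∣p∣*∣q∣ p q))
  (ℚ.≤-trans (ℚ.*-monoʳ-≤-nonNeg ℚ.∣ q ∣ ⦃ ℚ.∣-∣-nonNeg q ⦄ p≤)
             (ℚ.*-monoˡ-≤-nonNeg B ⦃ ℚ.nonNegative (ℚ.<⇒≤ 0<B) ⦄ q≤))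

*-congˡ≈ : ∀ c x y → x ≈ y → c * x ≈ c * y
*-congˡ≈ c x y x≈y ε 0<ε =
  let B , 0<B , c≤B = bounded (seq c) (cauchy c)
      δ , 0<δ , Bδ≡ε = quotient B ε 0<B 0<ε
      close : ∀ n → ℚ.∣ seq c n ∣ ℚ.≤ B → ℚ.∣ seq x n ℚ.- seq y n ∣ ℚ.≤ δ →
              ℚ.∣ seq c n ℚ.* seq x n ℚ.- seq c n ℚ.* seq y n ∣ ℚ.≤ ε
      close n p q = subst (λ t → ℚ.∣ t ∣ ℚ.≤ ε) (eq (seq c n) (seq x n) (seq y n))
        (subst (ℚ.∣ seq c n ℚ.* (seq x n ℚ.- seq y n) ∣ ℚ.≤_) Bδ≡ε
          (abs-* (seq c n) (seq x n ℚ.- seq y n) B δ 0<B p q))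
  in both close c≤B (x≈y δ 0<δ)
  where
  open +-*-Solver
  eq : ∀ c x y → c ℚ.* (x ℚ.- y) ≡ c ℚ.* x ℚ.- c ℚ.* y
  eq = solve 3 (λ c x y → c :* (x :- y) := c :* x :- c :* y) refl

infix 8 _⟨·⟩_

_⟨·⟩_ : ∀ {d} → Point d → Point d → ℝ
u ⟨·⟩ y = sum λ j → u j * y j

⟨·⟩-cong : ∀ {d} (u : Point d) {y z} → y ≋ z → u ⟨·⟩ y ≈ u ⟨·⟩ z
⟨·⟩-cong u {y} {z} y≋z = sum-cong≈ (λ j → u j * y j) (λ j → u j * z j) λ j → *-congˡ≈ (u j) (y j) (z j) (y≋z j)

⟨·⟩-linComb : ∀ {m d} (u : Point d) (c : Fin m → ℝ) p →
              seq (u ⟨·⟩ linComb c p) ≗ seq (sum λ i → c i * (u ⟨·⟩ p i))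
⟨·⟩-linComb {m} {d} u c p k = begin
    seq (u ⟨·⟩ linComb c p) k
      ≡⟨ seq-sum (λ j → u j * linComb c p j) k ⟩
    ∑ℚ.sum (λ j → u′ j ℚ.* seq (linComb c p j) k)
      ≡⟨ ∑ℚ.sum-cong-≗ {d} (λ j → trans (cong (u′ j ℚ.*_) (seq-sum (λ i → c i * p i j) k))
           (∑ℚ.*-distribˡ-sum (u′ j) λ i → c′ i ℚ.* p′ i j)) ⟩
    ∑ℚ.sum (λ j → ∑ℚ.sum λ i → u′ j ℚ.* (c′ i ℚ.* p′ i j))
      ≡⟨ ∑ℚ.∑-comm {d} {m} (λ j i → u′ j ℚ.* (c′ i ℚ.* p′ i j)) ⟩
    ∑ℚ.sum (λ i → ∑ℚ.sum λ j → u′ j ℚ.* (c′ i ℚ.* p′ i j))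
      ≡⟨ ∑ℚ.sum-cong-≗ {m} (λ i → trans (∑ℚ.sum-cong-≗ {d} λ j → eq (u′ j) (c′ i) (p′ i j))
           (sym (∑ℚ.*-distribˡ-sum (c′ i) λ j → u′ j ℚ.* p′ i j))) ⟩
    ∑ℚ.sum (λ i → c′ i ℚ.* ∑ℚ.sum λ j → u′ j ℚ.* p′ i j)
      ≡⟨ ∑ℚ.sum-cong-≗ {m} (λ i → cong (c′ i ℚ.*_) (sym (seq-sum (λ j → u j * p i j) k))) ⟩
    ∑ℚ.sum (λ i → c′ i ℚ.* seq (u ⟨·⟩ p i) k)
      ≡⟨ seq-sum (λ i → c i * (u ⟨·⟩ p i)) k ⟨
    seq (sum λ i → c i * (u ⟨·⟩ p i)) k ∎
  where
  open ≡-Reasoning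
  u′ : Fin d → ℚ
  u′ j = seq (u j) k
  c′ : Fin m → ℚ
  c′ i = seq (c i) k
  p′ : Fin m → Fin d → ℚ
  p′ i j = seq (p i j) k
  open +-*-Solver
  eq : ∀ a b c → a ℚ.* (b ℚ.* c) ≡ b ℚ.* (a ℚ.* c)
  eq = solve 3 (λ a b c → a :* (b :* c) := b :* (a :* c)) refl

sum-*ʳ : ∀ {m} (c : Fin m → ℝ) β → seq (sum λ i → c i * β) ≗ seq (β * sum c)
sum-*ʳ {m} c β k = begin
    seq (sum λ i → c i * β) k
      ≡⟨ seq-sum (λ i → c i * β) k ⟩
    ∑ℚ.sum (λ i → seq (c i) k ℚ.* seq β k)
      ≡⟨ ∑ℚ.sum-cong-≗ {m} (λ i → ℚ.*-comm (seq (c i) k) (seq β k)) ⟩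
    ∑ℚ.sum (λ i → seq β k ℚ.* seq (c i) k)
      ≡⟨ ∑ℚ.*-distribˡ-sum (seq β k) (λ i → seq (c i) k) ⟨
    seq β k ℚ.* ∑ℚ.sum (λ i → seq (c i) k)
      ≡⟨ cong (seq β k ℚ.*_) (seq-sum c k) ⟨
    seq β k ℚ.* seq (sum c) k ∎
  where open ≡-Reasoning

affine-combination : ∀ {m d} (u : Point d) β (c : Fin m → ℝ) p y → (∀ i → u ⟨·⟩ p i ≈ β) →
                     sum c ≈ 1ℝ → linComb c p ≋ y → u ⟨·⟩ y ≈ β
affine-combination {m} {d} u β c p y on-p Σc≈1 lc≋y = ≈-trans t₀ t₁ β s₁ (≈-trans t₁ t₂ β s₂
    (≈-trans t₂ t₃ β s₃ (≈-trans t₃ t₄ β s₄ (≈-trans t₄ t₅ β s₅ s₆))))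
  where
  t₀ t₁ t₂ t₃ t₄ t₅ : ℝ
  t₀ = u ⟨·⟩ y
  t₁ = u ⟨·⟩ linComb c p
  t₂ = sum λ i → c i * (u ⟨·⟩ p i)
  t₃ = sum λ i → c i * β
  t₄ = β * sum c
  t₅ = β * 1ℝ
  s₁ : t₀ ≈ t₁
  s₁ = ≈-sym t₁ t₀ (⟨·⟩-cong u {linComb c p} {y} lc≋y)
  s₂ : t₁ ≈ t₂
  s₂ = ≗⇒≈ t₁ t₂ (⟨·⟩-linComb u c p)
  s₃ : t₂ ≈ t₃
  s₃ = sum-cong≈ (λ i → c i * (u ⟨·⟩ p i)) (λ i → c i * β) λ i → *-congˡ≈ (c i) (u ⟨·⟩ p i) β (on-p i)
  s₄ : t₃ ≈ t₄
  s₄ = ≗⇒≈ t₃ t₄ (sum-*ʳ c β)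
  s₅ : t₄ ≈ t₅
  s₅ = *-congˡ≈ β (sum c) 1ℝ Σc≈1
  s₆ : t₅ ≈ β
  s₆ = ≗⇒≈ t₅ β λ k → ℚ.*-identityʳ (seq β k)

-- An affine function that is constant on X is constant on the affine hull, which is the whole
-- space. Hence the equations of a description cut nothing off, and no nonzero covector is constant
-- on X.
aff-extend : ∀ {d} (X : LatticeSet d) → FullDimensional X → ∀ u β →
             (∀ x → X x → u ⟨·⟩ ι x ≈ β) → ∀ y → u ⟨·⟩ y ≈ β
aff-extend X full u β h y =
  let m , c , p , p∈X , Σc≈1 , lc≋y = full y
  in affine-combination u β c p y (λ i → on-p (p i) (p∈X i)) Σc≈1 lc≋y
  where
  on-p : ∀ p → embed X p → u ⟨·⟩ p ≈ β
  on-p p (x , x∈X , ιx≋p) = ≈-trans (u ⟨·⟩ p) (u ⟨·⟩ ι x) β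
    (≈-sym (u ⟨·⟩ ι x) (u ⟨·⟩ p) (⟨·⟩-cong u {ι x} {p} ιx≋p)) (h x x∈X)

fromℤ-≈⇒≡ : ∀ i j → fromℤ i ≈ fromℤ j → i ≡ j
fromℤ-≈⇒≡ i j i≈j with i≈j ½ (ℚ.positive⁻¹ ½)
... | N , p = ℤ.i-j≡0⇒i≡j i j (tiny (i ℤ.- j) (subst (λ t → ℚ.∣ t ∣ ℚ.≤ ½)
        (sym (trans (int-+ i (ℤ.- j)) (cong (int i ℚ.+_) (int-neg j)))) (p N ℕ.≤-refl)))
  where
  1≰½ : ¬ int 1ℤ ℚ.≤ ½
  1≰½ (ℚ.*≤* (ℤ.+≤+ (s≤s ())))
  tiny⁺ : ∀ n → ¬ ℚ.∣ int (+ suc n) ∣ ℚ.≤ ½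
  tiny⁺ n h = 1≰½ (ℚ.≤-trans (int-mono {1ℤ} {+ suc n} (ℤ.+≤+ (s≤s z≤n))) (ℚ.≤-trans (p≤∣p∣ (int (+ suc n))) h))
  tiny : ∀ z → ℚ.∣ int z ∣ ℚ.≤ ½ → z ≡ 0ℤ
  tiny (+ zero)  h = refl
  tiny (+ suc n) h = ⊥-elim (tiny⁺ n h)
  tiny -[1+ n ]  h = ⊥-elim (tiny⁺ n (subst (ℚ._≤ ½)
    (trans (sym (ℚ.∣-p∣≡∣p∣ (int -[1+ n ]))) (cong ℚ.∣_∣ (sym (int-neg -[1+ n ])))) h))

-- Affinely independent points of a full-dimensional set

homog : ∀ {d} → LatticePoint d → V (suc d)
homog x zero    = 1ℤ
homog x (suc j) = lookup x j

dot : ∀ {n} → V n → V n → ℤ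
dot u v = ∑.sum λ j → u j ℤ.* v j

-- The equation spreads from X to all lattice points. At the origin it gives φ₀ = 0, and at the unit
-- vectors it gives the remaining coefficients.
no-equation : ∀ {d} (X : LatticeSet d) → FullDimensional X → (φ : V (suc d)) →
              (∀ x → X x → dot φ (homog x) ≡ 0ℤ) → φ ≗ 𝟘
no-equation {d} X full φ h = λ { zero → φ₀≡0 ; (suc i) → φᵢ≡0 i }
  where
  u : Point d
  u j = fromℤ (φ (suc j))
  rest : LatticePoint d → ℤ
  rest x = ∑.sum λ j → φ (suc j) ℤ.* lookup x j
  u-seq : ∀ x → u ⟨·⟩ ι x ≈ fromℤ (rest x)
  u-seq x = ≗⇒≈ (u ⟨·⟩ ι x) (fromℤ (rest x)) λ k → trans (seq-sum (λ j → u j * ι x j) k)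
    (sym (trans (int-sum (λ j → φ (suc j) ℤ.* lookup x j)) (∑ℚ.sum-cong-≗ {d} λ j → int-* (φ (suc j)) (lookup x j))))
  everywhere : ∀ x → rest x ≡ ℤ.- φ zero
  everywhere x = fromℤ-≈⇒≡ (rest x) (ℤ.- φ zero)
    (≈-trans (fromℤ (rest x)) (u ⟨·⟩ ι x) (fromℤ (ℤ.- φ zero)) (≈-sym (u ⟨·⟩ ι x) (fromℤ (rest x)) (u-seq x))
      (aff-extend X full u (fromℤ (ℤ.- φ zero)) (λ x x∈X →
        subst (λ t → u ⟨·⟩ ι x ≈ fromℤ t) (solve₀ (φ zero) (rest x) (h x x∈X)) (u-seq x)) (ι x)))
    where
    eq : ∀ a b → b ≡ (a ℤ.* 1ℤ ℤ.+ b) ℤ.- a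
    eq = solve-∀
    solve₀ : ∀ a b → a ℤ.* 1ℤ ℤ.+ b ≡ 0ℤ → b ≡ ℤ.- a
    solve₀ a b p = trans (eq a b) (trans (cong (ℤ._- a) p) (ℤ.+-identityˡ (ℤ.- a)))
  φ₀≡0 : φ zero ≡ 0ℤ
  φ₀≡0 = trans (sym (ℤ.neg-involutive (φ zero))) (cong ℤ.-_ (trans (sym (everywhere (tabulate 𝟘)))
    (trans (∑.sum-cong-≗ {d} λ j → trans (cong (φ (suc j) ℤ.*_) (lookup∘tabulate 𝟘 j)) (ℤ.*-zeroʳ (φ (suc j))))
           (∑.sum-replicate-zero d))))
  φᵢ≡0 : ∀ i → φ (suc i) ≡ 0ℤ
  φᵢ≡0 i = trans (sym (lin-δ i (λ j (_ : Fin 1) → φ (suc j)) zero))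
    (trans (∑.sum-cong-≗ {d} λ j → trans (cong (ℤ._* φ (suc j)) (sym (lookup∘tabulate (δ i) j)))
                                         (ℤ.*-comm (lookup (tabulate (δ i)) j) (φ (suc j))))
           (trans (everywhere (tabulate (δ i))) (cong ℤ.-_ φ₀≡0)))

-- A maximal independent family of homogenised points of X is annihilated by an integer
-- covector if it is too small.
independent-points : ∀ {d} (X : LatticeSet d) → FullDimensional X → ∀ m → m ℕ.≤ suc d →
                     ¬ ¬ ∃ λ (y : Fin m → LatticePoint d) → (∀ k → X (y k)) × Indep (homog ∘ y)
independent-points X full zero    m≤ = return ((λ ()) , (λ ()) , λ _ _ ())
independent-points {d} X full (suc m) m≤ = do
  (y , y∈X , indep) ← independent-points X full m (ℕ.≤-trans (ℕ.n≤1+n m) m≤)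
  -- The transposed matrix: its d + 1 columns lie in ℤ^m with m ≤ d, and a dependency among them is
  -- a covector annihilating all chosen points.
  (φ , φ≢0 , φ⊥y) ← siegel m≤ (λ i j → homog (y j) i)
  no stuck ← em (∀ x → X x → dot φ (homog x) ≡ 0ℤ)
    where yes all → λ _ → proj₂ φ≢0 (no-equation X full φ all (proj₁ φ≢0))
  -- No point off the hyperplane can be extracted from `stuck`; instead each x is shown to lie on
  -- it, since otherwise `done` would accept x as the next point.
  λ done → stuck λ x x∈X → decidable-stable (dot φ (homog x) ℤ.≟ 0ℤ) λ φx≢0 →
    let y′ : Fin (suc m) → LatticePoint d
        y′ = λ { zero → x ; (suc k) → y k }
        apply : ∀ c → lin c (homog ∘ y′) ≗ 𝟘 → dot φ (λ i → lin c (homog ∘ y′) i) ≡ 0ℤ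
        apply c h = trans (∑.sum-cong-≗ {suc d} λ i → trans (cong (φ i ℤ.*_) (h i)) (ℤ.*-zeroʳ (φ i)))
                          (∑.sum-replicate-zero (suc d))
        -- Pairing the relation with φ leaves only the term of x.
        c₀≡0 : ∀ c → lin c (homog ∘ y′) ≗ 𝟘 → c zero ≡ 0ℤ
        c₀≡0 c h = decidable-stable (c zero ℤ.≟ 0ℤ) λ c₀≢0 →
          φx≢0 (ℤ.*-cancelˡ-≡ (c zero) _ 0ℤ ⦃ ℤ.≢-nonZero c₀≢0 ⦄
            (trans (sym (dot-lin φ c (homog ∘ y′) φ⊥y)) (trans (apply c h) (sym (ℤ.*-zeroʳ (c zero))))))
    in done (y′ , (λ { zero → x∈X ; (suc k) → y∈X k })
           , λ c h → λ { zero → c₀≡0 c h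
                       ; (suc k) → indep (c ∘ suc) (λ i → trans (drop₀ (c zero) (homog x i) _ (c₀≡0 c h)) (h i)) k })
  where
  drop₀ : ∀ a x s → a ≡ 0ℤ → s ≡ a ℤ.* x ℤ.+ s
  drop₀ a x s refl = trans (sym (ℤ.+-identityˡ s)) (cong (ℤ._+ s) (sym (ℤ.*-zeroˡ x)))
  dot-lin : ∀ {m n} (φ : V n) (c : V (suc m)) (g : Fin (suc m) → V n) →
            lin φ (λ i j → g (suc j) i) ≗ 𝟘 → dot φ (lin c g) ≡ c zero ℤ.* dot φ (g zero)
  dot-lin {m} {n} φ c g φ⊥ = begin
      ∑.sum (λ i → φ i ℤ.* ∑.sum λ k → c k ℤ.* g k i)
        ≡⟨ ∑.sum-cong-≗ {n} (λ i → ∑.*-distribˡ-sum (φ i) λ k → c k ℤ.* g k i) ⟩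
      ∑.sum (λ i → ∑.sum λ k → φ i ℤ.* (c k ℤ.* g k i))
        ≡⟨ ∑.∑-comm {n} {suc m} (λ i k → φ i ℤ.* (c k ℤ.* g k i)) ⟩
      ∑.sum (λ k → ∑.sum λ i → φ i ℤ.* (c k ℤ.* g k i))
        ≡⟨ ∑.sum-cong-≗ {suc m} (λ k → trans (∑.sum-cong-≗ {n} λ i → eq (φ i) (c k) (g k i))
             (sym (∑.*-distribˡ-sum (c k) λ i → φ i ℤ.* g k i))) ⟩
      ∑.sum (λ k → c k ℤ.* dot φ (g k))
        ≡⟨ cong (ℤ._+_ (c zero ℤ.* dot φ (g zero))) (trans
             (∑.sum-cong-≗ {m} λ k → trans (cong (c (suc k) ℤ.*_) (φ⊥ k)) (ℤ.*-zeroʳ (c (suc k))))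
             (∑.sum-replicate-zero m)) ⟩
      c zero ℤ.* dot φ (g zero) ℤ.+ 0ℤ
        ≡⟨ ℤ.+-identityʳ _ ⟩
      c zero ℤ.* dot φ (g zero) ∎
    where
    open ≡-Reasoning
    eq : ∀ a b c → a ℤ.* (b ℤ.* c) ≡ b ℤ.* (a ℤ.* c)
    eq = solve-∀

-- Lattice points of polyhedra

-- Coordinate 0 carries a positive constant, coordinate 1 homogenises.
record Pt {n} (v : V (suc (suc n))) : Set where
  constructor _,_
  field
    unit  : v zero ≡ 0ℤ
    level : v (suc zero) ≡ 1ℤ

record Dir {n} (v : V (suc (suc n))) : Set where
  constructor _,_
  field
    unit  : v zero ≡ 0ℤ
    level : v (suc zero) ≡ 0ℤ

pt-⊕ : ∀ {n} {x z : V (suc (suc n))} → Pt x → Dir z → Pt (x ⊕ z)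
pt-⊕ (p , q) (r , s) = cong₂ ℤ._+_ p r , cong₂ ℤ._+_ q s

dir-⊖ : ∀ {n} {x y : V (suc (suc n))} → Pt x → Pt y → Dir (x ⊖ y)
dir-⊖ (p , q) (r , s) = cong₂ ℤ._-_ p r , cong₂ ℤ._-_ q s

dir-• : ∀ {n} a {z : V (suc (suc n))} → Dir z → Dir (a • z)
dir-• a (p , q) = trans (cong (a ℤ.*_) p) (ℤ.*-zeroʳ a) , trans (cong (a ℤ.*_) q) (ℤ.*-zeroʳ a)

dir-⊝ : ∀ {n} {z : V (suc (suc n))} → Dir z → Dir (⊝ z)
dir-⊝ (p , q) = cong ℤ.-_ p , cong ℤ.-_ q

dir-lin : ∀ {m n} (c : V m) (g : Fin m → V (suc (suc n))) → (∀ i → Dir (g i)) → Dir (lin c g)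
dir-lin {m} c g dir = vanish (λ i → Dir.unit (dir i)) , vanish (λ i → Dir.level (dir i))
  where
  vanish : ∀ {j} → (∀ i → g i j ≡ 0ℤ) → lin c g j ≡ 0ℤ
  vanish {j} h = trans (∑.sum-cong-≗ {m} λ i → trans (cong (c i ℤ.*_) (h i)) (ℤ.*-zeroʳ (c i)))
                       (∑.sum-replicate-zero m)

⊝-null : ∀ {n} {z : V n} → ⊝ z ≗ 𝟘 → z ≗ 𝟘
⊝-null {z = z} h j = trans (sym (ℤ.neg-involutive (z j))) (cong ℤ.-_ (h j))

lin-diff : ∀ {m n} (c : V m) (v : Fin m → V n) w → lin c (λ i → v i ⊖ w) ≗ lin c v ⊖ ∑.sum c • w
lin-diff {m} c v w j = begin
    ∑.sum (λ i → c i ℤ.* (v i j ℤ.- w j))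
      ≡⟨ ∑.sum-cong-≗ {m} (λ i → eq (c i) (v i j) (w j)) ⟩
    ∑.sum (λ i → c i ℤ.* v i j ℤ.+ c i ℤ.* (ℤ.- w j))
      ≡⟨ ∑.∑-distrib-+ (λ i → c i ℤ.* v i j) (λ i → c i ℤ.* (ℤ.- w j)) ⟩
    lin c v j ℤ.+ ∑.sum (λ i → c i ℤ.* (ℤ.- w j))
      ≡⟨ cong (ℤ._+_ (lin c v j)) (sym (∑.*-distribʳ-sum (ℤ.- w j) c)) ⟩
    lin c v j ℤ.+ ∑.sum c ℤ.* (ℤ.- w j)
      ≡⟨ cong (ℤ._+_ (lin c v j)) (sym (ℤ.neg-distribʳ-* (∑.sum c) (w j))) ⟩
    lin c v j ℤ.- ∑.sum c ℤ.* w j ∎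
  where
  open ≡-Reasoning
  eq : ∀ a x y → a ℤ.* (x ℤ.- y) ≡ a ℤ.* x ℤ.+ a ℤ.* (ℤ.- y)
  eq = solve-∀

module Polyhedron {d} (P : Fin d → Cone (suc (suc d))) where
  private module P i = Cone (P i)

  W : Set
  W = V (suc (suc d))

  X : W → Set
  X v = Pt v × ∀ i → P i ∋ v

  Complete : List W → Set
  Complete xs = ∀ v → X v → Any (v ≗_) xs

  -- x, x + z, x + 2z, … lie in the finite set X.
  recession : ∀ xs → Complete xs → ∀ {x z} → X x → Dir z → (∀ i → P i ∋ z) → z ≗ 𝟘
  recession xs complete {x} {z} (ptx , x∈) dz z∈ =
    let (k , l , k<l , eq) = Fin.pigeonhole (ℕ.n<1+n (length xs)) (λ k → Any.index (step k))
    in λ j → same (toℕ k) (toℕ l) k<l (x j) (z j)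
         (trans (Any.lookup-index (step k) j)
           (trans (cong (λ t → List.lookup xs t j) eq) (sym (Any.lookup-index (step l) j))))
    where
    step : (k : Fin (suc (length xs))) → Any ((x ⊕ + toℕ k • z) ≗_) xs
    step k = complete (x ⊕ + toℕ k • z)
      (pt-⊕ ptx (dir-• (+ toℕ k) dz) , λ i → P.add i (x∈ i) (P.mul∈ i (toℕ k) (z∈ i)))
    sub : ∀ a x → x ≡ (a ℤ.+ x) ℤ.- a
    sub = solve-∀
    same : ∀ k l → k ℕ.< l → ∀ a b → a ℤ.+ + k ℤ.* b ≡ a ℤ.+ + l ℤ.* b → b ≡ 0ℤ
    same k l k<l a b eq = decidable-stable (b ℤ.≟ 0ℤ) λ b≢0 →
      ℕ.<⇒≢ k<l (ℤ.+-injective (ℤ.*-cancelʳ-≡ (+ k) (+ l) b ⦃ ℤ.≢-nonZero b≢0 ⦄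
            (trans (sub a (+ k ℤ.* b)) (trans (cong (ℤ._- a) eq) (sym (sub a (+ l ℤ.* b)))))))

  -- Row i takes finitely many values on X, so some `η i` is no larger than any nonzero value and
  -- any nonzero difference of two values.
  record Threshold : Set where
    field
      η     : Fin d → W
      pos   : ∀ i → Pos (P i) (η i)
      tight : ∀ i {x} → X x → Small (P i) (η i) x → P i ∋ ⊝ x
      equal : ∀ i {x x′} → X x → X x′ → Small (P i) (η i) (x′ ⊖ x) → P i ∋ x′ ⊖ x

  threshold : ∀ xs → Complete xs → (∀ i → ∃ (Pos (P i))) → ¬ ¬ Threshold
  threshold xs complete one = do
    th ← ¬¬-Π λ i → small-threshold (P i) (proj₂ (one i)) (xs ++ cartesianProductWith _⊖_ xs xs)
    let all = λ i → proj₂ (proj₂ (th i))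
    return (record
      { η     = λ i → proj₁ (th i)
      ; pos   = λ i → proj₁ (proj₂ (th i))
      ; tight = λ i {x} x∈X s →
          let (v , v∈ , x≗v) = find (complete x x∈X)
          in P.resp i (λ j → cong ℤ.-_ (sym (x≗v j)))
               (proj₂ (All.lookup (all i) (Mem.∈-++⁺ˡ v∈) (small-resp (P i) x≗v s)))
      ; equal = λ i {x} {x′} x∈X x′∈X s →
          let (v , v∈ , x≗v) = find (complete x x∈X)
              (v′ , v′∈ , x′≗v′) = find (complete x′ x′∈X)
              d≗ = λ j → cong₂ ℤ._-_ (x′≗v′ j) (x≗v j)
          in P.resp i (λ j → sym (d≗ j))
               (proj₁ (All.lookup (all i)
                 (Mem.∈-++⁺ʳ xs (Mem.∈-cartesianProductWith⁺ _⊖_ v′∈ v∈)) (small-resp (P i) d≗ s)))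
      })

  module Bounded (xs : List W) (complete : Complete xs) (th : Threshold) where
    open Threshold th

    rec : ∀ {x z} → X x → Dir z → (∀ i → P i ∋ z) → z ≗ 𝟘
    rec = recession xs complete

    -- The contrapositive of `tight`; the lower half of smallness is automatic because x satisfies
    -- the row.
    slack : ∀ i {x} → X x → ¬ P i ∋ ⊝ x → P i ∋ x ⊖ η i
    slack i {x} x∈X loose = P.stable i λ ∌ → loose (tight i x∈X (∌ ,
      λ p → pos i (P.resp i (λ j → eq (x j) (η i j)) (P.add i p (proj₂ x∈X i)))))
      where
      eq : ∀ x e → (ℤ.- x ℤ.- e) ℤ.+ x ≡ ℤ.- e
      eq = solve-∀

    -- Rows that decrease along z have slack at least η at x and decrease by less than η, so x + z
    -- stays in X. But values on X that differ by less than η are equal, hence no row decreases at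
    -- all and z is a recession direction.
    escape : ∀ {x z} → X x → Dir z → ¬ z ≗ 𝟘 → (∀ i → ¬ P i ∋ z → (¬ P i ∋ ⊝ x) × Small (P i) (η i) z) → ⊥
    escape {x} {z} x∈X dz z≢0 h = z≢0 (rec x∈X dz λ i → P.stable i λ z∉ →
      z∉ (P.resp i (λ j → eq₁ (x j) (z j))
        (equal i x∈X x+z∈X (small-resp (P i) (λ j → sym (eq₁ (x j) (z j))) (proj₂ (h i z∉))))))
      where
      eq₁ : ∀ x z → (x ℤ.+ z) ℤ.- x ≡ z
      eq₁ = solve-∀
      eq₂ : ∀ x z e → (x ℤ.- e) ℤ.+ (e ℤ.+ z) ≡ x ℤ.+ z
      eq₂ = solve-∀
      x+z∈X : X (x ⊕ z)
      x+z∈X = pt-⊕ (proj₁ x∈X) dz , λ i → P.stable i λ ∌ →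
        let ∌z = λ z∈ → ∌ (P.add i (proj₂ x∈X i) z∈)
            (loose , small) = h i ∌z
        in ∌ (P.resp i (λ j → eq₂ (x j) (z j) (η i j)) (P.add i (slack i x∈X loose) (small⁺ (P i) small)))

    module Points (y : Fin (suc d) → W) (y∈X : ∀ k → X (y k)) (indep : Indep y) where

      Tight : Fin (suc d) → Fin d → Set
      Tight k i = P i ∋ ⊝ y k

      distinct : ∀ {k l} → k ≢ l → ¬ y k ⊖ y l ≗ 𝟘
      distinct {k} {l} k≢l h = 1≢0 (trans (sym (cong₂ ℤ._-_ (δ-same k) (δ-diff (k≢l ∘ sym))))
          (indep (δ k ⊖ δ l) (λ j → trans (lin-⊖ (δ k) (δ l) y j)
            (trans (cong₂ ℤ._-_ (lin-δ k y j) (lin-δ l y j)) (h j))) k))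

      escape-diff : ∀ {k l} → k ≢ l → ¬ (∀ i → P i ∋ y k ⊖ y l)
      escape-diff {k} {l} k≢l h = distinct k≢l (rec (y∈X k) (dir-⊖ (proj₁ (y∈X k)) (proj₁ (y∈X l))) h)

      -- The difference vanishes on the common rows. Whatever its sign on r, one of its two
      -- orientations is a recession direction.
      share-all-but-one : ∀ {k l} → k ≢ l → ∀ r → (∀ i → i ≢ r → Tight k i × Tight l i) → ⊥
      share-all-but-one {k} {l} k≢l r h = em (P r ∋ y k ⊖ y l) λ
        { (yes p) → escape-diff k≢l (cover k l (λ i i≢r → proj₂ (h i i≢r)) p)
        ; (no ¬p) → escape-diff (k≢l ∘ sym) (cover l k (λ i i≢r → proj₁ (h i i≢r))
                      (P.resp r (λ j → eq (y k j) (y l j)) (P.total r ¬p))) }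
        where
        eq : ∀ a b → ℤ.- (a ℤ.- b) ≡ b ℤ.- a
        eq = solve-∀
        cover : ∀ k l → (∀ i → i ≢ r → Tight l i) → P r ∋ y k ⊖ y l → ∀ i → P i ∋ y k ⊖ y l
        cover k l tl p i with i Fin.≟ r
        ... | yes refl = p
        ... | no i≢r   = P.add i (proj₂ (y∈X k) i) (tl i i≢r)

      -- There are d + 1 points but only d exceptional rows, so two points have the same one.
      not-all-but-one : ¬ (∀ k → ∃ λ r → ∀ i → i ≢ r → Tight k i)
      not-all-but-one h =
        let (k , l , k<l , eq) = Fin.pigeonhole (ℕ.n<1+n d) (λ k → proj₁ (h k))
        in share-all-but-one (Fin.<⇒≢ k<l) (proj₁ (h k)) λ i i≢r →
             proj₂ (h k) i i≢r , proj₂ (h l) i (λ i≡r → i≢r (trans i≡r (sym eq)))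

      g : Fin d → W
      g i = y (suc i) ⊖ y zero

      dir-g : ∀ i → Dir (g i)
      dir-g i = dir-⊖ (proj₁ (y∈X (suc i))) (proj₁ (y∈X zero))

      lin-g≢0 : ∀ c → NonZero c → ¬ lin c g ≗ 𝟘
      -- The coefficient -Σc of `y zero` turns a combination of differences into a combination of
      -- points.
      lin-g≢0 c (i , cᵢ≢0) h = cᵢ≢0 (indep (λ { zero → ℤ.- ∑.sum c ; (suc i) → c i })
          (λ j → trans (eq (∑.sum c) (y zero j) (lin c (y ∘ suc) j))
                (trans (sym (lin-diff c (y ∘ suc) (y zero) j)) (h j))) (suc i))
        where
        eq : ∀ s w v → (ℤ.- s) ℤ.* w ℤ.+ v ≡ v ℤ.- s ℤ.* w
        eq = solve-∀

      -- The multiplier is `suc s`, which excludes 0; the arguments 15 and 63 used later stand for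
      -- 16 and 64.
      record LatticeVec (θ : Fin d → W) (s : ℕ) : Set where
        field
          c     : V d
          c≢0   : NonZero c
          small : ∀ i → Small (P i) (θ i) (+ suc s • lin c g)
        z : W
        z = lin c g
        dir : Dir z
        dir = dir-lin c g dir-g
        z≢0 : ¬ z ≗ 𝟘
        z≢0 = lin-g≢0 c c≢0

      diff-null : ∀ {k l} i → Tight k i → Tight l i → Null (P i) (y l ⊖ y k)
      diff-null {k} {l} i ki li = P.add i (proj₂ (y∈X l) i) ki ,
          P.resp i (λ j → eq (y l j) (y k j)) (P.add i li (proj₂ (y∈X k) i))
        where
        eq : ∀ a b → ℤ.- a ℤ.+ b ≡ ℤ.- (a ℤ.- b)
        eq = solve-∀

      common-tight⇒null : ∀ c i → (∀ k → Tight k i) → Null (P i) (lin c g)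
      common-tight⇒null c i tight = null-lin (P i) c g λ l → diff-null i (tight zero) (tight (suc l))

      -- Otherwise every row that decreases along z is loose at `y k`, and `escape` applies.
      one-sided : ∀ {z} → Dir z → ¬ z ≗ 𝟘 → (∀ i → Small (P i) (η i) z) →
                  ∀ k → ¬ (∀ i → Tight k i → P i ∋ z)
      one-sided dz z≢0 small k h = escape (y∈X k) dz z≢0 λ i z∉ → (λ t → z∉ (h i t)) , small i

      module Signs (tight? : ∀ k i → Dec (Tight k i)) {z} (dz : Dir z) (z≢0 : ¬ z ≗ 𝟘)
                   (small : ∀ i → Small (P i) (η i) z)
                   (z∈? : ∀ i → Dec (P i ∋ z)) (⊝z∈? : ∀ i → Dec (P i ∋ ⊝ z)) where

        private
          find-tight : ∀ k (Q : Fin d → Set) → (∀ i → Dec (Q i)) → ¬ (∀ i → Tight k i → Q i) →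
                       ∃ λ i → Tight k i × ¬ Q i
          find-tight k Q Q? h with Fin.¬∀⟶∃¬ d (λ i → Tight k i → Q i) (λ i → tight? k i →-dec Q? i) h
          ... | i , ¬tq with tight? k i
          ...   | yes t = i , t , λ q → ¬tq (λ _ → q)
          ...   | no ¬t = ⊥-elim (¬tq λ t → ⊥-elim (¬t t))

        pos-row : ∀ k → ∃ λ i → Tight k i × Pos (P i) z
        pos-row k = find-tight k (λ i → P i ∋ ⊝ z) ⊝z∈?
          (one-sided (dir-⊝ dz) (z≢0 ∘ ⊝-null) (λ i → small-⊝ (P i) (small i)) k)

        neg-row : ∀ k → ∃ λ i → Tight k i × ¬ P i ∋ z
        neg-row k = find-tight k (λ i → P i ∋ z) z∈? (one-sided dz z≢0 small k)

        two-rows : ∀ k → ∃₂ λ i j → i ≢ j × Tight k i × Tight k j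
        two-rows k =
          let (i , ti , pi) = pos-row k
              (j , tj , nj) = neg-row k
          in i , j , (λ i≡j → pi (P.total i (subst (λ r → ¬ P r ∋ z) (sym i≡j) nj))) , ti , tj

module _ {k} (P : Fin (suc k) → Cone (suc (suc (suc k)))) where
  open Polyhedron P

  module _ (xs : List W) (complete : Complete xs) (th : Threshold)
           (y : Fin (suc (suc k)) → W) (y∈X : ∀ k → X (y k)) (indep : Indep y) where
    open Bounded xs complete th
    open Points y y∈X indep

    -- There is one difference `g i` per row, and a nonzero combination of them inside all cones
    -- would be a recession direction: exactly the setting of `small-all`.
    lattice-vec : ∀ θ → (∀ i → Pos (P i) (θ i)) → ∀ s → ¬ ¬ LatticeVec θ s
    lattice-vec θ pos s = small-all P θ pos g s
      (λ c c≢0 h → lin-g≢0 c c≢0 (rec (y∈X zero) (dir-lin c g dir-g) h)) >>= λ (c , c≢0 , small) →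
      return (record { c = c ; c≢0 = c≢0 ; small = small })

-- Independence of short vectors

dot-comm : ∀ {n} (u v : V n) → dot u v ≡ dot v u
dot-comm {n} u v = ∑.sum-cong-≗ {n} λ j → ℤ.*-comm (u j) (v j)

dot-cong : ∀ {n} (u : V n) {v w : V n} → v ≗ w → dot u v ≡ dot u w
dot-cong {n} u v≗w = ∑.sum-cong-≗ {n} λ j → cong (u j ℤ.*_) (v≗w j)

dot-⊕ : ∀ {n} (u v w : V n) → dot u (v ⊕ w) ≡ dot u v ℤ.+ dot u w
dot-⊕ {n} u v w = trans (∑.sum-cong-≗ {n} λ j → ℤ.*-distribˡ-+ (u j) (v j) (w j))
                        (∑.∑-distrib-+ (λ j → u j ℤ.* v j) (λ j → u j ℤ.* w j))

dot-• : ∀ {n} (u : V n) a v → dot u (a • v) ≡ a ℤ.* dot u v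
dot-• {n} u a v = trans (∑.sum-cong-≗ {n} λ j → eq (u j) a (v j)) (sym (∑.*-distribˡ-sum a λ j → u j ℤ.* v j))
  where
  eq : ∀ u a v → u ℤ.* (a ℤ.* v) ≡ a ℤ.* (u ℤ.* v)
  eq = solve-∀

dot-⊝ : ∀ {n} (u v : V n) → dot u (⊝ v) ≡ ℤ.- dot u v
dot-⊝ u v = trans (dot-cong u λ j → sym (ℤ.-1*i≡-i (v j))) (trans (dot-• u (ℤ.- 1ℤ) v) (ℤ.-1*i≡-i (dot u v)))

dot-⊖ : ∀ {n} (u v w : V n) → dot u (v ⊖ w) ≡ dot u v ℤ.- dot u w
dot-⊖ u v w = trans (dot-⊕ u v (⊝ w)) (cong (ℤ._+_ (dot u v)) (dot-⊝ u w))

dot-𝟘 : ∀ {n} (u : V n) → dot u 𝟘 ≡ 0ℤ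
dot-𝟘 {n} u = trans (∑.sum-cong-≗ {n} λ j → ℤ.*-zeroʳ (u j)) (∑.sum-replicate-zero n)

normsq : ∀ {n} → V n → ℕ
normsq {zero}  v = 0
normsq {suc n} v = ℤ.∣ v zero ∣ ℕ.* ℤ.∣ v zero ∣ ℕ.+ normsq (v ∘ suc)

dot≡normsq : ∀ {n} (v : V n) → dot v v ≡ + normsq v
dot≡normsq {zero}  v = refl
dot≡normsq {suc n} v = cong₂ ℤ._+_ (square (v zero)) (dot≡normsq (v ∘ suc))
  where
  square : ∀ x → x ℤ.* x ≡ + (ℤ.∣ x ∣ ℕ.* ℤ.∣ x ∣)
  square (+ x)    = sym (ℤ.pos-* x x)
  square -[1+ x ] = refl

normsq≡0 : ∀ {n} (v : V n) → normsq v ≡ 0 → v ≗ 𝟘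
normsq≡0 {suc n} v h zero = ℤ.∣i∣≡0⇒i≡0 (square≡0 ℤ.∣ v zero ∣ (ℕ.m+n≡0⇒m≡0 _ h))
  where
  square≡0 : ∀ m → m ℕ.* m ≡ 0 → m ≡ 0
  square≡0 zero _ = refl
normsq≡0 {suc n} v h (suc j) = normsq≡0 (v ∘ suc) (ℕ.m+n≡0⇒n≡0 (ℤ.∣ v zero ∣ ℕ.* ℤ.∣ v zero ∣) h) j

dot-definite : ∀ {n} (v : V n) → dot v v ≡ 0ℤ → v ≗ 𝟘
dot-definite v h = normsq≡0 v (ℤ.+-injective (trans (sym (dot≡normsq v)) h))

-- |v|² times the component of w orthogonal to v.
proj : ∀ {n} → V n → V n → V n
proj v w = dot v v • w ⊖ dot w v • v

dot-proj : ∀ {n} (u v w : V n) → dot u (proj v w) ≡ dot v v ℤ.* dot u w ℤ.- dot w v ℤ.* dot u v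
dot-proj u v w = trans (dot-⊖ u (dot v v • w) (dot w v • v)) (cong₂ ℤ._-_ (dot-• u (dot v v) w) (dot-• u (dot w v) v))

proj-⊥ : ∀ {n} (v w : V n) → dot (proj v w) v ≡ 0ℤ
proj-⊥ v w = trans (dot-comm (proj v w) v) (trans (dot-proj v v w)
  (trans (cong (λ t → dot v v ℤ.* t ℤ.- dot w v ℤ.* dot v v) (dot-comm v w)) (eq (dot v v) (dot w v))))
  where
  eq : ∀ a b → a ℤ.* b ℤ.- b ℤ.* a ≡ 0ℤ
  eq = solve-∀

proj-square : ∀ {n} (v w : V n) → dot (proj v w) (proj v w) ≡ dot v v ℤ.* dot (proj v w) w
proj-square v w = trans (dot-proj (proj v w) v w)
  (trans (cong (λ t → dot v v ℤ.* dot (proj v w) w ℤ.- dot w v ℤ.* t) (proj-⊥ v w))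
         (eq (dot v v ℤ.* dot (proj v w) w) (dot w v)))
  where
  eq : ∀ a b → a ℤ.- b ℤ.* 0ℤ ≡ a
  eq = solve-∀

*≢0 : ∀ {a b} → a ≢ 0ℤ → b ≢ 0ℤ → a ℤ.* b ≢ 0ℤ
*≢0 {a} {b} a≢0 b≢0 h = b≢0 (ℤ.*-cancelˡ-≡ a b 0ℤ ⦃ ℤ.≢-nonZero a≢0 ⦄ (trans h (sym (ℤ.*-zeroʳ a))))

Ind3 : ∀ {n} → V n → V n → V n → Set
Ind3 g u v = ∀ a b c → a • g ⊕ b • u ⊕ c • v ≗ 𝟘 → a ≡ 0ℤ × b ≡ 0ℤ × c ≡ 0ℤ

-- Gram–Schmidt over ℤ.
orthogonal : ∀ {n} {g u v : V n} → Ind3 g u v →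
             ∃ λ φ → dot φ u ≡ 0ℤ × dot φ v ≡ 0ℤ × dot φ g ≢ 0ℤ
orthogonal {n} {g} {u} {v} ind = φ , φu , φv , φg≢0
  where
  v′ g′ φ : V n
  v′ = proj u v
  g′ = proj u g
  φ  = proj v′ g′
  uu≢0 : dot u u ≢ 0ℤ
  uu≢0 h = 1≢0 (proj₁ (proj₂ (ind 0ℤ 1ℤ 0ℤ λ j → trans (eq (g j) (u j) (v j)) (dot-definite u h j))))
    where
    eq : ∀ a b c → 0ℤ ℤ.* a ℤ.+ 1ℤ ℤ.* b ℤ.+ 0ℤ ℤ.* c ≡ b
    eq = solve-∀
  vv≢0 : dot v′ v′ ≢ 0ℤ
  vv≢0 h = uu≢0 (proj₂ (proj₂ (ind 0ℤ (ℤ.- dot v u) (dot u u) λ j →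
      trans (eq (dot v u) (dot u u) (g j) (u j) (v j)) (dot-definite v′ h j))))
    where
    eq : ∀ p q a b c → 0ℤ ℤ.* a ℤ.+ (ℤ.- p) ℤ.* b ℤ.+ q ℤ.* c ≡ q ℤ.* c ℤ.- p ℤ.* b
    eq = solve-∀
  φφ≢0 : dot φ φ ≢ 0ℤ
  φφ≢0 h = *≢0 vv≢0 uu≢0 (proj₁ (ind (dot v′ v′ ℤ.* dot u u)
      (dot g′ v′ ℤ.* dot v u ℤ.- dot v′ v′ ℤ.* dot g u) (ℤ.- (dot g′ v′ ℤ.* dot u u))
      λ j → trans (eq (dot v′ v′) (dot u u) (dot g′ v′) (dot v u) (dot g u) (g j) (u j) (v j)) (dot-definite φ h j)))
    where
    eq : ∀ A U G p q g u v → (A ℤ.* U) ℤ.* g ℤ.+ (G ℤ.* p ℤ.- A ℤ.* q) ℤ.* u ℤ.+ (ℤ.- (G ℤ.* U)) ℤ.* v ≡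
                              A ℤ.* (U ℤ.* g ℤ.- q ℤ.* u) ℤ.- G ℤ.* (U ℤ.* v ℤ.- p ℤ.* u)
    eq = solve-∀
  φu : dot φ u ≡ 0ℤ
  φu = trans (dot-comm φ u) (trans (dot-proj u v′ g′)
    (trans (cong₂ (λ s t → dot v′ v′ ℤ.* s ℤ.- dot g′ v′ ℤ.* t)
              (trans (dot-comm u g′) (proj-⊥ u g)) (trans (dot-comm u v′) (proj-⊥ u v)))
           (eq (dot v′ v′) (dot g′ v′))))
    where
    eq : ∀ a b → a ℤ.* 0ℤ ℤ.- b ℤ.* 0ℤ ≡ 0ℤ
    eq = solve-∀
  scaled : ∀ w → dot φ (proj u w) ≡ dot u u ℤ.* dot φ w
  scaled w = trans (dot-proj φ u w) (trans (cong (λ t → dot u u ℤ.* dot φ w ℤ.- dot w u ℤ.* t) φu)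
    (eq (dot u u ℤ.* dot φ w) (dot w u)))
    where
    eq : ∀ a b → a ℤ.- b ℤ.* 0ℤ ≡ a
    eq = solve-∀
  -- `scaled` reduces orthogonality to v to orthogonality to the projection `v′`, which holds by
  -- construction.
  φv : dot φ v ≡ 0ℤ
  φv = decidable-stable (dot φ v ℤ.≟ 0ℤ) λ φv≢0 →
    *≢0 uu≢0 φv≢0 (trans (sym (scaled v)) (proj-⊥ v′ g′))
  φg≢0 : dot φ g ≢ 0ℤ
  φg≢0 h = φφ≢0 (trans (proj-square v′ g′) (trans (cong (dot v′ v′ ℤ.*_) (trans (scaled g)
    (trans (cong (dot u u ℤ.*_) h) (ℤ.*-zeroʳ (dot u u))))) (ℤ.*-zeroʳ (dot v′ v′))))

module _ {n} (C : Cone n) where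
  open Cone C hiding (_∋_; Pos; Null)

  -- A vector v so small that even a large multiple of it is below |u| is not in the
  -- rational span of u and a vector g on which the functional vanishes.
  small⇒ind3 : ∀ {g u v ζ s} → ¬ g ≗ 𝟘 → Null C g → ¬ Null C u → ¬ Null C v →
               ∀ τ → u ≗ τ • ζ → Pos C ζ → ℤ.∣ dot (proj g u) u ∣ ℕ.≤ s → Small C ζ (+ s • v) → Ind3 g u v
  small⇒ind3 {g} {u} {v} {ζ} {s} g≢0 null-g u≁0 v≁0 τ u≗ pos-ζ D≤s small a b c h = a≡0 , b≡0 , c≡0
    where
    φ : V n
    φ = proj g u
    D K : ℤ
    D = dot φ u
    K = dot φ v
    gg≢0 : dot g g ≢ 0ℤ
    gg≢0 = g≢0 ∘ dot-definite g
    -- Since |φ|² = |g|²·D, vanishing of D would make φ zero and u a rational multiple of g, hence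
    -- null.
    D≢0 : D ≢ 0ℤ
    D≢0 D≡0 = u≁0 (null-div C (dot g g) gg≢0 (null-resp C
        (λ j → trans (eq (dot g g ℤ.* u j) (dot u g ℤ.* g j) (dot-definite φ
          (trans (proj-square g u) (trans (cong (dot g g ℤ.*_) D≡0) (ℤ.*-zeroʳ (dot g g)))) j)) refl)
        (null-• C (dot u g) null-g)))
      where
      eq : ∀ x y → x ℤ.- y ≡ 0ℤ → y ≡ x
      eq x y h = sym (ℤ.i-j≡0⇒i≡j x y h)
    bD+cK≡0 : b ℤ.* D ℤ.+ c ℤ.* K ≡ 0ℤ
    bD+cK≡0 = begin
        b ℤ.* D ℤ.+ c ℤ.* K
          ≡⟨ eq a (b ℤ.* D) (c ℤ.* K) ⟩
        a ℤ.* 0ℤ ℤ.+ b ℤ.* D ℤ.+ c ℤ.* K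
          ≡⟨ cong (λ t → a ℤ.* t ℤ.+ b ℤ.* D ℤ.+ c ℤ.* K) (sym (proj-⊥ g u)) ⟩
        a ℤ.* dot φ g ℤ.+ b ℤ.* D ℤ.+ c ℤ.* K
          ≡⟨ cong₂ ℤ._+_ (cong₂ ℤ._+_ (sym (dot-• φ a g)) (sym (dot-• φ b u))) (sym (dot-• φ c v)) ⟩
        dot φ (a • g) ℤ.+ dot φ (b • u) ℤ.+ dot φ (c • v)
          ≡⟨ cong (ℤ._+ dot φ (c • v)) (sym (dot-⊕ φ (a • g) (b • u))) ⟩
        dot φ (a • g ⊕ b • u) ℤ.+ dot φ (c • v)
          ≡⟨ sym (dot-⊕ φ (a • g ⊕ b • u) (c • v)) ⟩
        dot φ (a • g ⊕ b • u ⊕ c • v)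
          ≡⟨ dot-cong φ h ⟩
        dot φ 𝟘
          ≡⟨ dot-𝟘 φ ⟩
        0ℤ ∎
      where
      open ≡-Reasoning
      eq : ∀ a y z → y ℤ.+ z ≡ a ℤ.* 0ℤ ℤ.+ y ℤ.+ z
      eq = solve-∀
    -- Eliminating g shows that D·v - K·u is null. So |D| times the value of v is a nonzero integer
    -- multiple of the value of ζ, at least as large as it in absolute value, against `small-D`.
    module _ (c≢0 : c ≢ 0ℤ) where
      null-diff : Null C (D • v ⊖ K • u)
      null-diff = null-div C c c≢0 (null-resp C (λ j → eq a b c D K (g j) (u j) (v j) (h j) bD+cK≡0)
                    (null-• C (ℤ.- (a ℤ.* D)) null-g))
        where
        ring₁ : ∀ a b c D K g u v → c ℤ.* (D ℤ.* v ℤ.- K ℤ.* u) ≡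
                D ℤ.* (a ℤ.* g ℤ.+ b ℤ.* u ℤ.+ c ℤ.* v) ℤ.- (b ℤ.* D ℤ.+ c ℤ.* K) ℤ.* u ℤ.+ (ℤ.- (a ℤ.* D)) ℤ.* g
        ring₁ = solve-∀
        ring₂ : ∀ D u x → D ℤ.* 0ℤ ℤ.- 0ℤ ℤ.* u ℤ.+ x ≡ x
        ring₂ = solve-∀
        eq : ∀ a b c D K g u v → a ℤ.* g ℤ.+ b ℤ.* u ℤ.+ c ℤ.* v ≡ 0ℤ → b ℤ.* D ℤ.+ c ℤ.* K ≡ 0ℤ →
             (ℤ.- (a ℤ.* D)) ℤ.* g ≡ c ℤ.* (D ℤ.* v ℤ.- K ℤ.* u)
        eq a b c D K g u v h₁ h₂ = sym (trans (ring₁ a b c D K g u v)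
          (trans (cong₂ (λ s t → D ℤ.* s ℤ.- t ℤ.* u ℤ.+ (ℤ.- (a ℤ.* D)) ℤ.* g) h₁ h₂)
                 (ring₂ D u ((ℤ.- (a ℤ.* D)) ℤ.* g))))
      K≢0 : K ≢ 0ℤ
      K≢0 K≡0 = v≁0 (null-div C D D≢0 (null-resp C
        (λ j → trans (cong (λ t → D ℤ.* v j ℤ.- t ℤ.* u j) K≡0) (eq (D ℤ.* v j) (u j))) null-diff))
        where
        eq : ∀ x y → x ℤ.- 0ℤ ℤ.* y ≡ x
        eq = solve-∀
      small-D : Small C ζ (+ ℤ.∣ D ∣ • v)
      small-D = small-∣ C D≤s pos-ζ small
      contra : ∀ κ → κ ≢ 0ℤ → Null C (+ ℤ.∣ D ∣ • v ⊖ κ • ζ) → ⊥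
      contra (+ zero)  κ≢0 _ = κ≢0 refl
      contra (+ suc κ) _ (p , _) = Small.upper small-D
          (resp (λ j → eq (+ ℤ.∣ D ∣ ℤ.* v j) (+ κ) (ζ j)) (add p (mul∈ κ (pos∈ C pos-ζ))))
        where
        eq : ∀ x k z → x ℤ.- (1ℤ ℤ.+ k) ℤ.* z ℤ.+ k ℤ.* z ≡ x ℤ.- z
        eq = solve-∀
      contra -[1+ κ ] _ (_ , q) = Small.lower small-D
          (resp (λ j → eq (+ ℤ.∣ D ∣ ℤ.* v j) (+ κ) (ζ j)) (add q (mul∈ κ (pos∈ C pos-ζ))))
        where
        eq : ∀ x k z → ℤ.- (x ℤ.- (ℤ.- (1ℤ ℤ.+ k)) ℤ.* z) ℤ.+ k ℤ.* z ≡ ℤ.- x ℤ.- z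
        eq = solve-∀
      abs-sign : ∀ D → ∃ λ σ → σ ≢ 0ℤ × + ℤ.∣ D ∣ ≡ σ ℤ.* D
      abs-sign (+ n)    = 1ℤ , (λ ()) , sym (ℤ.*-identityˡ (+ n))
      abs-sign -[1+ n ] = ℤ.- 1ℤ , (λ ()) , sym (ℤ.-1*i≡-i -[1+ n ])
      τ≢0 : τ ≢ 0ℤ
      τ≢0 τ≡0 = u≁0 (null-resp C (λ j → trans (sym (ℤ.*-zeroˡ (ζ j)))
            (trans (cong (ℤ._* ζ j) (sym τ≡0)) (sym (u≗ j)))) (null-𝟘 C))
      impossible : ⊥
      impossible with abs-sign D
      ... | σ , σ≢0 , σ≡ = contra (σ ℤ.* K ℤ.* τ) (*≢0 (*≢0 σ≢0 K≢0) τ≢0)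
              (null-resp C (λ j → trans (cong (λ t → σ ℤ.* (D ℤ.* v j ℤ.- K ℤ.* t)) (u≗ j))
                (trans (eq σ D K τ (v j) (ζ j)) (cong (λ t → t ℤ.* v j ℤ.- σ ℤ.* K ℤ.* τ ℤ.* ζ j) (sym σ≡))))
                (null-• C σ null-diff))
        where
        eq : ∀ σ D K τ v z → σ ℤ.* (D ℤ.* v ℤ.- K ℤ.* (τ ℤ.* z)) ≡ σ ℤ.* D ℤ.* v ℤ.- σ ℤ.* K ℤ.* τ ℤ.* z
        eq = solve-∀
    c≡0 : c ≡ 0ℤ
    c≡0 = decidable-stable (c ℤ.≟ 0ℤ) impossible
    au+bg≡0 : ∀ j → a ℤ.* g j ℤ.+ b ℤ.* u j ≡ 0ℤ
    au+bg≡0 j = trans (sym (ℤ.+-identityʳ (a ℤ.* g j ℤ.+ b ℤ.* u j)))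
          (trans (cong (λ t → a ℤ.* g j ℤ.+ b ℤ.* u j ℤ.+ t)
      (sym (trans (cong (ℤ._* v j) c≡0) (ℤ.*-zeroˡ (v j))))) (h j))
    b≡0 : b ≡ 0ℤ
    b≡0 = decidable-stable (b ℤ.≟ 0ℤ) λ b≢0 → u≁0 (null-div C b b≢0
      (null-resp C (λ j → eq a b (g j) (u j) (au+bg≡0 j)) (null-• C (ℤ.- a) null-g)))
      where
      ring₁ : ∀ a b g u → b ℤ.* u ≡ (a ℤ.* g ℤ.+ b ℤ.* u) ℤ.+ (ℤ.- a) ℤ.* g
      ring₁ = solve-∀
      eq : ∀ a b g u → a ℤ.* g ℤ.+ b ℤ.* u ≡ 0ℤ → (ℤ.- a) ℤ.* g ≡ b ℤ.* u
      eq a b g u h = sym (trans (ring₁ a b g u) (trans (cong (ℤ._+ (ℤ.- a) ℤ.* g) h) (ℤ.+-identityˡ ((ℤ.- a) ℤ.* g))))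
    a≡0 : a ≡ 0ℤ
    a≡0 = decidable-stable (a ℤ.≟ 0ℤ) λ a≢0 → g≢0 λ j →
      decidable-stable (g j ℤ.≟ 0ℤ) λ gj≢0 → *≢0 a≢0 gj≢0
        (trans (sym (ℤ.+-identityʳ (a ℤ.* g j))) (trans (cong (λ t → a ℤ.* g j ℤ.+ t)
          (sym (trans (cong (ℤ._* u j) b≡0) (ℤ.*-zeroˡ (u j))))) (au+bg≡0 j)))

-- Congruence modulo 2 and short vectors

Halved : ∀ {n} → V n → Set
Halved v = ∃ λ u → v ≗ u ⊕ u

Even : ℤ → Set
Even x = ∃ λ u → x ≡ u ℤ.+ u

divide : ∀ x → ∃₂ λ (r : ℕ) (u : ℤ) → r ℕ.< 2 × x ≡ + r ℤ.+ (u ℤ.+ u)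
divide x = x %ℕ 2 , x /ℕ 2 , n%ℕd<d x 2 , trans (a≡a%ℕn+[a/ℕn]*n x 2) (eq (+ (x %ℕ 2)) (x /ℕ 2))
  where
  eq : ∀ r u → r ℤ.+ u ℤ.* + 2 ≡ r ℤ.+ (u ℤ.+ u)
  eq = solve-∀

double-injective : ∀ x y → x ℤ.+ x ≡ y ℤ.+ y → x ≡ y
double-injective x y h = ℤ.*-cancelˡ-≡ (+ 2) x y (trans (eq x) (trans h (sym (eq y))))
  where
  eq : ∀ x → + 2 ℤ.* x ≡ x ℤ.+ x
  eq = solve-∀

halve-bound : ∀ {m m′ N} → m ≡ m′ ℤ.+ m′ → m ≢ 0ℤ → ℤ.∣ m ∣ ℕ.≤ suc N → m′ ≢ 0ℤ × ℤ.∣ m′ ∣ ℕ.≤ N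
halve-bound {m} {m′} {N} m≡ m≢0 m≤ = m′≢0 m′ m≡ , bound m′ m≡
  where
  m′≢0 : ∀ m′ → m ≡ m′ ℤ.+ m′ → m′ ≢ 0ℤ
  m′≢0 m′ m≡ refl = m≢0 m≡
  half : ∀ k → suc k ℕ.+ suc k ℕ.≤ suc N → suc k ℕ.≤ N
  half k (s≤s h) = ℕ.≤-trans (ℕ.m≤n+m (suc k) k) h
  bound : ∀ m′ → m ≡ m′ ℤ.+ m′ → ℤ.∣ m′ ∣ ℕ.≤ N
  bound (+ zero)  _ = z≤n
  bound (+ suc k) eq = half k (subst (ℕ._≤ suc N) (cong ℤ.∣_∣ eq) m≤)
  bound -[1+ k ]  eq = half k (subst (ℕ._≤ suc N) (trans (cong ℤ.∣_∣ eq) (cong suc (sym (ℕ.+-suc k k)))) m≤)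

Mod2Indep : ∀ {n} → V n → V n → Set
Mod2Indep u v = ∀ a b → Halved (a • u ⊕ b • v) → Even a × Even b

-- Only the parities of a and b matter, and the three odd combinations are the three hypotheses.
mod2-indep : ∀ {n} {u v : V n} → ¬ Halved u → ¬ Halved v → ¬ Halved (u ⊕ v) → Mod2Indep u v
mod2-indep {u = u} {v} ¬u ¬v ¬uv a b (h , eq) =
    let (r , a′ , r<2 , a≡) = divide a
        (r′ , b′ , r′<2 , b≡) = divide b
    in parities r r′ a′ b′ r<2 r′<2 a≡ b≡ (reduce (+ r) (+ r′) a′ b′ a≡ b≡)
  where
  reduce : ∀ r r′ a′ b′ → a ≡ r ℤ.+ (a′ ℤ.+ a′) → b ≡ r′ ℤ.+ (b′ ℤ.+ b′) → Halved (r • u ⊕ r′ • v)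
  reduce r r′ a′ b′ a≡ b≡ = h ⊖ a′ • u ⊖ b′ • v , λ j →
      trans (ring r r′ a′ b′ (u j) (v j))
        (trans (cong (λ t → t ℤ.- (a′ ℤ.* u j ℤ.+ a′ ℤ.* u j) ℤ.- (b′ ℤ.* v j ℤ.+ b′ ℤ.* v j))
                 (trans (cong₂ (λ s t → s ℤ.* u j ℤ.+ t ℤ.* v j) (sym a≡) (sym b≡)) (eq j)))
               (ring′ (h j) (a′ ℤ.* u j) (b′ ℤ.* v j)))
    where
    ring : ∀ r r′ a b u v → r ℤ.* u ℤ.+ r′ ℤ.* v ≡
           (r ℤ.+ (a ℤ.+ a)) ℤ.* u ℤ.+ (r′ ℤ.+ (b ℤ.+ b)) ℤ.* v ℤ.- (a ℤ.* u ℤ.+ a ℤ.* u) ℤ.- (b ℤ.* v ℤ.+ b ℤ.* v)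
    ring = solve-∀
    ring′ : ∀ h x y → (h ℤ.+ h) ℤ.- (x ℤ.+ x) ℤ.- (y ℤ.+ y) ≡ (h ℤ.- x ℤ.- y) ℤ.+ (h ℤ.- x ℤ.- y)
    ring′ = solve-∀
  ring₁₀ : ∀ u v → u ≡ + 1 ℤ.* u ℤ.+ + 0 ℤ.* v
  ring₁₀ = solve-∀
  ring₀₁ : ∀ u v → v ≡ + 0 ℤ.* u ℤ.+ + 1 ℤ.* v
  ring₀₁ = solve-∀
  ring₁₁ : ∀ u v → u ℤ.+ v ≡ + 1 ℤ.* u ℤ.+ + 1 ℤ.* v
  ring₁₁ = solve-∀
  parities : ∀ r r′ a′ b′ → r ℕ.< 2 → r′ ℕ.< 2 → a ≡ + r ℤ.+ (a′ ℤ.+ a′) → b ≡ + r′ ℤ.+ (b′ ℤ.+ b′) →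
             Halved (+ r • u ⊕ + r′ • v) → Even a × Even b
  parities 0 0 a′ b′ _ _ a≡ b≡ _ =
    (a′ , trans a≡ (ℤ.+-identityˡ (a′ ℤ.+ a′))) , (b′ , trans b≡ (ℤ.+-identityˡ (b′ ℤ.+ b′)))
  parities 1 0 _ _ _ _ _ _ (w , w≗) = ⊥-elim (¬u (w , λ j → trans (ring₁₀ (u j) (v j)) (w≗ j)))
  parities 0 1 _ _ _ _ _ _ (w , w≗) = ⊥-elim (¬v (w , λ j → trans (ring₀₁ (u j) (v j)) (w≗ j)))
  parities 1 1 _ _ _ _ _ _ (w , w≗) = ⊥-elim (¬uv (w , λ j → trans (ring₁₁ (u j) (v j)) (w≗ j)))
  parities (suc (suc r)) _ _ _ (s≤s (s≤s ())) _ _ _ _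
  parities _ (suc (suc r)) _ _ _ (s≤s (s≤s ())) _ _ _

module Saturate {n} (R : V n → V n → Set)
                (swap : ∀ {u v} → R u v → R v u)
                (half : ∀ {u v w} → R u v → u ≗ w ⊕ w → R w v)
                (half⁺ : ∀ {u v w} → R u v → u ⊕ v ≗ w ⊕ w → R w v) (i j : Fin n) where

  -- A nonzero minor witnesses that u and v are independent, and its absolute value bounds the
  -- number of halvings.
  minor : V n → V n → ℤ
  minor u v = u i ℤ.* v j ℤ.- u j ℤ.* v i

  -- Each halving step halves the minor.
  saturate : ∀ N u v → R u v → minor u v ≢ 0ℤ → ℤ.∣ minor u v ∣ ℕ.≤ N → ¬ ¬ ∃₂ λ u′ v′ → R u′ v′ × Mod2Indep u′ v′
  saturate zero    u v r m≢0 m≤ = ⊥-elim (m≢0 (ℤ.∣i∣≡0⇒i≡0 (ℕ.n≤0⇒n≡0 m≤)))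
  saturate (suc N) u v r m≢0 m≤ = do
    no ¬u ← em (Halved u)
      where yes (w , h) → descend w v (half r h)
              (trans (cong₂ (λ s t → s ℤ.* v j ℤ.- t ℤ.* v i) (h i) (h j)) (ring₁ (w i) (w j) (v i) (v j)))
    no ¬v ← em (Halved v)
      where yes (w , h) → descend u w (swap (half (swap r) h))
              (trans (cong₂ (λ s t → u i ℤ.* t ℤ.- u j ℤ.* s) (h i) (h j)) (ring₂ (u i) (u j) (w i) (w j)))
    no ¬uv ← em (Halved (u ⊕ v))
      where yes (w , h) → descend w v (half⁺ r h) (trans (ring₃ (u i) (u j) (v i) (v j))
              (trans (cong₂ (λ s t → s ℤ.* v j ℤ.- t ℤ.* v i) (h i) (h j)) (ring₁ (w i) (w j) (v i) (v j))))
    return (u , v , r , mod2-indep ¬u ¬v ¬uv)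
    where
    ring₁ : ∀ a b c d → (a ℤ.+ a) ℤ.* d ℤ.- (b ℤ.+ b) ℤ.* c ≡ (a ℤ.* d ℤ.- b ℤ.* c) ℤ.+ (a ℤ.* d ℤ.- b ℤ.* c)
    ring₁ = solve-∀
    ring₂ : ∀ a b c d → a ℤ.* (d ℤ.+ d) ℤ.- b ℤ.* (c ℤ.+ c) ≡ (a ℤ.* d ℤ.- b ℤ.* c) ℤ.+ (a ℤ.* d ℤ.- b ℤ.* c)
    ring₂ = solve-∀
    ring₃ : ∀ a b c d → a ℤ.* d ℤ.- b ℤ.* c ≡ (a ℤ.+ c) ℤ.* d ℤ.- (b ℤ.+ d) ℤ.* c
    ring₃ = solve-∀
    descend : ∀ u′ v′ → R u′ v′ → minor u v ≡ minor u′ v′ ℤ.+ minor u′ v′ → _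
    descend u′ v′ r′ m≡ =
      let (m′≢0 , m′≤) = halve-bound m≡ m≢0 m≤ in saturate N u′ v′ r′ m′≢0 m′≤

-- If uᵢ ≠ 0 and all minors with row i vanished, then uᵢ·v - vᵢ·u = 0 would be a dependency with a
-- nonzero coefficient.
nonzero-minor : ∀ {n} {u v : V n} → (∀ b c → b • u ⊕ c • v ≗ 𝟘 → b ≡ 0ℤ × c ≡ 0ℤ) →
                ∃₂ λ i j → u i ℤ.* v j ℤ.- u j ℤ.* v i ≢ 0ℤ
nonzero-minor {n} {u} {v} ind =
  let (i , uᵢ≢0) = ≢⇒NonZero {v = u} λ u≗0 → 1≢0 (proj₁
              (ind 1ℤ 0ℤ λ j → trans (cong (λ t → 1ℤ ℤ.* t ℤ.+ 0ℤ ℤ.* v j) (u≗0 j)) (eq₀ (v j))))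
      (j , m≢0) = ≢⇒NonZero {v = λ j → u i ℤ.* v j ℤ.- u j ℤ.* v i} λ h →
        uᵢ≢0 (proj₂ (ind (ℤ.- v i) (u i) λ j → trans (eq (u i) (u j) (v i) (v j)) (h j)))
  in i , j , m≢0
  where
  eq₀ : ∀ x → 1ℤ ℤ.* 0ℤ ℤ.+ 0ℤ ℤ.* x ≡ 0ℤ
  eq₀ = solve-∀
  eq : ∀ a b c d → (ℤ.- c) ℤ.* b ℤ.+ a ℤ.* d ≡ a ℤ.* d ℤ.- b ℤ.* c
  eq = solve-∀

-- Midpoints modulo 2 and walks along a segment

module Mod2 {n} (w₁ w₂ : V n) where

  infix 4 _~_

  -- Modulo 2 the sum is the difference; the sum is used because its half is the midpoint.
  record _~_ (q q′ : V n) : Set where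
    constructor mk~
    field
      a b : ℤ
      mid : V n
      eq  : q ⊕ q′ ⊕ a • w₁ ⊕ b • w₂ ≗ mid ⊕ mid

  ~-sym : ∀ {q q′} → q ~ q′ → q′ ~ q
  ~-sym {q} {q′} (mk~ a b u h) = mk~ a b u λ j → trans
        (cong (λ t → t ℤ.+ a ℤ.* w₁ j ℤ.+ b ℤ.* w₂ j) (ℤ.+-comm (q′ j) (q j))) (h j)

  ~-trans : ∀ {p q r} → p ~ q → q ~ r → p ~ r
  ~-trans {p} {q} {r} (mk~ a b u h) (mk~ a′ b′ u′ h′) = mk~ (a ℤ.+ a′) (b ℤ.+ b′) (u ⊕ u′ ⊖ q) λ j →
      trans (ring (p j) (q j) (r j) a b a′ b′ (w₁ j) (w₂ j))
            (trans (cong₂ (λ s t → s ℤ.+ t ℤ.- (q j ℤ.+ q j)) (h j) (h′ j)) (ring′ (u j) (u′ j) (q j)))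
    where
    ring : ∀ p q r a b a′ b′ v w → p ℤ.+ r ℤ.+ (a ℤ.+ a′) ℤ.* v ℤ.+ (b ℤ.+ b′) ℤ.* w ≡
           (p ℤ.+ q ℤ.+ a ℤ.* v ℤ.+ b ℤ.* w) ℤ.+ (q ℤ.+ r ℤ.+ a′ ℤ.* v ℤ.+ b′ ℤ.* w) ℤ.- (q ℤ.+ q)
    ring = solve-∀
    ring′ : ∀ u u′ q → (u ℤ.+ u) ℤ.+ (u′ ℤ.+ u′) ℤ.- (q ℤ.+ q) ≡ (u ℤ.+ u′ ℤ.- q) ℤ.+ (u ℤ.+ u′ ℤ.- q)
    ring′ = solve-∀

  -- Even parts of the coefficients are absorbed into `mid`, so the correction by `w₁` and `w₂` is
  -- at most one of each and stays short.
  record Midpoint (q q′ : V n) : Set where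
    field
      a b : ℕ
      a≤1 : a ℕ.≤ 1
      b≤1 : b ℕ.≤ 1
      mid : V n
      eq  : q ⊕ q′ ⊕ + a • w₁ ⊕ + b • w₂ ≗ mid ⊕ mid

  midpoint : ∀ {q q′} → q ~ q′ → Midpoint q q′
  midpoint {q} {q′} (mk~ a b u h) =
    let (r , s , r<2 , a≡) = divide a
        (r′ , s′ , r′<2 , b≡) = divide b
    in record
      { a = r ; b = r′ ; a≤1 = ℕ.≤-pred r<2 ; b≤1 = ℕ.≤-pred r′<2 ; mid = u ⊖ s • w₁ ⊖ s′ • w₂
      ; eq = λ j → trans (ring (+ r) s (+ r′) s′ (q j) (q′ j) (w₁ j) (w₂ j))
          (trans (cong (λ t → t ℤ.- (s ℤ.* w₁ j ℤ.+ s ℤ.* w₁ j) ℤ.- (s′ ℤ.* w₂ j ℤ.+ s′ ℤ.* w₂ j))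
                   (trans (cong₂ (λ x y → q j ℤ.+ q′ j ℤ.+ x ℤ.* w₁ j ℤ.+ y ℤ.* w₂ j) (sym a≡) (sym b≡)) (h j)))
                 (ring′ (u j) (s ℤ.* w₁ j) (s′ ℤ.* w₂ j))) }
    where
    ring : ∀ r s r′ s′ q q′ v w → q ℤ.+ q′ ℤ.+ r ℤ.* v ℤ.+ r′ ℤ.* w ≡
           q ℤ.+ q′ ℤ.+ (r ℤ.+ (s ℤ.+ s)) ℤ.* v ℤ.+ (r′ ℤ.+ (s′ ℤ.+ s′)) ℤ.* w ℤ.- (s ℤ.* v ℤ.+ s ℤ.* v) ℤ.-
                 (s′ ℤ.* w ℤ.+ s′ ℤ.* w)
    ring = solve-∀
    ring′ : ∀ u x y → (u ℤ.+ u) ℤ.- (x ℤ.+ x) ℤ.- (y ℤ.+ y) ≡ (u ℤ.- x ℤ.- y) ℤ.+ (u ℤ.- x ℤ.- y)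
    ring′ = solve-∀

  -- q lies on the middle half of the segment from y₀ to y₁, up to multiples of w₁ and w₂
  -- with coefficients in [-1, 1].
  record Between (y₀ y₁ q : V n) : Set where
    field
      M A B : ℕ
      a b   : ℤ
      eq    : + M • q ≗ + A • y₀ ⊕ + B • y₁ ⊕ a • w₁ ⊕ b • w₂
      M>0   : 1 ℕ.≤ M
      A+B   : A ℕ.+ B ≡ M
      4A    : M ℕ.≤ 4 ℕ.* A
      4B    : M ℕ.≤ 4 ℕ.* B
      a≤M   : ℤ.∣ a ∣ ℕ.≤ M
      b≤M   : ℤ.∣ b ∣ ℕ.≤ M

  private
    ∣a+Mα∣≤ : ∀ {a M α} → ℤ.∣ a ∣ ℕ.≤ M → α ℕ.≤ 1 → ℤ.∣ a ℤ.+ + M ℤ.* + α ∣ ℕ.≤ M ℕ.+ M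
    ∣a+Mα∣≤ {a} {M} {α} a≤ α≤1 = ℕ.≤-trans (ℤ.∣i+j∣≤∣i∣+∣j∣ a (+ M ℤ.* + α)) (ℕ.+-mono-≤ a≤
      (ℕ.≤-trans (ℕ.≤-reflexive (ℤ.abs-* (+ M) (+ α)))
        (ℕ.≤-trans (ℕ.*-monoʳ-≤ M α≤1) (ℕ.≤-reflexive (ℕ.*-identityʳ M)))))
    M+M≤4[A+M] : ∀ A M → M ℕ.+ M ℕ.≤ 4 ℕ.* (A ℕ.+ M)
    M+M≤4[A+M] A M = ℕ.≤-trans (ℕ.+-mono-≤ (ℕ.m≤n+m M A) (ℕ.m≤n+m M A))
      (ℕ.+-monoʳ-≤ (A ℕ.+ M) (ℕ.m≤m+n (A ℕ.+ M) _))
    M+M≤4B : ∀ M B → M ℕ.≤ B ℕ.+ B → M ℕ.+ M ℕ.≤ 4 ℕ.* B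
    M+M≤4B M B h = ℕ.≤-trans (ℕ.+-mono-≤ h h) (ℕ.≤-reflexive (trans (ℕ.+-assoc B B (B ℕ.+ B))
      (cong (λ t → B ℕ.+ (B ℕ.+ (B ℕ.+ t))) (sym (ℕ.+-identityʳ B)))))

  module _ {y₀ y₁ : V n} where

    swap-between : ∀ {q} → Between y₀ y₁ q → Between y₁ y₀ q
    swap-between {q} s = record
      { M = M ; A = B ; B = A ; a = a ; b = b ; M>0 = M>0 ; 4A = 4B ; 4B = 4A ; a≤M = a≤M ; b≤M = b≤M
      ; A+B = trans (ℕ.+-comm B A) A+B
      ; eq = λ j → trans (eq j) (cong (λ t → t ℤ.+ a ℤ.* w₁ j ℤ.+ b ℤ.* w₂ j)
            (ℤ.+-comm (+ A ℤ.* y₀ j) (+ B ℤ.* y₁ j))) }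
      where open Between s

    -- The denominator doubles. The weight at `y₁` stays B, so M ≤ 2B is what keeps it at least a
    -- quarter; the new correction is at most M + M, again within the new denominator.
    toward : ∀ {q} (s : Between y₀ y₁ q) (m : Midpoint q y₀) → Between.M s ℕ.≤ Between.B s ℕ.+ Between.B s →
             ∃ λ (s′ : Between y₀ y₁ (Midpoint.mid m)) → Between.M s′ ≡ Between.M s ℕ.+ Between.M s × Between.B s′
                   ≡ Between.B s
    toward {q} s m M≤2B = record
      { M = M ℕ.+ M ; A = A ℕ.+ M ; B = B ; a = a ℤ.+ + M ℤ.* + α ; b = b ℤ.+ + M ℤ.* + β
      ; eq = λ j → trans (ring₁ (+ M) (mid j)) (trans (cong (+ M ℤ.*_) (sym (m-eq j)))
          (trans (ring₂ (+ M) (q j) (y₀ j) (+ α) (w₁ j) (+ β) (w₂ j))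
            (trans (cong (λ t → t ℤ.+ + M ℤ.* y₀ j ℤ.+ + M ℤ.* + α ℤ.* w₁ j ℤ.+ + M ℤ.* + β ℤ.* w₂ j) (eq j))
              (ring₃ (+ M) (+ A) (+ B) a b (y₀ j) (y₁ j) (+ α) (w₁ j) (+ β) (w₂ j)))))
      ; M>0 = ℕ.≤-trans M>0 (ℕ.m≤m+n M M)
      ; A+B = trans (trans (ℕ.+-assoc A M B) (trans (cong (A ℕ.+_) (ℕ.+-comm M B)) (sym (ℕ.+-assoc A B M))))
            (cong (ℕ._+ M) A+B)
      ; 4A = M+M≤4[A+M] A M ; 4B = M+M≤4B M B M≤2B
      ; a≤M = ∣a+Mα∣≤ {a} a≤M α≤1 ; b≤M = ∣a+Mα∣≤ {b} b≤M β≤1 } , refl , refl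
      where
      open Between s
      open Midpoint m using (mid) renaming (a to α; b to β; a≤1 to α≤1; b≤1 to β≤1; eq to m-eq)
      ring₁ : ∀ M u → (M ℤ.+ M) ℤ.* u ≡ M ℤ.* (u ℤ.+ u)
      ring₁ = solve-∀
      ring₂ : ∀ M q y α w β w′ → M ℤ.* (q ℤ.+ y ℤ.+ α ℤ.* w ℤ.+ β ℤ.* w′) ≡ M ℤ.* q ℤ.+ M ℤ.* y ℤ.+ M ℤ.* α ℤ.* w
            ℤ.+ M ℤ.* β ℤ.* w′
      ring₂ = solve-∀
      ring₃ : ∀ M A B a b y₀ y₁ α w β w′ →
              (A ℤ.* y₀ ℤ.+ B ℤ.* y₁ ℤ.+ a ℤ.* w ℤ.+ b ℤ.* w′) ℤ.+ M ℤ.* y₀ ℤ.+ M ℤ.* α ℤ.* w ℤ.+ M ℤ.* β ℤ.* w′ ≡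
              (A ℤ.+ M) ℤ.* y₀ ℤ.+ B ℤ.* y₁ ℤ.+ (a ℤ.+ M ℤ.* α) ℤ.* w ℤ.+ (b ℤ.+ M ℤ.* β) ℤ.* w′
      ring₃ = solve-∀

  module Walk {y₀ y₁ : V n} (y₀~y₁ : y₀ ~ y₁) (φ : V n)
              (φw₁ : dot φ w₁ ≡ 0ℤ) (φw₂ : dot φ w₂ ≡ 0ℤ) (φg : dot φ y₁ ℤ.- dot φ y₀ ≢ 0ℤ) where
    private
      ψ : V n → ℤ
      ψ = dot φ

    ψ-mid : ∀ {q q′} (m : Midpoint q q′) → ψ (Midpoint.mid m) ℤ.+ ψ (Midpoint.mid m) ≡ ψ q ℤ.+ ψ q′
    ψ-mid {q} {q′} m = trans (sym (dot-⊕ φ mid mid)) (trans (dot-cong φ (λ j → sym (eq j)))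
        (trans (dot-⊕ φ (q ⊕ q′ ⊕ + a • w₁) (+ b • w₂)) (trans (cong₂ ℤ._+_
          (trans (dot-⊕ φ (q ⊕ q′) (+ a • w₁)) (cong₂ ℤ._+_ (dot-⊕ φ q q′) (vanish a w₁ φw₁))) (vanish b w₂ φw₂))
          (ring (ψ q ℤ.+ ψ q′)))))
      where
      open Midpoint m
      ring : ∀ x → x ℤ.+ 0ℤ ℤ.+ 0ℤ ≡ x
      ring = solve-∀
      vanish : ∀ a w → ψ w ≡ 0ℤ → ψ (+ a • w) ≡ 0ℤ
      vanish a w h = trans (dot-• φ (+ a) w) (trans (cong (+ a ℤ.*_) h) (ℤ.*-zeroʳ (+ a)))

    -- e is the value of φ on the current lattice step along the segment.
    record State (q : V n) (e : ℤ) : Set where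
      field
        between : Between y₀ y₁ q
        B′ M′   : ℕ
        odd     : Between.B between ≡ suc (B′ ℕ.+ B′)
        even    : Between.M between ≡ M′ ℕ.+ M′
        at-q    : ψ q ℤ.- ψ y₀ ≡ + Between.B between ℤ.* e
        at-y₁   : ψ y₁ ℤ.- ψ y₀ ≡ + Between.M between ℤ.* e

    private
      -- An odd multiple of e is even only if e is; the half is x - B′e.
      halve-odd : ∀ B′ x e → x ℤ.+ x ≡ (1ℤ ℤ.+ (+ B′ ℤ.+ + B′)) ℤ.* e →
                  ∃ λ e′ → e ≡ e′ ℤ.+ e′ × x ≡ (1ℤ ℤ.+ (+ B′ ℤ.+ + B′)) ℤ.* e′
      halve-odd B′ x e h = e′ , e≡ , double-injective x ((1ℤ ℤ.+ (+ B′ ℤ.+ + B′)) ℤ.* e′)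
          (trans h (trans (cong ((1ℤ ℤ.+ (+ B′ ℤ.+ + B′)) ℤ.*_) e≡) (ring₂ (+ B′) e′)))
        where
        e′ : ℤ
        e′ = x ℤ.- + B′ ℤ.* e
        ring₁ : ∀ B e → e ≡ ((1ℤ ℤ.+ (B ℤ.+ B)) ℤ.* e) ℤ.- (B ℤ.* e ℤ.+ B ℤ.* e)
        ring₁ = solve-∀
        ring₁′ : ∀ x y → (x ℤ.+ x) ℤ.- (y ℤ.+ y) ≡ (x ℤ.- y) ℤ.+ (x ℤ.- y)
        ring₁′ = solve-∀
        ring₂ : ∀ B e → (1ℤ ℤ.+ (B ℤ.+ B)) ℤ.* (e ℤ.+ e) ≡ (1ℤ ℤ.+ (B ℤ.+ B)) ℤ.* e ℤ.+ (1ℤ ℤ.+ (B ℤ.+ B)) ℤ.* e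
        ring₂ = solve-∀
        e≡ : e ≡ e′ ℤ.+ e′
        e≡ = trans (ring₁ (+ B′) e) (trans (cong (ℤ._- (+ B′ ℤ.* e ℤ.+ + B′ ℤ.* e)) (sym h)) (ring₁′ x (+ B′ ℤ.* e)))
      refine : ∀ M e e′ → e ≡ e′ ℤ.+ e′ → + M ℤ.* e ≡ + (M ℕ.+ M) ℤ.* e′
      refine M e e′ refl = ring (+ M) e′
        where
        ring : ∀ M e → M ℤ.* (e ℤ.+ e) ≡ (M ℤ.+ M) ℤ.* e
        ring = solve-∀

    step-left : ∀ {q e} (s : State q e) (m : Midpoint q y₀) → Between.M (State.between s) ℕ.≤ Between.B
          (State.between s) ℕ.+ Between.B (State.between s) →
                ∃ λ e′ → e ≡ e′ ℤ.+ e′ × State (Midpoint.mid m) e′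
    step-left {q} {e} s m M≤2B =
      let (s′ , M≡ , B≡) = toward between m M≤2B
          x = ψ (Midpoint.mid m) ℤ.- ψ y₀
          2x : x ℤ.+ x ≡ (1ℤ ℤ.+ (+ B′ ℤ.+ + B′)) ℤ.* e
          2x = trans (ring (ψ (Midpoint.mid m)) (ψ y₀)) (trans (cong (ℤ._- (ψ y₀ ℤ.+ ψ y₀)) (ψ-mid m))
                 (trans (ring′ (ψ q) (ψ y₀)) (trans at-q (cong (λ t → + t ℤ.* e) odd))))
          (e′ , e≡ , x≡) = halve-odd B′ x e 2x
      in e′ , e≡ , record
        { between = s′ ; B′ = B′ ; M′ = Between.M between ; odd = trans B≡ odd ; even = M≡
        ; at-q = trans x≡ (cong (λ t → + t ℤ.* e′) (sym (trans B≡ odd)))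
        ; at-y₁ = trans at-y₁ (trans (refine (Between.M between) e e′ e≡) (cong (λ t → + t ℤ.* e′) (sym M≡))) }
      where
      open State s
      ring : ∀ u y → (u ℤ.- y) ℤ.+ (u ℤ.- y) ≡ (u ℤ.+ u) ℤ.- (y ℤ.+ y)
      ring = solve-∀
      ring′ : ∀ q y → (q ℤ.+ y) ℤ.- (y ℤ.+ y) ≡ q ℤ.- y
      ring′ = solve-∀

    step-right : ∀ {q e} (s : State q e) (m : Midpoint q y₁) → Between.M (State.between s) ℕ.≤ Between.A
          (State.between s) ℕ.+ Between.A (State.between s) →
                 ∃ λ e′ → e ≡ e′ ℤ.+ e′ × State (Midpoint.mid m) e′
    step-right {q} {e} s m M≤2A =
      let (s′ , M≡ , A≡) = toward {y₁} {y₀} (swap-between between) m M≤2A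
          s″ = swap-between {y₁} {y₀} s′
          x = ψ (Midpoint.mid m) ℤ.- ψ y₀
          -- The new weight at `y₁` is B + M = (2B′ + 1) + 2M′, odd again.
          B″ = B′ ℕ.+ M′
          B≡ : Between.A s′ ≡ suc (B″ ℕ.+ B″)
          B≡ = ℕ.+-cancelʳ-≡ (Between.B s′) (Between.A s′) (suc (B″ ℕ.+ B″))
                 (trans (Between.A+B s′) (trans M≡ (trans (sum-odd (Between.A between) (Between.B between)
                       (Between.M between) (Between.A+B between) odd even)
                   (cong (suc (B″ ℕ.+ B″) ℕ.+_) (sym A≡)))))
          2x : x ℤ.+ x ≡ (1ℤ ℤ.+ (+ B″ ℤ.+ + B″)) ℤ.* e
          2x = trans (ring (ψ (Midpoint.mid m)) (ψ y₀)) (trans (cong (ℤ._- (ψ y₀ ℤ.+ ψ y₀)) (ψ-mid m))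
                 (trans (ring′ (ψ q) (ψ y₁) (ψ y₀)) (trans (cong₂ ℤ._+_
                   (trans at-q (cong (λ t → + t ℤ.* e) odd)) (trans at-y₁ (cong (λ t → + t ℤ.* e) even)))
                   (ring″ (+ B′) (+ M′) e))))
          (e′ , e≡ , x≡) = halve-odd B″ x e 2x
      in e′ , e≡ , record
        { between = s″ ; B′ = B″ ; M′ = Between.M between ; odd = B≡ ; even = M≡
        ; at-q = trans x≡ (cong (λ t → + t ℤ.* e′) (sym B≡))
        ; at-y₁ = trans at-y₁ (trans (refine (Between.M between) e e′ e≡) (cong (λ t → + t ℤ.* e′) (sym M≡))) }
      where
      open State s
      ring : ∀ u y → (u ℤ.- y) ℤ.+ (u ℤ.- y) ≡ (u ℤ.+ u) ℤ.- (y ℤ.+ y)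
      ring = solve-∀
      ring′ : ∀ q y₁ y → (q ℤ.+ y₁) ℤ.- (y ℤ.+ y) ≡ (q ℤ.- y) ℤ.+ (y₁ ℤ.- y)
      ring′ = solve-∀
      ring″ : ∀ B M e → (1ℤ ℤ.+ (B ℤ.+ B)) ℤ.* e ℤ.+ (M ℤ.+ M) ℤ.* e ≡ (1ℤ ℤ.+ ((B ℤ.+ M) ℤ.+ (B ℤ.+ M))) ℤ.* e
      ring″ = solve-∀
      sum-odd : ∀ A B M → A ℕ.+ B ≡ M → B ≡ suc (B′ ℕ.+ B′) → M ≡ M′ ℕ.+ M′ →
                M ℕ.+ M ≡ suc ((B′ ℕ.+ M′) ℕ.+ (B′ ℕ.+ M′)) ℕ.+ A
      sum-odd A B M A+B odd even = ℤ.+-injective (trans (cong (λ t → + t ℤ.+ + M) (sym A+B))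
        (trans (cong₂ (λ s t → + A ℤ.+ + s ℤ.+ + t) odd even) (ring‴ (+ A) (+ B′) (+ M′))))
        where
        ring‴ : ∀ A B M → A ℤ.+ (1ℤ ℤ.+ (B ℤ.+ B)) ℤ.+ (M ℤ.+ M) ≡ (1ℤ ℤ.+ ((B ℤ.+ M) ℤ.+ (B ℤ.+ M))) ℤ.+ A
        ring‴ = solve-∀

    Separated : Set
    Separated = ∃ λ q → Between y₀ y₁ q × ¬ q ~ y₀

    -- While q is congruent to `y₀`, and hence to `y₁`, it has a lattice midpoint with either end up
    -- to the short vectors. Going towards the farther end keeps q in the middle half, and every
    -- step halves the nonzero integer e, so the class must change eventually.
    walk : ∀ N {q e} → State q e → e ≢ 0ℤ → ℤ.∣ e ∣ ℕ.≤ N → ¬ ¬ Separated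
    walk zero    s e≢0 e≤ = ⊥-elim (e≢0 (ℤ.∣i∣≡0⇒i≡0 (ℕ.n≤0⇒n≡0 e≤)))
    walk (suc N) {q} {e} s e≢0 e≤ = do
      yes q~y₀ ← em (q ~ y₀)
        where no q≁ → return (q , State.between s , q≁)
      descend q~y₀ (M ℕ.≤? B ℕ.+ B)
      where
      open Between (State.between s)
      continue : (∃ λ e′ → e ≡ e′ ℤ.+ e′ × ∃ λ q′ → State q′ e′) → ¬ ¬ Separated
      continue (e′ , e≡ , q′ , s′) = let (e′≢0 , e′≤) = halve-bound e≡ e≢0 e≤ in walk N s′ e′≢0 e′≤
      descend : q ~ y₀ → Dec (M ℕ.≤ B ℕ.+ B) → ¬ ¬ Separated
      descend q~y₀ (yes M≤2B) =
        let (e′ , e≡ , s′) = step-left s (midpoint q~y₀) M≤2B in continue (e′ , e≡ , _ , s′)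
      descend q~y₀ (no M≰2B) =
        let (e′ , e≡ , s′) = step-right s (midpoint (~-trans q~y₀ y₀~y₁)) M≤2A in continue (e′ , e≡ , _ , s′)
        where
        2B<M : B ℕ.+ B ℕ.< M
        2B<M = ℕ.≰⇒> M≰2B
        B≤A : B ℕ.≤ A
        B≤A = ℕ.+-cancelʳ-≤ B B A (ℕ.≤-trans (ℕ.<⇒≤ 2B<M) (ℕ.≤-reflexive (sym A+B)))
        M≤2A : M ℕ.≤ A ℕ.+ A
        M≤2A = ℕ.≤-trans (ℕ.≤-reflexive (sym A+B)) (ℕ.+-monoʳ-≤ A B≤A)

    separate : ¬ ¬ Separated
    separate = walk ℤ.∣ e ∣ start e≢0 ℕ.≤-refl
      where
      m : Midpoint y₀ y₁
      m = midpoint y₀~y₁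
      open Midpoint m
      e : ℤ
      e = ψ mid ℤ.- ψ y₀
      ring₁ : ∀ u → + 2 ℤ.* u ≡ u ℤ.+ u
      ring₁ = solve-∀
      ring₂ : ∀ y₀ y₁ a b → y₀ ℤ.+ y₁ ℤ.+ a ℤ.+ b ≡ + 1 ℤ.* y₀ ℤ.+ + 1 ℤ.* y₁ ℤ.+ a ℤ.+ b
      ring₂ = solve-∀
      ring₃ : ∀ y₀ y₁ → y₁ ℤ.- y₀ ≡ (y₀ ℤ.+ y₁) ℤ.- (y₀ ℤ.+ y₀)
      ring₃ = solve-∀
      ring₄ : ∀ u y → (u ℤ.+ u) ℤ.- (y ℤ.+ y) ≡ + 2 ℤ.* (u ℤ.- y)
      ring₄ = solve-∀
      at-end : ψ y₁ ℤ.- ψ y₀ ≡ + 2 ℤ.* e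
      at-end = trans (ring₃ (ψ y₀) (ψ y₁)) (trans (cong (ℤ._- (ψ y₀ ℤ.+ ψ y₀)) (sym (ψ-mid m)))
            (ring₄ (ψ mid) (ψ y₀)))
      e≢0 : e ≢ 0ℤ
      e≢0 h = φg (trans at-end (cong (+ 2 ℤ.*_) h))
      start : State mid e
      start = record
        { between = record
            { M = 2 ; A = 1 ; B = 1 ; a = + a ; b = + b
            ; eq = λ j → trans (ring₁ (mid j)) (trans (sym (eq j))
                  (ring₂ (y₀ j) (y₁ j) (+ a ℤ.* w₁ j) (+ b ℤ.* w₂ j)))
            ; M>0 = s≤s z≤n ; A+B = refl ; 4A = s≤s (s≤s z≤n) ; 4B = s≤s (s≤s z≤n)
            ; a≤M = ℕ.≤-trans a≤1 (s≤s z≤n) ; b≤M = ℕ.≤-trans b≤1 (s≤s z≤n) }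
        ; B′ = 0 ; M′ = 1 ; odd = refl ; even = refl
        ; at-q = sym (ℤ.*-identityˡ e) ; at-y₁ = at-end }

-- Counting classes modulo 2

bit : ℤ → Fin 2
bit x = fromℕ< (n%ℕd<d x 2)

bit-≡ : ∀ x y → bit x ≡ bit y → Even (x ℤ.- y)
bit-≡ x y eq = x /ℕ 2 ℤ.- y /ℕ 2 , trans (cong₂ ℤ._-_ (a≡a%ℕn+[a/ℕn]*n x 2) (a≡a%ℕn+[a/ℕn]*n y 2))
    (trans (cong (λ r → + r ℤ.+ x /ℕ 2 ℤ.* + 2 ℤ.- (+ (y %ℕ 2) ℤ.+ y /ℕ 2 ℤ.* + 2)) r≡)
           (ring (+ (y %ℕ 2)) (x /ℕ 2) (y /ℕ 2)))
  where
  r≡ : x %ℕ 2 ≡ y %ℕ 2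
  r≡ = trans (sym (Fin.toℕ-fromℕ< (n%ℕd<d x 2))) (trans (cong toℕ eq) (Fin.toℕ-fromℕ< (n%ℕd<d y 2)))
  ring : ∀ r p q → r ℤ.+ p ℤ.* + 2 ℤ.- (r ℤ.+ q ℤ.* + 2) ≡ (p ℤ.- q) ℤ.+ (p ℤ.- q)
  ring = solve-∀

bits-≡ : ∀ {n} (u v : V n) → funToFin (bit ∘ u) ≡ funToFin (bit ∘ v) → ∀ j → Even (u j ℤ.- v j)
bits-≡ u v eq j = bit-≡ (u j) (v j) (trans (sym (Fin.finToFun-funToFin (bit ∘ u) j))
  (trans (cong (λ t → finToFun t j) eq) (Fin.finToFun-funToFin (bit ∘ v) j)))

even-bits : ∀ (a a′ : Fin 2) → Even (+ toℕ a ℤ.- + toℕ a′) → a ≡ a′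
even-bits zero zero _ = refl
even-bits (suc zero) (suc zero) _ = refl
even-bits zero (suc zero) (-[1+ u ] , eq) = ⊥-elim (odd eq)
  where
  odd : -[1+ 0 ] ≡ -[1+ u ] ℤ.+ -[1+ u ] → ⊥
  odd ()
even-bits zero (suc zero) (+ u , ())
even-bits (suc zero) zero (+ suc u , eq) = ⊥-elim (ℕ.1+n≢0
      (sym (trans (ℕ.suc-injective (ℤ.+-injective eq)) (ℕ.+-suc u u))))
even-bits (suc zero) zero (+ zero , ())
even-bits (suc zero) zero (-[1+ u ] , ())

-- Five points times four combinations of w₁, w₂ exceed the 16 classes of ℤ⁴ modulo 2.
module _ {w₁ w₂ : V 6} (dw₁ : Dir w₁) (dw₂ : Dir w₂) (indep : Mod2Indep w₁ w₂) where
  open Mod2 w₁ w₂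

  parity-pigeonhole : (p : Fin 5 → V 6) → (∀ k → Pt (p k)) → ∃₂ λ k l → k ≢ l × p k ~ p l
  parity-pigeonhole p pt =
    -- The bound is 2^4 < 5·4, in the form 17 ≤ 17 + 3.
    let (x , x′ , x<x′ , eq) = Fin.pigeonhole (ℕ.m≤m+n 17 3) code
    in collide x x′ (Fin.<⇒≢ x<x′) (halved x x′ (bits-≡ (lattice x) (lattice x′) eq))
    where
    pt-of : Fin (5 ℕ.* 4) → Fin 5
    pt-of x = proj₁ (remQuot {5} 4 x)
    a b : Fin (5 ℕ.* 4) → Fin 2
    a x = proj₁ (remQuot {2} 2 (proj₂ (remQuot {5} 4 x)))
    b x = proj₂ (remQuot {2} 2 (proj₂ (remQuot {5} 4 x)))
    v : Fin (5 ℕ.* 4) → V 6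
    v x = p (pt-of x) ⊕ + toℕ (a x) • w₁ ⊕ + toℕ (b x) • w₂
    -- The two leading coordinates agree for all points, so four bits determine the class.
    lattice : Fin (5 ℕ.* 4) → V 4
    lattice x j = v x (suc (suc j))
    code : Fin (5 ℕ.* 4) → Fin (2 ℕ.^ 4)
    code x = funToFin (bit ∘ lattice x)
    pt-v : ∀ x → Pt (v x)
    pt-v x = pt-⊕ (pt-⊕ (pt (pt-of x)) (dir-• (+ toℕ (a x)) dw₁)) (dir-• (+ toℕ (b x)) dw₂)
    same : ∀ x x′ → pt-of x ≡ pt-of x′ → a x ≡ a x′ → b x ≡ b x′ → x ≡ x′
    same x x′ p≡ a≡ b≡ = trans (sym (Fin.combine-remQuot {5} 4 x)) (trans (cong₂ combine p≡
      (trans (sym (Fin.combine-remQuot {2} 2 (proj₂ (remQuot {5} 4 x)))) (trans (cong₂ combine a≡ b≡)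
        (Fin.combine-remQuot {2} 2 (proj₂ (remQuot {5} 4 x′)))))) (Fin.combine-remQuot {5} 4 x′))
    halved : ∀ x x′ → (∀ j → Even (lattice x j ℤ.- lattice x′ j)) → Halved (v x ⊖ v x′)
    halved x x′ h = (λ { zero → 0ℤ ; (suc zero) → 0ℤ ; (suc (suc j)) → proj₁ (h j) }) ,
      λ { zero → Dir.unit d ; (suc zero) → Dir.level d ; (suc (suc j)) → proj₂ (h j) }
      where
      d : Dir (v x ⊖ v x′)
      d = dir-⊖ (pt-v x) (pt-v x′)
    collide : ∀ x x′ → x ≢ x′ → Halved (v x ⊖ v x′) → ∃₂ λ k l → k ≢ l × p k ~ p l
    collide x x′ x≢x′ (u , h) = decide (pt-of x Fin.≟ pt-of x′)
      where
      α β α′ β′ : ℤ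
      α  = + toℕ (a x)
      β  = + toℕ (b x)
      α′ = + toℕ (a x′)
      β′ = + toℕ (b x′)
      ring₁ : ∀ p α β α′ β′ w w′ → (α ℤ.- α′) ℤ.* w ℤ.+ (β ℤ.- β′) ℤ.* w′ ≡
              (p ℤ.+ α ℤ.* w ℤ.+ β ℤ.* w′) ℤ.- (p ℤ.+ α′ ℤ.* w ℤ.+ β′ ℤ.* w′)
      ring₁ = solve-∀
      ring₂ : ∀ p p′ α β α′ β′ w w′ → p ℤ.+ p′ ℤ.+ (α ℤ.- α′) ℤ.* w ℤ.+ (β ℤ.- β′) ℤ.* w′ ≡
              (p ℤ.+ α ℤ.* w ℤ.+ β ℤ.* w′) ℤ.- (p′ ℤ.+ α′ ℤ.* w ℤ.+ β′ ℤ.* w′) ℤ.+ (p′ ℤ.+ p′)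
      ring₂ = solve-∀
      ring₃ : ∀ u p → (u ℤ.+ u) ℤ.+ (p ℤ.+ p) ≡ (u ℤ.+ p) ℤ.+ (u ℤ.+ p)
      ring₃ = solve-∀
      decide : Dec (pt-of x ≡ pt-of x′) → ∃₂ λ k l → k ≢ l × p k ~ p l
      decide (no p≢) = pt-of x , pt-of x′ , p≢ , mk~ (α ℤ.- α′) (β ℤ.- β′) (u ⊕ p (pt-of x′)) λ j →
        trans (ring₂ (p (pt-of x) j) (p (pt-of x′) j) α β α′ β′ (w₁ j) (w₂ j))
              (trans (cong (ℤ._+ (p (pt-of x′) j ℤ.+ p (pt-of x′) j)) (h j)) (ring₃ (u j) (p (pt-of x′) j)))
      decide (yes p≡) =
        -- For equal points the relation involves only `w₁` and `w₂`; independence modulo 2 then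
        -- forces equal coefficients.
        let (ea , eb) = indep (α ℤ.- α′) (β ℤ.- β′) (u , λ j →
              trans (ring₁ (p (pt-of x) j) α β α′ β′ (w₁ j) (w₂ j))
                (trans (cong (λ t → p (pt-of x) j ℤ.+ α ℤ.* w₁ j ℤ.+ β ℤ.* w₂ j ℤ.-
                      (p t j ℤ.+ α′ ℤ.* w₁ j ℤ.+ β′ ℤ.* w₂ j)) p≡) (h j)))
        in ⊥-elim (x≢x′ (same x x′ p≡ (even-bits (a x) (a x′) ea) (even-bits (b x) (b x′) eb)))

-- Dimension four

no-six : ∀ {a b c d e f : Fin 5} → AllPairs _≢_ (a ∷ b ∷ c ∷ d ∷ e ∷ f ∷ []) → ⊥
no-six {a} {b} {c} {d} {e} {f} distinct =
  let (i , j , i<j , eq) = Fin.pigeonhole (ℕ.n<1+n 5) (List.lookup (a ∷ b ∷ c ∷ d ∷ e ∷ f ∷ []))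
  in at distinct i j i<j eq
  where
  at : ∀ {xs : List (Fin 5)} → AllPairs _≢_ xs → ∀ i j → toℕ i ℕ.< toℕ j → List.lookup xs i ≢ List.lookup xs j
  at (p ∷ ps) zero    (suc j) _         = All.lookup p (Mem.∈-lookup j)
  at (p ∷ ps) (suc i) (suc j) (s≤s i<j) = at ps i j i<j

-- A finite check by evaluation: the inequalities are moved into a disjunction of equalities, which
-- makes the quantified statement decidable.
exhaust : ∀ (a b c e : Fin 4) → a ≢ b → a ≢ c → a ≢ e → b ≢ c → b ≢ e → c ≢ e →
          ∀ l → (l ≡ a ⊎ l ≡ b) ⊎ (l ≡ c ⊎ l ≡ e)
exhaust a b c e a≢b a≢c a≢e b≢c b≢e c≢e l = pick (table a b c e l)
  where
  Coincide Found : Fin 4 → Fin 4 → Fin 4 → Fin 4 → Fin 4 → Set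
  Coincide a b c e l = a ≡ b ⊎ a ≡ c ⊎ a ≡ e ⊎ b ≡ c ⊎ b ≡ e ⊎ c ≡ e
  Found a b c e l = (l ≡ a ⊎ l ≡ b) ⊎ (l ≡ c ⊎ l ≡ e)
  table : ∀ a b c e l → Coincide a b c e l ⊎ Found a b c e l
  table = from-yes (Fin.all? λ (a : Fin 4) → Fin.all? λ (b : Fin 4) → Fin.all? λ (c : Fin 4) →
    Fin.all? λ (e : Fin 4) → Fin.all? λ (l : Fin 4) →
    (a Fin.≟ b ⊎-dec a Fin.≟ c ⊎-dec a Fin.≟ e ⊎-dec b Fin.≟ c ⊎-dec b Fin.≟ e ⊎-dec c Fin.≟ e) ⊎-dec
    ((l Fin.≟ a ⊎-dec l Fin.≟ b) ⊎-dec (l Fin.≟ c ⊎-dec l Fin.≟ e)))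
  pick : Coincide a b c e l ⊎ Found a b c e l → Found a b c e l
  pick (inj₂ h) = h
  pick (inj₁ (inj₁ h)) = ⊥-elim (a≢b h)
  pick (inj₁ (inj₂ (inj₁ h))) = ⊥-elim (a≢c h)
  pick (inj₁ (inj₂ (inj₂ (inj₁ h)))) = ⊥-elim (a≢e h)
  pick (inj₁ (inj₂ (inj₂ (inj₂ (inj₁ h))))) = ⊥-elim (b≢c h)
  pick (inj₁ (inj₂ (inj₂ (inj₂ (inj₂ (inj₁ h)))))) = ⊥-elim (b≢e h)
  pick (inj₁ (inj₂ (inj₂ (inj₂ (inj₂ (inj₂ h)))))) = ⊥-elim (c≢e h)

other-rows : ∀ (i j : Fin 4) → i ≢ j → ∃₂ λ p q → ∀ l → (l ≡ i ⊎ l ≡ j) ⊎ (l ≡ p ⊎ l ≡ q)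
other-rows i j i≢j = pick (table i j)
  where
  Others : Fin 4 → Fin 4 → Set
  Others i j = ∃₂ λ p q → ∀ l → (l ≡ i ⊎ l ≡ j) ⊎ (l ≡ p ⊎ l ≡ q)
  table : ∀ i j → i ≡ j ⊎ Others i j
  table = from-yes (Fin.all? λ (i : Fin 4) → Fin.all? λ (j : Fin 4) → i Fin.≟ j ⊎-dec
        (Fin.any? λ (p : Fin 4) → Fin.any? λ (q : Fin 4) → Fin.all? λ (l : Fin 4) →
    (l Fin.≟ i ⊎-dec l Fin.≟ j) ⊎-dec (l Fin.≟ p ⊎-dec l Fin.≟ q)))
  pick : i ≡ j ⊎ Others i j → Others i j
  pick (inj₁ i≡j) = ⊥-elim (i≢j i≡j)
  pick (inj₂ h)   = h

two-of-three : ∀ {a b : Fin 4} (i : Fin 3 → Fin 4) → (∀ k → i k ≡ a ⊎ i k ≡ b) →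
               i zero ≡ i (suc zero) ⊎ i (suc zero) ≡ i (suc (suc zero)) ⊎ i zero ≡ i (suc (suc zero))
two-of-three i h with h zero | h (suc zero) | h (suc (suc zero))
... | inj₁ p | inj₁ q | _      = inj₁ (trans p (sym q))
... | inj₂ p | inj₂ q | _      = inj₁ (trans p (sym q))
... | inj₁ p | inj₂ q | inj₁ r = inj₂ (inj₂ (trans p (sym r)))
... | inj₁ p | inj₂ q | inj₂ r = inj₂ (inj₁ (trans q (sym r)))
... | inj₂ p | inj₁ q | inj₁ r = inj₂ (inj₁ (trans q (sym r)))
... | inj₂ p | inj₁ q | inj₂ r = inj₂ (inj₂ (trans p (sym r)))

module Dim4 (P : Fin 4 → Cone 6) (xs : List (V 6)) (complete : Polyhedron.Complete P xs)
            (th : Polyhedron.Threshold P) (y : Fin 5 → V 6) (y∈X : ∀ k → Polyhedron.X P (y k))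
            (indep : Indep y) (tight? : ∀ k i → Dec (P i ∋ ⊝ y k)) where
  open Polyhedron P
  open Threshold th
  open Bounded xs complete th
  open Points y y∈X indep
  private module P i = Cone (P i)

  record Signed (z : W) : Set where
    field
      a b c e : Fin 4
      cover   : ∀ l → (l ≡ a ⊎ l ≡ b) ⊎ (l ≡ c ⊎ l ≡ e)
      side⁺   : ∀ {l} → l ≡ a ⊎ l ≡ b → Pos (P l) z
      side⁻   : ∀ {l} → l ≡ c ⊎ l ≡ e → ¬ P l ∋ z

    -- The vector ± z on which row l is positive.
    orient : Fin 4 → W
    orient l = [ (λ _ → z) , (λ _ → ⊝ z) ]′ (cover l)

    Oriented : Fin 4 → Set
    Oriented l = (Pos (P l) z × orient l ≡ z) ⊎ (¬ P l ∋ z × orient l ≡ ⊝ z)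

    orient-cases : ∀ l → Oriented l
    orient-cases l with cover l
    ... | inj₁ h = inj₁ (side⁺ h , refl)
    ... | inj₂ h = inj₂ (side⁻ h , refl)

    pos-orient : ∀ l → Pos (P l) (orient l)
    pos-orient l with orient-cases l
    ... | inj₁ (p , eq) = subst (Pos (P l)) (sym eq) p
    ... | inj₂ (n , eq) = subst (Pos (P l)) (sym eq) λ r → n (P.resp l (λ j → ℤ.neg-involutive (z j)) r)

    sign-orient : ∀ l → ∃ λ τ → z ≗ τ • orient l
    sign-orient l with orient-cases l
    ... | inj₁ (_ , eq) = 1ℤ , λ j → trans (sym (ℤ.*-identityˡ (z j))) (cong (λ t → 1ℤ ℤ.* t j) (sym eq))
    ... | inj₂ (_ , eq) = ℤ.- 1ℤ , λ j → trans (ring (z j)) (cong (λ t → ℤ.- 1ℤ ℤ.* t j) (sym eq))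
      where
      ring : ∀ x → x ≡ ℤ.- 1ℤ ℤ.* (ℤ.- x)
      ring = solve-∀

    not-null : ∀ l → ¬ Null (P l) z
    not-null l (p , q) with cover l
    ... | inj₁ h = side⁺ h q
    ... | inj₂ h = side⁻ h p

    is⁺ : ∀ {l} → Pos (P l) z → l ≡ a ⊎ l ≡ b
    is⁺ {l} p with cover l
    ... | inj₁ h = h
    ... | inj₂ h = ⊥-elim (p (P.total l (side⁻ h)))

    is⁻ : ∀ {l} → ¬ P l ∋ z → l ≡ c ⊎ l ≡ e
    is⁻ {l} n with cover l
    ... | inj₁ h = ⊥-elim (n (pos∈ (P l) (side⁺ h)))
    ... | inj₂ h = h

  -- A row tight at all five points vanishes on the lattice of their differences, so each
  -- sign occurs on two rows.
  signs : ∀ c → NonZero c → (∀ i → Small (P i) (η i) (lin c g)) → ¬ ¬ Signed (lin c g)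
  signs c c≢0 small = do
    z∈? ← ¬¬-Π λ i → em (P i ∋ lin c g)
    ⊝z∈? ← ¬¬-Π λ i → em (P i ∋ ⊝ lin c g)
    let open Signs tight? (dir-lin c g dir-g) (lin-g≢0 c c≢0) small z∈? ⊝z∈?
        loose : ∀ i → ¬ Null (P i) (lin c g) → ∃ λ k → ¬ Tight k i
        loose i h = Fin.¬∀⟶∃¬ 5 (λ k → Tight k i) (λ k → tight? k i) (λ t → h (common-tight⇒null c i t))
        (a , _ , pa) = pos-row zero
        -- Row a is positive on z, hence not null, hence loose at some point k. A positive row that
        -- is tight at k must differ from a.
        (k , ¬ka) = loose a (λ n → pa (proj₂ n))
        (b , kb , pb) = pos-row k
        (c′ , _ , nc) = neg-row zero
        (l , ¬lc) = loose c′ (λ n → nc (proj₁ n))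
        (e , le , ne) = neg-row l
        sep : ∀ {i j} → Pos (P i) (lin c g) → ¬ P j ∋ lin c g → i ≢ j
        sep {i} p n i≡j = n (subst (λ r → P r ∋ lin c g) i≡j (pos∈ (P i) p))
        a≢b : a ≢ b
        a≢b a≡b = ¬ka (subst (Tight k) (sym a≡b) kb)
        c≢e : c′ ≢ e
        c≢e c≡e = ¬lc (subst (Tight l) (sym c≡e) le)
    return (record
      { a = a ; b = b ; c = c′ ; e = e
      ; cover = exhaust a b c′ e a≢b (sep pa nc) (sep pa ne) (sep pb nc) (sep pb ne) c≢e
      ; side⁺ = λ { (inj₁ l≡) → subst (λ r → Pos (P r) (lin c g)) (sym l≡) pa
                  ; (inj₂ l≡) → subst (λ r → Pos (P r) (lin c g)) (sym l≡) pb }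
      ; side⁻ = λ { (inj₁ l≡) → subst (λ r → ¬ P r ∋ lin c g) (sym l≡) nc
                  ; (inj₂ l≡) → subst (λ r → ¬ P r ∋ lin c g) (sym l≡) ne } })

  -- Three points with two common tight rows would span a rank-2 lattice with only two
  -- functionals left; Dirichlet then gives a short lattice vector that can be added to one of them.
  three-share : ∀ {k l m} → k ≢ l → l ≢ m → k ≢ m → ∀ {i j} → i ≢ j →
                Tight k i → Tight l i → Tight m i → Tight k j → Tight l j → Tight m j → ⊥
  three-share {k} {l} {m} k≢l l≢m k≢m {i} {j} i≢j ki li mi kj lj mj =
    let (p , q , rows) = other-rows i j i≢j in go p q rows
    where
    h : Fin 2 → W
    h zero       = y l ⊖ y k
    h (suc zero) = y m ⊖ y k
    dir-h : ∀ s → Dir (h s)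
    dir-h zero       = dir-⊖ (proj₁ (y∈X l)) (proj₁ (y∈X k))
    dir-h (suc zero) = dir-⊖ (proj₁ (y∈X m)) (proj₁ (y∈X k))
    h-null : ∀ c r → Tight k r → Tight l r → Tight m r → Null (P r) (lin c h)
    h-null c r kr lr mr = null-lin (P r) c h λ { zero → diff-null r kr lr ; (suc zero) → diff-null r kr mr }
    h≢0 : ∀ c → NonZero c → ¬ lin c h ≗ 𝟘
    h≢0 c (s , cs≢0) lin≡0 = cs≢0 (coef s)
      where
      c₀ c₁ : ℤ
      c₀ = c zero
      c₁ = c (suc zero)
      C : V 5
      C = c₀ • δ l ⊕ c₁ • δ m ⊖ (c₀ ℤ.+ c₁) • δ k
      C≗0 : C ≗ 𝟘
      C≗0 = indep C λ t → begin
          lin C y t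
            ≡⟨ lin-⊖ (c₀ • δ l ⊕ c₁ • δ m) ((c₀ ℤ.+ c₁) • δ k) y t ⟩
          lin (c₀ • δ l ⊕ c₁ • δ m) y t ℤ.- lin ((c₀ ℤ.+ c₁) • δ k) y t
            ≡⟨ cong₂ ℤ._-_ (trans (lin-⊕ (c₀ • δ l) (c₁ • δ m) y t) (cong₂ ℤ._+_ (at c₀ l t) (at c₁ m t)))
                  (at (c₀ ℤ.+ c₁) k t) ⟩
          c₀ ℤ.* y l t ℤ.+ c₁ ℤ.* y m t ℤ.- (c₀ ℤ.+ c₁) ℤ.* y k t
            ≡⟨ ring c₀ c₁ (y l t) (y m t) (y k t) ⟩
          lin c h t
            ≡⟨ lin≡0 t ⟩
          0ℤ ∎
        where
        open ≡-Reasoning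
        at : ∀ c l t → lin (c • δ l) y t ≡ c ℤ.* y l t
        at c l t = trans (lin-• c (δ l) y t) (cong (c ℤ.*_) (lin-δ l y t))
        ring : ∀ a b x z w → a ℤ.* x ℤ.+ b ℤ.* z ℤ.- (a ℤ.+ b) ℤ.* w ≡ a ℤ.* (x ℤ.- w) ℤ.+ (b ℤ.* (z ℤ.- w) ℤ.+ 0ℤ)
        ring = solve-∀
      eval : ∀ t {dl dm dk} → δ l t ≡ dl → δ m t ≡ dm → δ k t ≡ dk →
             c₀ ℤ.* dl ℤ.+ c₁ ℤ.* dm ℤ.- (c₀ ℤ.+ c₁) ℤ.* dk ≡ 0ℤ
      eval t refl refl refl = C≗0 t
      ring₀ : ∀ a b → a ≡ a ℤ.* 1ℤ ℤ.+ b ℤ.* 0ℤ ℤ.- (a ℤ.+ b) ℤ.* 0ℤ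
      ring₀ = solve-∀
      ring₁ : ∀ a b → b ≡ a ℤ.* 0ℤ ℤ.+ b ℤ.* 1ℤ ℤ.- (a ℤ.+ b) ℤ.* 0ℤ
      ring₁ = solve-∀
      coef : ∀ s → c s ≡ 0ℤ
      coef zero       = trans (ring₀ c₀ c₁) (eval l (δ-same l) (δ-diff (l≢m ∘ sym)) (δ-diff k≢l))
      coef (suc zero) = trans (ring₁ c₀ c₁) (eval m (δ-diff l≢m) (δ-same m) (δ-diff k≢m))
    go : ∀ p q → (∀ r → (r ≡ i ⊎ r ≡ j) ⊎ (r ≡ p ⊎ r ≡ q)) → ⊥
    go p q rows = decide (tight? k p) (tight? k q)
      where
      row : Fin 2 → Fin 4
      row zero       = p
      row (suc zero) = q
      each : {Q : Fin 4 → Set} → Q i → Q j → Q p → Q q → ∀ r → Q r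
      each {Q} qi qj qp qq r with rows r
      ... | inj₁ (inj₁ r≡) = subst Q (sym r≡) qi
      ... | inj₁ (inj₂ r≡) = subst Q (sym r≡) qj
      ... | inj₂ (inj₁ r≡) = subst Q (sym r≡) qp
      ... | inj₂ (inj₂ r≡) = subst Q (sym r≡) qq
      short : ¬ ¬ ∃ λ c → NonZero c × ∀ s → Small (P (row s)) (η (row s)) (lin c h)
      -- Rows i and j vanish on the span of h, so a combination inside the two remaining cones would
      -- lie in all four.
      short = small-all (P ∘ row) (η ∘ row) (pos ∘ row) h 0
          (λ c c≢0 out → h≢0 c c≢0 (rec (y∈X k) (dir-lin c h dir-h)
            (each {λ r → P r ∋ lin c h} (proj₁ (h-null c i ki li mi)) (proj₁ (h-null c j kj lj mj)) (out zero)
                  (out (suc zero))))) >>=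
        λ (c , c≢0 , small) → return (c , c≢0 , λ s → small-resp (P (row s)) (λ t → ℤ.*-identityˡ (lin c h t))
              (small s))
      -- The sign is chosen so that the row o, possibly tight at y k, is respected.
      leave : ∀ o r → (¬ Tight k r) → (∀ {Q : Fin 4 → Set} → Q i → Q j → Q o → Q r → ∀ t → Q t) →
              (∃ λ c → NonZero c × Small (P r) (η r) (lin c h)) → ⊥
      leave o r loose each′ (c , c≢0 , small) = em (P o ∋ lin c h) λ
        { (yes o∈) → escape (y∈X k) (dir-lin c h dir-h) (h≢0 c c≢0)
            (each′ {λ t → ¬ P t ∋ lin c h → (¬ Tight k t) × Small (P t) (η t) (lin c h)}
              (λ ∌ → ⊥-elim (∌ (proj₁ (h-null c i ki li mi)))) (λ ∌ → ⊥-elim (∌ (proj₁ (h-null c j kj lj mj))))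
              (λ ∌ → ⊥-elim (∌ o∈)) (λ _ → loose , small))
        ; (no o∉) → escape (y∈X k) (dir-⊝ (dir-lin c h dir-h)) (h≢0 c c≢0 ∘ ⊝-null)
            (each′ {λ t → ¬ P t ∋ ⊝ lin c h → (¬ Tight k t) × Small (P t) (η t) (⊝ lin c h)}
              (λ ∌ → ⊥-elim (∌ (proj₂ (h-null c i ki li mi)))) (λ ∌ → ⊥-elim (∌ (proj₂ (h-null c j kj lj mj))))
              (λ ∌ → ⊥-elim (∌ (P.total o o∉))) (λ _ → loose , small-⊝ (P r) small)) }
      decide : Dec (Tight k p) → Dec (Tight k q) → ⊥
      -- If all four rows are tight at `y k`, the difference of two points is a recession direction.
      -- Otherwise a loose row absorbs the short vector.
      decide (yes kp) (yes kq) = escape-diff (k≢l ∘ sym) (each {λ r → P r ∋ y l ⊖ y k}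
        (proj₁ (diff-null i ki li)) (proj₁ (diff-null j kj lj))
        (P.add p (proj₂ (y∈X l) p) kp) (P.add q (proj₂ (y∈X l) q) kq))
      decide (no ¬kp) _ = short λ (c , c≢0 , small) →
        leave q p ¬kp (λ {Q} qi qj qo qr → each {Q} qi qj qr qo) (c , c≢0 , small zero)
      decide (yes _) (no ¬kq) = short λ (c , c≢0 , small) →
        leave p q ¬kq (λ {Q} → each {Q}) (c , c≢0 , small (suc zero))

  module Scale (c₀ : V 4) (c₀≢0 : NonZero c₀) (small₀ : ∀ i → Small (P i) (η i) (+ 64 • lin c₀ g))
               (S₀ : Signed (lin c₀ g)) where
    open Signed S₀ using (orient; Oriented; orient-cases; pos-orient; is⁺; is⁻)

    z₀ : W
    z₀ = lin c₀ g

    dir-z₀ : Dir z₀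
    dir-z₀ = dir-lin c₀ g dir-g

    -- On row i the value of `ζ i` is the absolute value of that of `z₀`, so it can serve as the
    -- next threshold.
    ζ : Fin 4 → W
    ζ = orient

    pos-ζ : ∀ i → Pos (P i) (ζ i)
    pos-ζ = pos-orient

    ζ∈ : ∀ i → P i ∋ ζ i
    ζ∈ i = pos∈ (P i) (pos-orient i)

    η-64ζ : ∀ i → P i ∋ η i ⊖ + 64 • ζ i
    η-64ζ i = go (orient-cases i)
      where
      ring : ∀ h x → h ℤ.+ + 64 ℤ.* x ≡ h ℤ.- + 64 ℤ.* (ℤ.- x)
      ring = solve-∀
      go : Oriented i → P i ∋ η i ⊖ + 64 • ζ i
      go (inj₁ (_ , eq)) = subst (λ t → P i ∋ η i ⊖ + 64 • t) (sym eq) (small⁻ (P i) (small₀ i))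
      go (inj₂ (_ , eq)) = subst (λ t → P i ∋ η i ⊖ + 64 • t) (sym eq)
        (P.resp i (λ j → ring (η i j) (z₀ j)) (small⁺ (P i) (small₀ i)))

    η-ζ : ∀ i → P i ∋ η i ⊖ ζ i
    η-ζ i = P.resp i (λ j → ring (η i j) (ζ i j)) (P.add i (η-64ζ i) (P.mul∈ i 63 (ζ∈ i)))
      where
      ring : ∀ h z → h ℤ.- + 64 ℤ.* z ℤ.+ + 63 ℤ.* z ≡ h ℤ.- z
      ring = solve-∀

    ζ+z₀ : ∀ i → P i ∋ ζ i ⊕ z₀
    ζ+z₀ i = go (orient-cases i)
      where
      go : Oriented i → P i ∋ ζ i ⊕ z₀
      go (inj₁ (p , eq)) = P.add i (ζ∈ i) (pos∈ (P i) p)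
      go (inj₂ (_ , eq)) = subst (λ t → P i ∋ t ⊕ z₀) (sym eq) (P.resp i (λ j → sym (ℤ.+-inverseˡ (z₀ j))) (P.0∈ i))

    ζ⊝z₀ : ∀ i → P i ∋ ζ i ⊕ ⊝ z₀
    ζ⊝z₀ i = go (orient-cases i)
      where
      go : Oriented i → P i ∋ ζ i ⊕ ⊝ z₀
      go (inj₁ (_ , eq)) = subst (λ t → P i ∋ t ⊕ ⊝ z₀) (sym eq) (P.resp i (λ j → sym (ℤ.+-inverseʳ (z₀ j))) (P.0∈ i))
      go (inj₂ (n , eq)) = P.add i (ζ∈ i) (P.total i n)

    small-z₀ : ∀ i → Small (P i) (η i) z₀
    small-z₀ i = small-resp (P i) (λ j → ℤ.*-identityˡ (z₀ j)) (small-∣ (P i) {1} {64} (s≤s z≤n) (pos i) (small₀ i))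

    module Parity (w₁ w₂ : W) (dir-w₁ : Dir w₁) (dir-w₂ : Dir w₂)
                  (small-w₁ : ∀ i → Small (P i) (ζ i) (+ 16 • w₁)) (small-w₂ : ∀ i → Small (P i) (ζ i) (+ 16 • w₂))
                  (ind : ∀ {k l} → k ≢ l → ∀ i → Tight k i → Tight l i → Ind3 (y l ⊖ y k) w₁ w₂)
                  (mod2 : Mod2Indep w₁ w₂) where
      open Mod2 w₁ w₂

      -- A lattice point close to a point of the polyhedron at which exactly the rows in S are tight.
      record Near (q : W) (S : Fin 4 → Set) : Set where
        field
          pt   : Pt q
          low  : ∀ i → P i ∋ + 4 • q ⊕ ζ i
          high : ∀ i → ¬ S i → P i ∋ + 8 • q ⊖ η i

      near-y : ∀ k → Near (y k) (Tight k)
      near-y k = record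
        { pt   = proj₁ (y∈X k)
        ; low  = λ i → P.add i (P.mul∈ i 4 (proj₂ (y∈X k) i)) (ζ∈ i)
        ; high = λ i loose → P.resp i (λ j → ring (y k j) (η i j))
            (P.add i (P.mul∈ i 8 (slack i (y∈X k) loose)) (P.mul∈ i 7 (pos∈ (P i) (pos i)))) }
        where
        ring : ∀ x h → + 8 ℤ.* (x ℤ.- h) ℤ.+ + 7 ℤ.* h ≡ + 8 ℤ.* x ℤ.- h
        ring = solve-∀

      w-bound : ∀ i M a {w} → ℤ.∣ a ∣ ℕ.≤ M → Small (P i) (ζ i) (+ 16 • w) → P i ∋ + M • ζ i ⊕ (+ 16 ℤ.* a) • w
      w-bound i M (+ n) {w} n≤M s = P.resp i (λ j → trans (ring (+ n) (+ (M ℕ.∸ n)) (ζ i j) (w j))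
          (cong (λ t → t ℤ.* ζ i j ℤ.+ + 16 ℤ.* + n ℤ.* w j) (cong +_ (ℕ.m+[n∸m]≡n n≤M))))
          (P.add i (P.mul∈ i n (small⁺ (P i) s)) (P.mul∈ i (M ℕ.∸ n) (ζ∈ i)))
        where
        ring : ∀ n d z w → n ℤ.* (z ℤ.+ + 16 ℤ.* w) ℤ.+ d ℤ.* z ≡ (n ℤ.+ d) ℤ.* z ℤ.+ + 16 ℤ.* n ℤ.* w
        ring = solve-∀
      w-bound i M -[1+ n ] {w} n≤M s = P.resp i (λ j → trans (ring (+ suc n) (+ (M ℕ.∸ suc n)) (ζ i j) (w j))
          (cong (λ t → t ℤ.* ζ i j ℤ.+ + 16 ℤ.* -[1+ n ] ℤ.* w j) (cong +_ (ℕ.m+[n∸m]≡n n≤M))))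
          (P.add i (P.mul∈ i (suc n) (small⁻ (P i) s)) (P.mul∈ i (M ℕ.∸ suc n) (ζ∈ i)))
        where
        ring : ∀ n d z w → n ℤ.* (z ℤ.- + 16 ℤ.* w) ℤ.+ d ℤ.* z ≡ (n ℤ.+ d) ℤ.* z ℤ.+ + 16 ℤ.* (ℤ.- n) ℤ.* w
        ring = solve-∀

      div-pos : ∀ i {m v} → 1 ℕ.≤ m → P i ∋ + m • v → P i ∋ v
      div-pos i {suc m} _ p = P.div∈ i m p

      -- The two correction terms cost at most ζ/16 each, so q ≥ -ζ/8 on every row. An end with
      -- slack η has weight at least 1/4, which leaves q ≥ η/4 - ζ/8 ≥ η/8 because ζ ≤ η. This is
      -- where the 4 and the 8 in `Near` have room.
      near-between : ∀ {k l q} → Between (y k) (y l) q → Near q (λ i → Tight k i × Tight l i)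
      near-between {k} {l} {q} s = record { pt = pt ; low = low ; high = high }
        where
        open Between s
        M≢0 : + M ≢ 0ℤ
        M≢0 h = ℕ.<⇒≢ M>0 (sym (ℤ.+-injective h))
        cancel : ∀ x c → + M ℤ.* x ≡ + M ℤ.* c → x ≡ c
        cancel x c = ℤ.*-cancelˡ-≡ (+ M) x c ⦃ ℤ.≢-nonZero M≢0 ⦄
        subst₄ : ∀ {p q r s p′ q′ r′ s′} → p ≡ p′ → q ≡ q′ → r ≡ r′ → s ≡ s′ →
                 + A ℤ.* p ℤ.+ + B ℤ.* q ℤ.+ a ℤ.* r ℤ.+ b ℤ.* s ≡ + A ℤ.* p′ ℤ.+ + B ℤ.* q′ ℤ.+ a ℤ.* r′ ℤ.+ b ℤ.* s′
        subst₄ refl refl refl refl = refl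
        ring₀ : ∀ M A B a b → A ℤ.* 0ℤ ℤ.+ B ℤ.* 0ℤ ℤ.+ a ℤ.* 0ℤ ℤ.+ b ℤ.* 0ℤ ≡ M ℤ.* 0ℤ
        ring₀ = solve-∀
        ring₁ : ∀ A B a b → A ℤ.* 1ℤ ℤ.+ B ℤ.* 1ℤ ℤ.+ a ℤ.* 0ℤ ℤ.+ b ℤ.* 0ℤ ≡ (A ℤ.+ B) ℤ.* 1ℤ
        ring₁ = solve-∀
        pt : Pt q
        pt = cancel (q zero) 0ℤ (trans (eq zero) (trans
               (subst₄ (Pt.unit (proj₁ (y∈X k))) (Pt.unit (proj₁ (y∈X l))) (Dir.unit dir-w₁) (Dir.unit dir-w₂))
               (ring₀ (+ M) (+ A) (+ B) a b)))
           , cancel (q (suc zero)) 1ℤ (trans (eq (suc zero)) (trans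
               (subst₄ (Pt.level (proj₁ (y∈X k))) (Pt.level (proj₁ (y∈X l))) (Dir.level dir-w₁) (Dir.level dir-w₂))
               (trans (ring₁ (+ A) (+ B) a b) (cong (λ t → + t ℤ.* 1ℤ) A+B))))
        low : ∀ i → P i ∋ + 4 • q ⊕ ζ i
        low i = div-pos i {4 ℕ.* M} (ℕ.≤-trans M>0 (ℕ.m≤m+n M _)) (P.resp i
            (λ j → trans (ringA (+ A) (+ B) a b (+ M) (y k j) (y l j) (w₁ j) (w₂ j) (ζ i j))
              (trans (cong (λ t → + 16 ℤ.* t ℤ.+ + 4 ℤ.* (+ M ℤ.* ζ i j)) (sym (eq j)))
                (trans (ringB (+ M) (q j) (ζ i j)) (cong (ℤ._* (+ 4 ℤ.* q j ℤ.+ ζ i j)) (sym (ℤ.pos-* 4 M))))))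
            (P.add i (P.add i (P.add i (P.add i
              (P.mul∈ i 16 (P.mul∈ i A (proj₂ (y∈X k) i))) (P.mul∈ i 16 (P.mul∈ i B (proj₂ (y∈X l) i))))
              (w-bound i M a a≤M (small-w₁ i))) (w-bound i M b b≤M (small-w₂ i))) (P.mul∈ i 2 (P.mul∈ i M (ζ∈ i)))))
          where
          ringA : ∀ A B a b M x y w w′ z →
            + 16 ℤ.* (A ℤ.* x) ℤ.+ + 16 ℤ.* (B ℤ.* y) ℤ.+ (M ℤ.* z ℤ.+ + 16 ℤ.* a ℤ.* w) ℤ.+
                  (M ℤ.* z ℤ.+ + 16 ℤ.* b ℤ.* w′) ℤ.+ + 2 ℤ.* (M ℤ.* z) ≡
            + 16 ℤ.* (A ℤ.* x ℤ.+ B ℤ.* y ℤ.+ a ℤ.* w ℤ.+ b ℤ.* w′) ℤ.+ + 4 ℤ.* (M ℤ.* z)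
          ringA = solve-∀
          ringB : ∀ M q z → + 16 ℤ.* (M ℤ.* q) ℤ.+ + 4 ℤ.* (M ℤ.* z) ≡ + 4 ℤ.* M ℤ.* (+ 4 ℤ.* q ℤ.+ z)
          ringB = solve-∀
        -- The end with slack has weight A′ ≥ M/4.
        high-at : ∀ i A′ B′ {x x′ : W} → (∀ j → + M ℤ.* q j ≡ + A′ ℤ.* x j ℤ.+ + B′ ℤ.* x′ j ℤ.+ a ℤ.* w₁ j
              ℤ.+ b ℤ.* w₂ j) →
                  M ℕ.≤ 4 ℕ.* A′ → P i ∋ x ⊖ η i → P i ∋ x′ → P i ∋ + 8 • q ⊖ η i
        high-at i A′ B′ {x} {x′} eq′ 4A′ x-η x′∈ = div-pos i {2 ℕ.* M} (ℕ.≤-trans M>0 (ℕ.m≤m+n M _)) (P.resp i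
            (λ j → trans (ringA (+ A′) (+ B′) a b (+ M) (+ D) (x j) (x′ j) (w₁ j) (w₂ j) (ζ i j) (η i j))
              (trans (cong₂ (λ s t → + 16 ℤ.* s ℤ.- + 4 ℤ.* (t ℤ.* η i j) ℤ.+ + 2 ℤ.* (+ M ℤ.* ζ i j) ℤ.+ + 2 ℤ.*
                    (+ M ℤ.* (η i j ℤ.- ζ i j)) ℤ.+ + 4 ℤ.* (+ D ℤ.* η i j))
                  (sym (eq′ j)) 4A≡)
                (trans (ringB (+ M) (+ D) (q j) (ζ i j) (η i j))
                      (cong (ℤ._* (+ 8 ℤ.* q j ℤ.- η i j)) (sym (ℤ.pos-* 2 M))))))
            (P.add i (P.add i (P.add i (P.add i (P.add i
              (P.mul∈ i 16 (P.mul∈ i A′ x-η)) (P.mul∈ i 16 (P.mul∈ i B′ x′∈)))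
              (w-bound i M a a≤M (small-w₁ i))) (w-bound i M b b≤M (small-w₂ i)))
              (P.mul∈ i 2 (P.mul∈ i M (η-ζ i)))) (P.mul∈ i 4 (P.mul∈ i D (pos∈ (P i) (pos i))))))
          where
          D : ℕ
          D = 4 ℕ.* A′ ℕ.∸ M
          4A≡ : + 4 ℤ.* + A′ ≡ + M ℤ.+ + D
          4A≡ = trans (sym (ℤ.pos-* 4 A′)) (cong +_ (sym (ℕ.m+[n∸m]≡n 4A′)))
          ringA : ∀ A B a b M D x y w w′ z h →
            + 16 ℤ.* (A ℤ.* (x ℤ.- h)) ℤ.+ + 16 ℤ.* (B ℤ.* y) ℤ.+ (M ℤ.* z ℤ.+ + 16 ℤ.* a ℤ.* w) ℤ.+
                  (M ℤ.* z ℤ.+ + 16 ℤ.* b ℤ.* w′) ℤ.+ + 2 ℤ.* (M ℤ.* (h ℤ.- z)) ℤ.+ + 4 ℤ.* (D ℤ.* h) ≡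
            + 16 ℤ.* (A ℤ.* x ℤ.+ B ℤ.* y ℤ.+ a ℤ.* w ℤ.+ b ℤ.* w′) ℤ.- + 4 ℤ.* (+ 4 ℤ.* A ℤ.* h) ℤ.+ + 2 ℤ.*
                  (M ℤ.* z) ℤ.+ + 2 ℤ.* (M ℤ.* (h ℤ.- z)) ℤ.+ + 4 ℤ.* (D ℤ.* h)
          ringA = solve-∀
          ringB : ∀ M D q z h →
            + 16 ℤ.* (M ℤ.* q) ℤ.- + 4 ℤ.* ((M ℤ.+ D) ℤ.* h) ℤ.+ + 2 ℤ.* (M ℤ.* z) ℤ.+ + 2 ℤ.* (M ℤ.* (h ℤ.- z))
                  ℤ.+ + 4 ℤ.* (D ℤ.* h) ≡
            + 2 ℤ.* M ℤ.* (+ 8 ℤ.* q ℤ.- h)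
          ringB = solve-∀
        high : ∀ i → ¬ (Tight k i × Tight l i) → P i ∋ + 8 • q ⊖ η i
        high i ¬both = go (tight? k i) (tight? l i)
          where
          go : Dec (Tight k i) → Dec (Tight l i) → P i ∋ + 8 • q ⊖ η i
          go (yes p) (yes p′) = ⊥-elim (¬both (p , p′))
          go (no loose) _     = high-at i A B {y k} {y l} eq 4A (slack i (y∈X k) loose) (proj₂ (y∈X l) i)
          go (yes _) (no loose) = high-at i B A {y l} {y k} (Between.eq (swap-between {y k} {y l} s)) 4B
                (slack i (y∈X l) loose) (proj₂ (y∈X k) i)

      -- If v is positive on every common row, adding v to the midpoint gives an interior
      -- lattice point of the polyhedron.
      interior : ∀ {q q′ S S′} → Near q S → Near q′ S′ → Midpoint q q′ → ∀ v → Dir v →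
                 (∀ i → P i ∋ ζ i ⊕ v) → (∀ i → S i → S′ i → ζ i ≗ v) → ⊥
      interior {q} {q′} {S} {S′} nq nq′ m v dir-v ζ+v same =
          escape x∈X dir-z₀ (lin-g≢0 c₀ c₀≢0) λ i _ → loose i , small-z₀ i
        where
        module N  = Near nq
        module N′ = Near nq′
        open Midpoint m renaming (mid to r)
        ws : ∀ i → P i ∋ (+ 1 • ζ i ⊕ (+ 16 ℤ.* + a) • w₁) ⊕ (+ 1 • ζ i ⊕ (+ 16 ℤ.* + b) • w₂)
        ws i = P.add i (w-bound i 1 (+ a) a≤1 (small-w₁ i)) (w-bound i 1 (+ b) b≤1 (small-w₂ i))
        ring-common : ∀ q q′ α β w w′ z → + 4 ℤ.* (+ 4 ℤ.* q ℤ.+ z) ℤ.+ + 4 ℤ.* (+ 4 ℤ.* q′ ℤ.+ z) ℤ.+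
                      (+ 1 ℤ.* z ℤ.+ + 16 ℤ.* α ℤ.* w ℤ.+ (+ 1 ℤ.* z ℤ.+ + 16 ℤ.* β ℤ.* w′)) ≡
                      + 16 ℤ.* (q ℤ.+ q′ ℤ.+ α ℤ.* w ℤ.+ β ℤ.* w′) ℤ.+ + 10 ℤ.* z
        ring-common = solve-∀
        ring-common′ : ∀ r z → + 16 ℤ.* (r ℤ.+ r) ℤ.+ + 10 ℤ.* z ≡ + 32 ℤ.* (r ℤ.+ z) ℤ.- + 22 ℤ.* z
        ring-common′ = solve-∀
        ring-slack : ∀ q q′ α β w w′ z h v → + 2 ℤ.* (+ 8 ℤ.* q ℤ.- h) ℤ.+ + 4 ℤ.* (+ 4 ℤ.* q′ ℤ.+ z) ℤ.+
                     (+ 1 ℤ.* z ℤ.+ + 16 ℤ.* α ℤ.* w ℤ.+ (+ 1 ℤ.* z ℤ.+ + 16 ℤ.* β ℤ.* w′)) ℤ.+ + 2 ℤ.*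
                           (h ℤ.- + 64 ℤ.* z) ℤ.+ + 32 ℤ.* (z ℤ.+ v) ℤ.+ + 68 ℤ.* z ≡
                     + 16 ℤ.* (q ℤ.+ q′ ℤ.+ α ℤ.* w ℤ.+ β ℤ.* w′) ℤ.+ + 32 ℤ.* v ℤ.- + 22 ℤ.* z
        ring-slack = solve-∀
        ring-slack′ : ∀ r v z → + 16 ℤ.* (r ℤ.+ r) ℤ.+ + 32 ℤ.* v ℤ.- + 22 ℤ.* z ≡ + 32 ℤ.* (r ℤ.+ v) ℤ.- + 22 ℤ.* z
        ring-slack′ = solve-∀
        ring-swap : ∀ q q′ α β w w′ → q ℤ.+ q′ ℤ.+ α ℤ.* w ℤ.+ β ℤ.* w′ ≡ q′ ℤ.+ q ℤ.+ α ℤ.* w ℤ.+ β ℤ.* w′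
        ring-swap = solve-∀
        -- With `hi`, `lo` and the corrections, 32r ≥ 2η - 4ζ - 2ζ. Since v ≥ -ζ and η ≥ 64ζ, this
        -- gives 32(r + v) ≥ 90ζ; the surplus 68ζ is dropped to reach the same bound 22ζ as on
        -- common rows.
        inside-slack : ∀ i p p′ → (∀ j → p j ℤ.+ p′ j ℤ.+ + a ℤ.* w₁ j ℤ.+ + b ℤ.* w₂ j ≡ r j ℤ.+ r j) →
                       P i ∋ + 8 • p ⊖ η i → P i ∋ + 4 • p′ ⊕ ζ i → P i ∋ + 32 • (r ⊕ v) ⊖ + 22 • ζ i
        inside-slack i p p′ p-eq hi lo = P.resp i
          (λ j → trans (ring-slack (p j) (p′ j) (+ a) (+ b) (w₁ j) (w₂ j) (ζ i j) (η i j) (v j))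
            (trans (cong (λ t → + 16 ℤ.* t ℤ.+ + 32 ℤ.* v j ℤ.- + 22 ℤ.* ζ i j) (p-eq j))
                  (ring-slack′ (r j) (v j) (ζ i j))))
          (P.add i (P.add i (P.add i (P.add i (P.add i (P.mul∈ i 2 hi) (P.mul∈ i 4 lo)) (ws i))
            (P.mul∈ i 2 (η-64ζ i))) (P.mul∈ i 32 (ζ+v i))) (P.mul∈ i 68 (ζ∈ i)))
        -- On a common row the two `low` bounds cost 4ζ each and the corrections ζ each, so 32r ≥
        -- -10ζ. There v agrees with ζ and adds 32ζ, leaving 22ζ.
        inside : ∀ i → P i ∋ + 32 • (r ⊕ v) ⊖ + 22 • ζ i
        inside i = P.stable i λ ∌ → em (S i) λ
          { (no ¬s) → ∌ (inside-slack i q q′ eq (N.high i ¬s) (N′.low i))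
          ; (yes s) → em (S′ i) λ
            { (no ¬s′) → ∌ (inside-slack i q′ q (λ j → trans (ring-swap (q′ j) (q j) (+ a) (+ b) (w₁ j) (w₂ j))
                  (eq j)) (N′.high i ¬s′) (N.low i))
            ; (yes s′) → ∌ (P.resp i
                (λ j → trans (ring-common (q j) (q′ j) (+ a) (+ b) (w₁ j) (w₂ j) (ζ i j))
                  (trans (cong (λ t → + 16 ℤ.* t ℤ.+ + 10 ℤ.* ζ i j) (eq j)) (trans (ring-common′ (r j) (ζ i j))
                    (cong (λ t → + 32 ℤ.* (r j ℤ.+ t) ℤ.- + 22 ℤ.* ζ i j) (same i s s′ j)))))
                (P.add i (P.add i (P.mul∈ i 4 (N.low i)) (P.mul∈ i 4 (N′.low i))) (ws i))) } }
        ring-drop : ∀ x z → + 32 ℤ.* x ℤ.- + 22 ℤ.* z ℤ.+ + 22 ℤ.* z ≡ + 32 ℤ.* x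
        ring-drop = solve-∀
        ring-loose : ∀ x z → + 32 ℤ.* x ℤ.- + 22 ℤ.* z ℤ.+ + 32 ℤ.* (ℤ.- x) ≡ + 22 ℤ.* (ℤ.- z)
        ring-loose = solve-∀
        pt-r : Pt r
        pt-r = double-injective (r zero) 0ℤ (trans (sym (eq zero))
              (subst₄ (Pt.unit N.pt) (Pt.unit N′.pt) (Dir.unit dir-w₁) (Dir.unit dir-w₂) ring₀))
             , double-injective (r (suc zero)) 1ℤ (trans (sym (eq (suc zero)))
                   (subst₄ (Pt.level N.pt) (Pt.level N′.pt) (Dir.level dir-w₁) (Dir.level dir-w₂) ring₁))
          where
          subst₄ : ∀ {x x′ u u′ p p′ s} → x ≡ x′ → u ≡ u′ → p ≡ 0ℤ → p′ ≡ 0ℤ →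
                   x′ ℤ.+ u′ ℤ.+ + a ℤ.* 0ℤ ℤ.+ + b ℤ.* 0ℤ ≡ s → x ℤ.+ u ℤ.+ + a ℤ.* p ℤ.+ + b ℤ.* p′ ≡ s
          subst₄ refl refl refl refl h = h
          ring₀′ : ∀ a b x → x ℤ.+ a ℤ.* 0ℤ ℤ.+ b ℤ.* 0ℤ ≡ x
          ring₀′ = solve-∀
          ring₀ : 0ℤ ℤ.+ 0ℤ ℤ.+ + a ℤ.* 0ℤ ℤ.+ + b ℤ.* 0ℤ ≡ 0ℤ ℤ.+ 0ℤ
          ring₀ = ring₀′ (+ a) (+ b) 0ℤ
          ring₁ : 1ℤ ℤ.+ 1ℤ ℤ.+ + a ℤ.* 0ℤ ℤ.+ + b ℤ.* 0ℤ ≡ 1ℤ ℤ.+ 1ℤ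
          ring₁ = ring₀′ (+ a) (+ b) (1ℤ ℤ.+ 1ℤ)
        x∈X : X (r ⊕ v)
        x∈X = pt-⊕ pt-r dir-v , λ i → P.div∈ i 31 (P.resp i (λ j → ring-drop (r j ℤ.+ v j) (ζ i j))
          (P.add i (inside i) (P.mul∈ i 22 (ζ∈ i))))
        loose : ∀ i → ¬ P i ∋ ⊝ (r ⊕ v)
        loose i t = pos-orient i (P.div∈ i 21 (P.resp i (λ j → ring-loose (r j ℤ.+ v j) (ζ i j))
          (P.add i (inside i) (P.mul∈ i 32 t))))

      -- If no common row were positive on `z₀`, the vector -z₀ would be positive on all of them,
      -- and shifting the midpoint by it would produce an interior lattice point.
      common⁺ : ∀ {q q′ S S′} → Near q S → Near q′ S′ → q ~ q′ → ¬ ¬ ∃ λ i → S i × S′ i × Pos (P i) z₀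
      common⁺ {S = S} {S′} nq nq′ q~q′ none = interior nq nq′ (midpoint q~q′) (⊝ z₀) (dir-⊝ dir-z₀) ζ⊝z₀ λ i s s′
            → go i s s′ (orient-cases i)
        where
        go : ∀ i → S i → S′ i → Oriented i → ζ i ≗ ⊝ z₀
        go i s s′ (inj₁ (p , _))  = ⊥-elim (none (i , s , s′ , p))
        go i s s′ (inj₂ (_ , eq)) = λ j → cong (λ t → t j) eq

      common⁻ : ∀ {q q′ S S′} → Near q S → Near q′ S′ → q ~ q′ → ¬ ¬ ∃ λ i → S i × S′ i × ¬ P i ∋ z₀
      common⁻ {S = S} {S′} nq nq′ q~q′ none = interior nq nq′ (midpoint q~q′) z₀ dir-z₀ ζ+z₀ λ i s s′ → go i s s′
            (orient-cases i)
        where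
        go : ∀ i → S i → S′ i → Oriented i → ζ i ≗ z₀
        go i s s′ (inj₂ (n , _))  = ⊥-elim (none (i , s , s′ , n))
        go i s s′ (inj₁ (_ , eq)) = λ j → cong (λ t → t j) eq

      three-tight : ∀ {k l m} → k ≢ l → l ≢ m → k ≢ m →
                    (∃ λ i → (Tight k i × Tight l i) × Tight m i × Pos (P i) z₀) →
                    (∃ λ j → (Tight k j × Tight l j) × Tight m j × ¬ P j ∋ z₀) → ⊥
      three-tight k≢l l≢m k≢m (i , (ki , li) , mi , pi) (j , (kj , lj) , mj , nj) =
        three-share k≢l l≢m k≢m (λ i≡j → nj (subst (λ r → P r ∋ z₀) i≡j (pos∈ (P i) pi))) ki li mi kj lj mj

      -- Pairwise intersecting subsets of a two-element set have a common element.
      helly : ∀ {Q : Fin 4 → Set} {a b} → (∀ {i} → Q i → i ≡ a ⊎ i ≡ b) → ∀ {k l m} →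
              (∃ λ i → Tight k i × Tight l i × Q i) → (∃ λ i → Tight l i × Tight m i × Q i) →
              (∃ λ i → Tight k i × Tight m i × Q i) → ∃ λ i → (Tight k i × Tight l i) × Tight m i × Q i
      helly {Q} {a} {b} two {k} {l} {m} (i₁ , ki₁ , li₁ , q₁) (i₂ , li₂ , mi₂ , q₂) (i₃ , ki₃ , mi₃ , q₃) =
          pick (two-of-three rows λ { zero → two q₁ ; (suc zero) → two q₂ ; (suc (suc zero)) → two q₃ })
        where
        rows : Fin 3 → Fin 4
        rows zero             = i₁
        rows (suc zero)       = i₂
        rows (suc (suc zero)) = i₃
        pick : i₁ ≡ i₂ ⊎ i₂ ≡ i₃ ⊎ i₁ ≡ i₃ → ∃ λ i → (Tight k i × Tight l i) × Tight m i × Q i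
        pick (inj₁ eq)        = i₁ , (ki₁ , li₁) , subst (Tight m) (sym eq) mi₂ , q₁
        pick (inj₂ (inj₁ eq)) = i₂ , (subst (Tight k) (sym eq) ki₃ , li₂) , mi₂ , q₂
        pick (inj₂ (inj₂ eq)) = i₁ , (ki₁ , li₁) , subst (Tight m) (sym eq) mi₃ , q₁

      -- Each of the three pairs shares a positive and a negative row. There are only two rows of
      -- each sign, so `helly` merges them into one row of each sign tight at all three points.
      no-triple : ∀ {k l m} → k ≢ l → l ≢ m → k ≢ m → y k ~ y l → y l ~ y m → ⊥
      no-triple {k} {l} {m} k≢l l≢m k≢m k~l l~m =
        common⁺ (near-y k) (near-y l) k~l λ kl⁺ → common⁻ (near-y k) (near-y l) k~l λ kl⁻ →
        common⁺ (near-y l) (near-y m) l~m λ lm⁺ → common⁻ (near-y l) (near-y m) l~m λ lm⁻ →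
        common⁺ (near-y k) (near-y m) (~-trans k~l l~m) λ km⁺ → common⁻ (near-y k) (near-y m) (~-trans k~l l~m)
              λ km⁻ →
        three-tight k≢l l≢m k≢m (helly {λ i → Pos (P i) z₀} is⁺ kl⁺ lm⁺ km⁺)
              (helly {λ i → ¬ P i ∋ z₀} is⁻ kl⁻ lm⁻ km⁻)

      record Splitting (k l : Fin 5) : Set where
        field
          q    : W
          near : Near q (λ i → Tight k i × Tight l i)
          sep  : ∀ m → ¬ q ~ y m

      -- A functional orthogonal to `w₁` and `w₂` but not to the edge measures the walk, which stops
      -- outside the class of `y k` and `y l`. A third point congruent to q would share two tight
      -- rows with both ends of the edge.
      split : ∀ {k l} → k ≢ l → y k ~ y l → ¬ ¬ Splitting k l
      split {k} {l} k≢l k~l = do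
        (i , ki , li , _) ← common⁺ (near-y k) (near-y l) k~l
        let (φ , φw₁ , φw₂ , φg) = orthogonal (ind k≢l i ki li)
        (q , between , q≁) ← Walk.separate k~l φ φw₁ φw₂ (φg ∘ trans (dot-⊖ φ (y l) (y k)))
        let near = near-between {k} {l} between
        return (record { q = q ; near = near ; sep = λ m q~m → apart near q≁ m q~m (m Fin.≟ k) (m Fin.≟ l) })
        where
        apart : ∀ {q} → Near q (λ i → Tight k i × Tight l i) → ¬ q ~ y k → ∀ m → q ~ y m → Dec (m ≡ k) → Dec
              (m ≡ l) → ⊥
        apart {q} near q≁ m q~m (yes m≡k) _ = q≁ (subst (λ t → q ~ y t) m≡k q~m)
        apart {q} near q≁ m q~m (no _) (yes m≡l) = q≁ (~-trans (subst (λ t → q ~ y t) m≡l q~m) (~-sym k~l))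
        apart {q} near q≁ m q~m (no m≢k) (no m≢l) =
          common⁺ near (near-y m) q~m λ r⁺ → common⁻ near (near-y m) q~m λ r⁻ →
          three-tight k≢l (m≢l ∘ sym) (m≢k ∘ sym) r⁺ r⁻

      -- Congruent q and q′ would share rows of both signs, and these are tight at k, l and k′.
      splittings-apart : ∀ {k l k′ l′} (S : Splitting k l) (S′ : Splitting k′ l′) →
                         k ≢ l → l ≢ k′ → k ≢ k′ → ¬ Splitting.q S ~ Splitting.q S′
      splittings-apart S S′ k≢l l≢k′ k≢k′ q~q′ =
        common⁺ (Splitting.near S) (Splitting.near S′) q~q′ λ (i , kl , (k′i , _) , p) →
        common⁻ (Splitting.near S) (Splitting.near S′) q~q′ λ (j , kl′ , (k′j , _) , n) →
        three-tight k≢l l≢k′ k≢k′ (i , kl , k′i , p) (j , kl′ , k′j , n)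

      replace : Fin 5 → W → (Fin 5 → W) → Fin 5 → W
      replace l q p m = if does (m Fin.≟ l) then q else p m

      replace-≡ : ∀ l q p {m} → m ≡ l → replace l q p m ≡ q
      replace-≡ l q p {m} m≡l = cong (if_then q else p m) (dec-true (m Fin.≟ l) m≡l)

      replace-≢ : ∀ l q p {m} → m ≢ l → replace l q p m ≡ p m
      replace-≢ l q p {m} m≢l = cong (if_then q else p m) (dec-false (m Fin.≟ l) m≢l)

      replace-pt : ∀ {l q p} → Pt q → (∀ m → Pt (p m)) → ∀ m → Pt (replace l q p m)
      replace-pt {l} {q} {p} pt-q pt-p m = go (m Fin.≟ l)
        where
        go : Dec (m ≡ l) → Pt (replace l q p m)
        go (yes m≡l) = subst Pt (sym (replace-≡ l q p m≡l)) pt-q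
        go (no m≢l)  = subst Pt (sym (replace-≢ l q p m≢l)) (pt-p m)

      replace-~ : ∀ {l q p} → (∀ m → m ≢ l → ¬ q ~ p m) → ∀ {m m′} → m ≢ m′ →
                  replace l q p m ~ replace l q p m′ → (m ≢ l × m′ ≢ l) × p m ~ p m′
      replace-~ {l} {q} {p} apart {m} {m′} m≢m′ h = go (m Fin.≟ l) (m′ Fin.≟ l)
        where
        go : Dec (m ≡ l) → Dec (m′ ≡ l) → (m ≢ l × m′ ≢ l) × p m ~ p m′
        go (yes m≡l) (yes m′≡l) = ⊥-elim (m≢m′ (trans m≡l (sym m′≡l)))
        go (yes m≡l) (no m′≢l)  = ⊥-elim (apart m′ m′≢l (subst₂ _~_ (replace-≡ l q p m≡l) (replace-≢ l q p m′≢l) h))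
        go (no m≢l)  (yes m′≡l) = ⊥-elim (apart m m≢l (~-sym
              (subst₂ _~_ (replace-≢ l q p m≢l) (replace-≡ l q p m′≡l) h)))
        go (no m≢l)  (no m′≢l)  = (m≢l , m′≢l) , subst₂ _~_ (replace-≢ l q p m≢l) (replace-≢ l q p m′≢l) h

      apart-replaced : ∀ {l q q′} → ¬ q′ ~ q → (∀ m → ¬ q′ ~ y m) → ∀ m → ¬ q′ ~ replace l q y m
      apart-replaced {l} {q} {q′} q′≁q q′≁y m h = go (m Fin.≟ l)
        where
        go : Dec (m ≡ l) → ⊥
        go (yes m≡l) = q′≁q (subst (q′ ~_) (replace-≡ l q y m≡l) h)
        go (no m≢l)  = q′≁y m (subst (q′ ~_) (replace-≢ l q y m≢l) h)

      -- An index common to both pairs would join them into a congruent triple.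
      disjoint : ∀ {k l m m′} → k ≢ l → y k ~ y l → m ≢ m′ → m ≢ l → m′ ≢ l → y m ~ y m′ → m ≢ k × m′ ≢ k
      disjoint {k} {l} {m} {m′} k≢l k~l m≢m′ m≢l m′≢l m~m′ =
        (λ m≡k → no-triple (k≢l ∘ sym) (λ k≡m′ → m≢m′ (trans m≡k k≡m′)) (m′≢l ∘ sym)
                   (~-sym k~l) (subst (λ t → y t ~ y m′) m≡k m~m′)) ,
        (λ m′≡k → no-triple (k≢l ∘ sym) (λ k≡m → m≢m′ (trans (sym k≡m) (sym m′≡k))) (m≢l ∘ sym)
                   (~-sym k~l) (~-sym (subst (λ t → y m ~ y t) m′≡k m~m′)))

      -- The replacing points are congruent to no other point of the family, so each application of
      -- the pigeonhole principle returns a pair of original points disjoint from the earlier pairs.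
      -- The third pair brings the count of distinct indices to six.
      contradiction₄ : ⊥
      contradiction₄ =
        let (k , l , k≢l , k~l) = parity-pigeonhole dir-w₁ dir-w₂ mod2 y (λ m → proj₁ (y∈X m))
        in split k≢l k~l λ S →
        let open Splitting S
            p₁ = replace l q y
            pt₁ = replace-pt {l} {q} {y} (Near.pt near) (λ m → proj₁ (y∈X m))
            (k′ , l′ , k′≢l′ , h₁) = parity-pigeonhole dir-w₁ dir-w₂ mod2 p₁ pt₁
            ((k′≢l , l′≢l) , k′~l′) = replace-~ {l} {q} {y} (λ m _ → sep m) k′≢l′ h₁
            (k′≢k , l′≢k) = disjoint k≢l k~l k′≢l′ k′≢l l′≢l k′~l′
        in split k′≢l′ k′~l′ λ S′ →
        let q′ = Splitting.q S′
            apart = apart-replaced (splittings-apart S S′ k≢l (k′≢l ∘ sym) (k′≢k ∘ sym) ∘ ~-sym) (Splitting.sep S′)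
            (m , m′ , m≢m′ , h₂) = parity-pigeonhole dir-w₁ dir-w₂ mod2 (replace l′ q′ p₁)
                                     (replace-pt {l′} {q′} {p₁} (Near.pt (Splitting.near S′)) pt₁)
            ((m≢l′ , m′≢l′) , h₃) = replace-~ {l′} {q′} {p₁} (λ m _ → apart m) m≢m′ h₂
            ((m≢l , m′≢l) , m~m′) = replace-~ {l} {q} {y} (λ m _ → sep m) m≢m′ h₃
            (m≢k , m′≢k) = disjoint k≢l k~l m≢m′ m≢l m′≢l m~m′
            (m≢k′ , m′≢k′) = disjoint k′≢l′ k′~l′ m≢m′ m≢l′ m′≢l′ m~m′
        in no-six ((k≢l ∷ k′≢k ∘ sym ∷ l′≢k ∘ sym ∷ m≢k ∘ sym ∷ m′≢k ∘ sym ∷ []) ∷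
                   (k′≢l ∘ sym ∷ l′≢l ∘ sym ∷ m≢l ∘ sym ∷ m′≢l ∘ sym ∷ []) ∷
                   (k′≢l′ ∷ m≢k′ ∘ sym ∷ m′≢k′ ∘ sym ∷ []) ∷
                   (m≢l′ ∘ sym ∷ m′≢l′ ∘ sym ∷ []) ∷ (m≢m′ ∷ []) ∷ [] ∷ [])

    -- The properties of a pair of short vectors that survive halving; it is the relation along
    -- which `saturate` descends.
    record Admissible (u v : W) : Set where
      field
        dir-u   : Dir u
        dir-v   : Dir v
        small-u : ∀ i → Small (P i) (ζ i) (+ 16 • u)
        small-v : ∀ i → Small (P i) (ζ i) (+ 16 • v)
        ind     : ∀ {k l} → k ≢ l → ∀ i → Tight k i → Tight l i → Ind3 (y l ⊖ y k) u v

    swap-admissible : ∀ {u v} → Admissible u v → Admissible v u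
    swap-admissible {u} {v} r = record
      { dir-u = dir-v ; dir-v = dir-u ; small-u = small-v ; small-v = small-u
      ; ind = λ {k} {l} k≢l i ki li a b c h →
          let (a≡0 , c≡0 , b≡0) = ind k≢l i ki li a c b λ j → trans (ring a b c (y l j ℤ.- y k j) (u j) (v j)) (h j)
          in a≡0 , b≡0 , c≡0 }
      where
      open Admissible r
      ring : ∀ a b c g u v → a ℤ.* g ℤ.+ c ℤ.* u ℤ.+ b ℤ.* v ≡ a ℤ.* g ℤ.+ b ℤ.* v ℤ.+ c ℤ.* u
      ring = solve-∀

    small-half : ∀ i {u v w} → Small (P i) (ζ i) (+ 16 • u) → Small (P i) (ζ i) (+ 16 • v) → u ⊕ v ≗ w ⊕ w →
                 Small (P i) (ζ i) (+ 16 • w)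
    small-half i {u} {v} {w} (u⁺ , u⁻) (v⁺ , v⁻) h =
        (λ p → u⁺ (P.stable i λ u∌ → v⁺ (P.resp i (λ j → cancel⁺ (u j) (v j) (w j) (ζ i j) (h j))
              (P.add i (P.add i p p) (P.total i u∌))))) ,
        (λ p → u⁻ (P.stable i λ u∌ → v⁻ (P.resp i (λ j → cancel⁻ (u j) (v j) (w j) (ζ i j) (h j))
              (P.add i (P.add i p p) (P.total i u∌)))))
      where
      ring : ∀ u v w z → (+ 16 ℤ.* w ℤ.- z) ℤ.+ (+ 16 ℤ.* w ℤ.- z) ℤ.+ ℤ.- (+ 16 ℤ.* u ℤ.- z) ≡ + 16 ℤ.* (w ℤ.+ w)
            ℤ.- + 16 ℤ.* u ℤ.- z
      ring = solve-∀
      ring′ : ∀ u v z → + 16 ℤ.* (u ℤ.+ v) ℤ.- + 16 ℤ.* u ℤ.- z ≡ + 16 ℤ.* v ℤ.- z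
      ring′ = solve-∀
      cancel⁺ : ∀ u v w z → u ℤ.+ v ≡ w ℤ.+ w → (+ 16 ℤ.* w ℤ.- z) ℤ.+ (+ 16 ℤ.* w ℤ.- z) ℤ.+ ℤ.-
            (+ 16 ℤ.* u ℤ.- z) ≡ + 16 ℤ.* v ℤ.- z
      cancel⁺ u v w z eq = trans (ring u v w z) (trans (cong (λ t → + 16 ℤ.* t ℤ.- + 16 ℤ.* u ℤ.- z) (sym eq))
            (ring′ u v z))
      ring⁻ : ∀ u v w z → (ℤ.- (+ 16 ℤ.* w) ℤ.- z) ℤ.+ (ℤ.- (+ 16 ℤ.* w) ℤ.- z) ℤ.+ ℤ.- (ℤ.- (+ 16 ℤ.* u) ℤ.- z) ≡
            ℤ.- (+ 16 ℤ.* (w ℤ.+ w)) ℤ.+ + 16 ℤ.* u ℤ.- z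
      ring⁻ = solve-∀
      ring⁻′ : ∀ u v z → ℤ.- (+ 16 ℤ.* (u ℤ.+ v)) ℤ.+ + 16 ℤ.* u ℤ.- z ≡ ℤ.- (+ 16 ℤ.* v) ℤ.- z
      ring⁻′ = solve-∀
      cancel⁻ : ∀ u v w z → u ℤ.+ v ≡ w ℤ.+ w → (ℤ.- (+ 16 ℤ.* w) ℤ.- z) ℤ.+ (ℤ.- (+ 16 ℤ.* w) ℤ.- z) ℤ.+ ℤ.-
            (ℤ.- (+ 16 ℤ.* u) ℤ.- z) ≡ ℤ.- (+ 16 ℤ.* v) ℤ.- z
      cancel⁻ u v w z eq = trans (ring⁻ u v w z) (trans
            (cong (λ t → ℤ.- (+ 16 ℤ.* t) ℤ.+ + 16 ℤ.* u ℤ.- z) (sym eq)) (ring⁻′ u v z))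

    dir-half : ∀ {v w : W} → Dir v → v ≗ w ⊕ w → Dir w
    dir-half {v} {w} (p , q) h = double-injective (w zero) 0ℤ (trans (sym (h zero)) p)
                               , double-injective (w (suc zero)) 0ℤ (trans (sym (h (suc zero))) q)

    private
      2a≡0 : ∀ a → a ℤ.+ a ≡ 0ℤ → a ≡ 0ℤ
      2a≡0 a h = double-injective a 0ℤ h

    half-admissible : ∀ {u v w} → Admissible u v → u ≗ w ⊕ w → Admissible w v
    half-admissible {u} {v} {w} r h = record
      { dir-u = dir-half dir-u h ; dir-v = dir-v ; small-v = small-v
      ; small-u = λ i → small-half i {u} {𝟘} {w} (small-u i) (small-𝟘 i) (λ j → trans (ℤ.+-identityʳ (u j)) (h j))
      ; ind = λ {k} {l} k≢l i ki li a b c eq →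
          let (a≡0 , b≡0 , c≡0) = ind k≢l i ki li (a ℤ.+ a) b (c ℤ.+ c) λ j →
                trans (cong (λ t → (a ℤ.+ a) ℤ.* (y l j ℤ.- y k j) ℤ.+ b ℤ.* t ℤ.+ (c ℤ.+ c) ℤ.* v j) (h j))
                  (trans (ring a b c (y l j ℤ.- y k j) (w j) (v j)) (cong (λ t → t ℤ.+ t) (eq j)))
          in 2a≡0 a a≡0 , b≡0 , 2a≡0 c c≡0 }
      where
      open Admissible r
      small-𝟘 : ∀ i → Small (P i) (ζ i) (+ 16 • 𝟘)
      small-𝟘 i = (λ p → pos-orient i (P.resp i (λ j → ℤ.+-identityˡ (ℤ.- ζ i j)) p))
                , (λ p → pos-orient i (P.resp i (λ j → ℤ.+-identityˡ (ℤ.- ζ i j)) p))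
      ring : ∀ a b c g w v → (a ℤ.+ a) ℤ.* g ℤ.+ b ℤ.* (w ℤ.+ w) ℤ.+ (c ℤ.+ c) ℤ.* v ≡
             (a ℤ.* g ℤ.+ b ℤ.* w ℤ.+ c ℤ.* v) ℤ.+ (a ℤ.* g ℤ.+ b ℤ.* w ℤ.+ c ℤ.* v)
      ring = solve-∀

    half⁺-admissible : ∀ {u v w} → Admissible u v → u ⊕ v ≗ w ⊕ w → Admissible w v
    half⁺-admissible {u} {v} {w} r h = record
      { dir-u = dir-half {u ⊕ v} (cong₂ ℤ._+_ (Dir.unit dir-u) (Dir.unit dir-v) , cong₂ ℤ._+_ (Dir.level dir-u)
            (Dir.level dir-v)) h
      ; dir-v = dir-v ; small-v = small-v
      ; small-u = λ i → small-half i {u} {v} {w} (small-u i) (small-v i) h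
      ; ind = λ {k} {l} k≢l i ki li a b c eq →
          -- With 2w = u + v, twice a·g + b·w + c·v is 2a·g + b·u + (b + 2c)·v.
          let (a≡0 , b≡0 , bc≡0) = ind k≢l i ki li (a ℤ.+ a) b (b ℤ.+ (c ℤ.+ c)) λ j →
                trans (ring₁ a b c (y l j ℤ.- y k j) (u j) (v j))
                  (trans (cong (λ t → (a ℤ.+ a) ℤ.* (y l j ℤ.- y k j) ℤ.+ b ℤ.* t ℤ.+ (c ℤ.+ c) ℤ.* v j) (h j))
                  (trans (ring a b c (y l j ℤ.- y k j) (w j) (v j)) (cong (λ t → t ℤ.+ t) (eq j))))
          in 2a≡0 a a≡0 , b≡0 , 2a≡0 c (trans (sym (ℤ.+-identityˡ (c ℤ.+ c)))
                (trans (cong (ℤ._+ (c ℤ.+ c)) (sym b≡0)) bc≡0)) }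
      where
      open Admissible r
      ring₁ : ∀ a b c g u v → (a ℤ.+ a) ℤ.* g ℤ.+ b ℤ.* u ℤ.+ (b ℤ.+ (c ℤ.+ c)) ℤ.* v ≡ (a ℤ.+ a) ℤ.* g ℤ.+ b ℤ.*
            (u ℤ.+ v) ℤ.+ (c ℤ.+ c) ℤ.* v
      ring₁ = solve-∀
      ring : ∀ a b c g w v → (a ℤ.+ a) ℤ.* g ℤ.+ b ℤ.* (w ℤ.+ w) ℤ.+ (c ℤ.+ c) ℤ.* v ≡
             (a ℤ.* g ℤ.+ b ℤ.* w ℤ.+ c ℤ.* v) ℤ.+ (a ℤ.* g ℤ.+ b ℤ.* w ℤ.+ c ℤ.* v)
      ring = solve-∀

    tight-row : ∀ k → ∃ (Tight k)
    tight-row k = go (Fin.any? (tight? k))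
      where
      go : Dec (∃ (Tight k)) → ∃ (Tight k)
      go (yes t) = t
      go (no ¬t) = ⊥-elim (one-sided dir-z₀ (lin-g≢0 c₀ c₀≢0) small-z₀ k λ i t → ⊥-elim (¬t (i , t)))

    -- Five points each have a tight row among four, so two points share one. For this pair `ind`
    -- applies; it makes u and v independent and starts the halving with a nonzero minor.
    contradiction-admissible : ∀ {u v} → Admissible u v → ⊥
    contradiction-admissible {u} {v} r =
      let (k , l , k<l , eq) = Fin.pigeonhole (ℕ.n<1+n 4) (λ k → proj₁ (tight-row k))
          (i , j , m≢0) = nonzero-minor {u = u} {v} λ b c h → proj₂
                (Admissible.ind r (Fin.<⇒≢ k<l) (proj₁ (tight-row k))
            (proj₂ (tight-row k)) (subst (Tight l) (sym eq) (proj₂ (tight-row l))) 0ℤ b c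
            λ j → trans (ring (y l j ℤ.- y k j) (b ℤ.* u j) (c ℤ.* v j)) (h j))
          open Saturate Admissible swap-admissible half-admissible half⁺-admissible i j
      in saturate ℤ.∣ minor u v ∣ u v r m≢0 ℕ.≤-refl λ (w₁ , w₂ , r′ , mod2) →
         let open Admissible r′ in
         Parity.contradiction₄ w₁ w₂ dir-u dir-v small-u small-v ind mod2
      where
      ring : ∀ g x y → 0ℤ ℤ.* g ℤ.+ x ℤ.+ y ≡ x ℤ.+ y
      ring = solve-∀

    module Shorter (Z₁ : LatticeVec ζ 15) (S₁ : Signed (LatticeVec.z Z₁)) where
      module S₁ = Signed S₁

      z₁ : W
      z₁ = LatticeVec.z Z₁

      ζ₁≤ζ : ∀ i → P i ∋ ζ i ⊖ S₁.orient i
      ζ₁≤ζ i = go (S₁.orient-cases i)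
        where
        s : Small (P i) (ζ i) z₁
        s = small-resp (P i) (λ j → ℤ.*-identityˡ (z₁ j))
              (small-∣ (P i) {1} {16} (s≤s z≤n) (pos-orient i) (LatticeVec.small Z₁ i))
        go : S₁.Oriented i → P i ∋ ζ i ⊖ S₁.orient i
        go (inj₁ (_ , eq)) = subst (λ t → P i ∋ ζ i ⊖ t) (sym eq) (small⁻ (P i) s)
        go (inj₂ (_ , eq)) = subst (λ t → P i ∋ ζ i ⊖ t) (sym eq)
          (P.resp i (λ j → cong (ℤ._+_ (ζ i j)) (sym (ℤ.neg-involutive (z₁ j)))) (small⁺ (P i) s))

      -- The multiplier required in `small⇒ind3` when the edge from k to l plays the role of g.
      D : Fin 5 → Fin 5 → ℕ
      D k l = ℤ.∣ dot (proj (y l ⊖ y k) z₁) z₁ ∣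

      D-bound : ∃ λ B → ∀ k l → D k l ℕ.≤ B
      D-bound =
        let row = λ k → fin-bound (D k)
            all = fin-bound (λ k → proj₁ (row k))
        in proj₁ all , λ k l → ℕ.≤-trans (proj₂ (row k) l) (proj₂ all k)

      -- The 16 makes the second vector as short as the first one is required to be; the rest
      -- exceeds the multipliers of all edges at once.
      s : ℕ
      s = 16 ℕ.+ proj₁ D-bound

      finish : LatticeVec S₁.orient s → ⊥
      finish Z₂ = signs (LatticeVec.c Z₂) (LatticeVec.c≢0 Z₂) small-η λ S₂ → contradiction-admissible (record
        { dir-u = LatticeVec.dir Z₁ ; dir-v = LatticeVec.dir Z₂
        ; small-u = LatticeVec.small Z₁ ; small-v = small-ζ
        ; ind = λ {k} {l} k≢l i ki li → small⇒ind3 (P i) {s = suc s} (distinct (k≢l ∘ sym))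
            (diff-null {k} {l} i ki li)
            (S₁.not-null i) (Signed.not-null S₂ i) (proj₁ (S₁.sign-orient i)) (proj₂ (S₁.sign-orient i))
                  (S₁.pos-orient i)
            (ℕ.≤-trans (proj₂ D-bound k l) (ℕ.m≤n+m (proj₁ D-bound) 17)) (LatticeVec.small Z₂ i) })
        where
        small-ζ : ∀ i → Small (P i) (ζ i) (+ 16 • LatticeVec.z Z₂)
        small-ζ i = small-mono (P i) (ζ₁≤ζ i) (small-∣ (P i) {16} {suc s}
              (ℕ.m≤n⇒m≤1+n (ℕ.m≤m+n 16 (proj₁ D-bound))) (S₁.pos-orient i) (LatticeVec.small Z₂ i))
        small-η : ∀ i → Small (P i) (η i) (LatticeVec.z Z₂)
        small-η i = small-mono (P i) (η-ζ i) (small-resp (P i) (λ j → ℤ.*-identityˡ (LatticeVec.z Z₂ j))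
          (small-∣ (P i) {1} {16} (s≤s z≤n) (pos-orient i) (small-ζ i)))

    shorten : LatticeVec ζ 15 → ⊥
    shorten Z₁ = signs (LatticeVec.c Z₁) (LatticeVec.c≢0 Z₁)
        (λ i → small-mono (P i) (η-ζ i) (small-resp (P i) (λ j → ℤ.*-identityˡ (LatticeVec.z Z₁ j))
          (small-∣ (P i) {1} {16} (s≤s z≤n) (pos-orient i) (LatticeVec.small Z₁ i)))) λ S₁ →
      let open Shorter Z₁ S₁ in
      lattice-vec P xs complete th y y∈X indep S₁.orient S₁.pos-orient s finish

  impossible₄ : ⊥
  impossible₄ = lattice-vec P xs complete th y y∈X indep η pos 63 λ Z₀ →
    signs (LatticeVec.c Z₀) (LatticeVec.c≢0 Z₀)
      (λ i → small-resp (P i) (λ j → ℤ.*-identityˡ (LatticeVec.z Z₀ j))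
        (small-∣ (P i) {1} {64} (s≤s z≤n) (pos i) (LatticeVec.small Z₀ i))) λ S₀ →
    let open Scale (LatticeVec.c Z₀) (LatticeVec.c≢0 Z₀) (LatticeVec.small Z₀) S₀ in
    lattice-vec P xs complete th y y∈X indep ζ pos-ζ 15 shorten

-- The lower bound

-- At most one row remains beside two distinct ones. This holds for d ≤ 3 and fails for d = 4, which
-- separates the easy dimensions from the hard one.
ThirdRow : ℕ → Set
ThirdRow d = ∀ (i j : Fin d) → i ≡ j ⊎ ∃ λ r → ∀ l → l ≡ r ⊎ (l ≡ i ⊎ l ≡ j)

third-row? : ∀ d → Dec (ThirdRow d)
third-row? d = Fin.all? λ (i : Fin d) → Fin.all? λ (j : Fin d) → i Fin.≟ j ⊎-dec
  Fin.any? λ (r : Fin d) → Fin.all? λ (l : Fin d) → l Fin.≟ r ⊎-dec (l Fin.≟ i ⊎-dec l Fin.≟ j)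

module _ {k} (P : Fin (suc k) → Cone (suc (suc (suc k)))) where
  open Polyhedron P

  module FewRows (third : ThirdRow (suc k)) (xs : List W) (complete : Complete xs) (th : Threshold)
                 (y : Fin (suc (suc k)) → W) (y∈X : ∀ k → X (y k)) (indep : Indep y) where
    open Threshold th
    open Bounded xs complete th
    open Points y y∈X indep

    -- A short vector forces two tight rows at every point, so at most one row per point is an
    -- exception, against `not-all-but-one`.
    impossible : ⊥
    impossible = (¬¬-Π λ k → ¬¬-Π λ i → em (Tight k i)) λ tight? →
      lattice-vec P xs complete th y y∈X indep η pos 0 λ Z →
      (¬¬-Π λ i → em (P i ∋ LatticeVec.z Z)) λ z∈? →
      (¬¬-Π λ i → em (P i ∋ ⊝ LatticeVec.z Z)) λ ⊝z∈? →
      let open Signs tight? (LatticeVec.dir Z) (LatticeVec.z≢0 Z)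
                 (λ i → small-resp (P i) (λ j → ℤ.*-identityˡ (LatticeVec.z Z j)) (LatticeVec.small Z i)) z∈? ⊝z∈?
      in not-all-but-one λ k → let (i , j , i≢j , ti , tj) = two-rows k in all-but k i≢j ti tj (third i j)
      where
      all-but : ∀ k {i j} → i ≢ j → Tight k i → Tight k j →
                i ≡ j ⊎ (∃ λ r → ∀ l → l ≡ r ⊎ (l ≡ i ⊎ l ≡ j)) → ∃ λ r → ∀ l → l ≢ r → Tight k l
      all-but k i≢j ti tj (inj₁ i≡j) = ⊥-elim (i≢j i≡j)
      all-but k {i} {j} i≢j ti tj (inj₂ (r , cover)) = r , λ l l≢r → pick l≢r (cover l)
        where
        pick : ∀ {l} → l ≢ r → l ≡ r ⊎ (l ≡ i ⊎ l ≡ j) → Tight k l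
        pick l≢r (inj₁ l≡r)        = ⊥-elim (l≢r l≡r)
        pick l≢r (inj₂ (inj₁ l≡i)) = subst (Tight k) (sym l≡i) ti
        pick l≢r (inj₂ (inj₂ l≡j)) = subst (Tight k) (sym l≡j) tj

too-few-inequalities : ∀ d → 1 ℕ.≤ d → d ℕ.≤ 4 → (P : Fin d → Cone (suc (suc d))) → let open Polyhedron P in
  ∀ xs → Complete xs → (∀ i → ∃ (Pos (P i))) → (y : Fin (suc d) → W) → (∀ k → X (y k)) → Indep y → ⊥
too-few-inequalities 1 _ _ P xs complete one y y∈X indep = Polyhedron.threshold P xs complete one λ th →
  FewRows.impossible P (from-yes (third-row? 1)) xs complete th y y∈X indep
too-few-inequalities 2 _ _ P xs complete one y y∈X indep = Polyhedron.threshold P xs complete one λ th →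
  FewRows.impossible P (from-yes (third-row? 2)) xs complete th y y∈X indep
too-few-inequalities 3 _ _ P xs complete one y y∈X indep = Polyhedron.threshold P xs complete one λ th →
  FewRows.impossible P (from-yes (third-row? 3)) xs complete th y y∈X indep
too-few-inequalities 4 _ _ P xs complete one y y∈X indep = Polyhedron.threshold P xs complete one λ th →
  (¬¬-Π λ k → ¬¬-Π λ i → em (P i ∋ ⊝ y k)) λ tight? → Dim4.impossible₄ P xs complete th y y∈X indep tight?
too-few-inequalities (suc (suc (suc (suc (suc d))))) _ (s≤s (s≤s (s≤s (s≤s ())))) P xs complete one y y∈X indep

-- Systems of linear inequalities as cones

lift : ∀ {d} → LatticePoint d → V (suc (suc d))
lift x zero    = 0ℤ
lift x (suc j) = homog x j

module Inequality {d} (a : Point d) (β : ℝ) where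
  -- The functional is β - a·x on lifted points. Coordinate 0, absent from points, has weight 1 so
  -- that even a row with a = 0 and β = 0 has a positive vector from which a threshold can start.
  coef : Fin (suc (suc d)) → ℝ
  coef zero          = 1ℝ
  coef (suc zero)    = β
  coef (suc (suc j)) = fromℚ (ℚ.- 1ℚ) * a j

  open Functional coef

  cone : Cone (suc (suc d))
  cone = halfspace

  value-lift : ∀ x k → seq (value (lift x)) k ≡ seq β k ℚ.- seq (a ⟨·⟩ ι x) k
  value-lift x k = begin
      1ℚ ℚ.* int 0ℤ ℚ.+ (seq β k ℚ.* int 1ℤ ℚ.+ seq (sum λ j → fromℚ (ℚ.- 1ℚ) * a j * fromℤ (lookup x j)) k)
        ≡⟨ cong (λ t → 1ℚ ℚ.* int 0ℤ ℚ.+ (seq β k ℚ.* int 1ℤ ℚ.+ t))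
              (seq-sum (λ j → fromℚ (ℚ.- 1ℚ) * a j * fromℤ (lookup x j)) k) ⟩
      1ℚ ℚ.* 0ℚ ℚ.+ (seq β k ℚ.* 1ℚ ℚ.+ ∑ℚ.sum (λ j → ℚ.- 1ℚ ℚ.* seq (a j) k ℚ.* int (lookup x j)))
        ≡⟨ cong (λ t → 1ℚ ℚ.* 0ℚ ℚ.+ (seq β k ℚ.* 1ℚ ℚ.+ t)) (trans
             (∑ℚ.sum-cong-≗ {d} λ j → ℚ.*-assoc (ℚ.- 1ℚ) (seq (a j) k) (int (lookup x j)))
             (sym (∑ℚ.*-distribˡ-sum (ℚ.- 1ℚ) λ j → seq (a j) k ℚ.* int (lookup x j)))) ⟩
      1ℚ ℚ.* 0ℚ ℚ.+ (seq β k ℚ.* 1ℚ ℚ.+ ℚ.- 1ℚ ℚ.* ∑ℚ.sum (λ j → seq (a j) k ℚ.* int (lookup x j)))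
        ≡⟨ cong (λ t → 1ℚ ℚ.* 0ℚ ℚ.+ (seq β k ℚ.* 1ℚ ℚ.+ ℚ.- 1ℚ ℚ.* t)) (sym (seq-sum (λ j → a j * ι x j) k)) ⟩
      1ℚ ℚ.* 0ℚ ℚ.+ (seq β k ℚ.* 1ℚ ℚ.+ ℚ.- 1ℚ ℚ.* seq (a ⟨·⟩ ι x) k)
        ≡⟨ eq (seq β k) (seq (a ⟨·⟩ ι x) k) ⟩
      seq β k ℚ.- seq (a ⟨·⟩ ι x) k ∎
    where
    open ≡-Reasoning
    open +-*-Solver
    eq : ∀ b s → 1ℚ ℚ.* 0ℚ ℚ.+ (b ℚ.* 1ℚ ℚ.+ ℚ.- 1ℚ ℚ.* s) ≡ b ℚ.- s
    eq = solve 2 (λ b s → con 1ℚ :* con 0ℚ :+ (b :* con 1ℚ :+ :- con 1ℚ :* s) := b :- s) refl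

  private
    shift : ∀ b s e → (b ℚ.- s) ℚ.+ e ≡ (b ℚ.+ e) ℚ.- s
    shift = solve 3 (λ b s e → (b :- s) :+ e := (b :+ e) :- s) refl
      where open +-*-Solver

  ≤⇒∈ : ∀ x → a ⟨·⟩ ι x ≤ β → cone ∋ lift x
  ≤⇒∈ x h = nonNeg-resp (λ k → sym (value-lift x k)) λ ε 0<ε →
    let (N , p) = h ε 0<ε in N , λ n n≥ →
    subst (0ℚ ℚ.≤_) (sym (shift (seq β n) (seq (a ⟨·⟩ ι x) n) ε)) (0≤∸ (p n n≥))

  ∈⇒≤ : ∀ x → cone ∋ lift x → a ⟨·⟩ ι x ≤ β
  ∈⇒≤ x h ε 0<ε =
    let (N , p) = nonNeg-resp (value-lift x) h ε 0<ε in N , λ n n≥ →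
    ∸0≤ (subst (0ℚ ℚ.≤_) (shift (seq β n) (seq (a ⟨·⟩ ι x) n) ε) (p n n≥))

  one-pos : Pos cone (δ zero)
  one-pos h =
    let (N , p) = h ½ (ℚ.positive⁻¹ ½)
    in 0≰-pos (ℚ.positive⁻¹ ½) (subst (λ t → 0ℚ ℚ.≤ t ℚ.+ ½)
          (trans (value-⊝ (δ zero) N) (cong ℚ.-_ (value-one N))) (p N ℕ.≤-refl))
    where
    value-one : ∀ k → seq (value (δ zero)) k ≡ 1ℚ
    value-one k = trans (value-seq (δ zero) k) (trans (cong (1ℚ ℚ.* int 1ℤ ℚ.+_)
      (trans (∑ℚ.sum-cong-≗ {suc d} λ j → ℚ.*-zeroʳ (seq (coef (suc j)) k)) (∑ℚ.sum-replicate-zero (suc d)))) refl)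

-- The search for short vectors pairs the rows with the d differences of the points, so a shorter
-- system is filled up to length d.
pad : ∀ {r d} {T : Set₁} → (Fin r → T) → T → Fin d → T
pad {r} f z i = go (toℕ i ℕ.<? r)
  where
  go : Dec (toℕ i ℕ.< r) → _
  go (yes p) = f (fromℕ< p)
  go (no _)  = z

pad-all : ∀ {r d} {T : Set₁} (f : Fin r → T) z (Q : T → Set) → (∀ i → Q (f i)) → Q z → ∀ (i : Fin d) → Q (pad f z i)
pad-all {r} f z Q qf qz i with toℕ i ℕ.<? r
... | yes p = qf (fromℕ< p)
... | no _  = qz

pad-inject : ∀ {r d} {T : Set₁} (f : Fin r → T) z (r≤d : r ℕ.≤ d) i → pad f z (inject≤ i r≤d) ≡ f i
pad-inject {r} f z r≤d i with toℕ (inject≤ i r≤d) ℕ.<? r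
... | yes p = cong f (Fin.toℕ-injective (trans (Fin.toℕ-fromℕ< p) (Fin.toℕ-inject≤ i r≤d)))
... | no ¬p = ⊥-elim (¬p (subst (ℕ._< r) (sym (Fin.toℕ-inject≤ i r≤d)) (Fin.toℕ<n i)))

zero-row : ∀ {d} (x : LatticePoint d) → (λ _ → 0ℝ) ⟨·⟩ ι x ≤ 0ℝ
zero-row {d} x ε 0<ε = 0 , λ n _ → subst (ℚ._≤ 0ℚ ℚ.+ ε) (sym (vanish n))
    (subst (0ℚ ℚ.≤_) (sym (ℚ.+-identityˡ ε)) (ℚ.<⇒≤ 0<ε))
  where
  vanish : ∀ n → seq ((λ _ → 0ℝ) ⟨·⟩ ι x) n ≡ 0ℚ
  vanish n = trans (seq-sum (λ j → 0ℝ * ι x j) n)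
    (trans (∑ℚ.sum-cong-≗ {d} λ j → ℚ.*-zeroˡ (int (lookup x j))) (∑ℚ.sum-replicate-zero d))

-- The rows of A x ≤ b, padded by trivial inequalities to exactly d rows.
module System {d r} (r≤d : r ℕ.≤ d) (A : Matrix r d) (b : Point r) where
  given : Fin r → Cone (suc (suc d))
  given i = Inequality.cone (A i) (b i)

  trivial : Cone (suc (suc d))
  trivial = Inequality.cone (λ _ → 0ℝ) 0ℝ

  rows : Fin d → Cone (suc (suc d))
  rows = pad given trivial

  one-pos : ∀ i → Pos (rows i) (δ zero)
  one-pos = pad-all given trivial (λ C → Pos C (δ zero)) (λ i → Inequality.one-pos {d} (A i) (b i))
        (Inequality.one-pos {d} (λ _ → 0ℝ) 0ℝ)

  rows∋ : ∀ x → (∀ i → (A · ι x) i ≤ b i) → ∀ i → rows i ∋ lift x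
  rows∋ x h = pad-all given trivial (λ C → C ∋ lift x) (λ i → Inequality.≤⇒∈ (A i) (b i) x (h i))
    (Inequality.≤⇒∈ (λ _ → 0ℝ) 0ℝ x (zero-row x))

  ∋rows : ∀ x → (∀ i → rows i ∋ lift x) → ∀ i → (A · ι x) i ≤ b i
  ∋rows x h i = Inequality.∈⇒≤ (A i) (b i) x (subst (λ C → C ∋ lift x) (pad-inject given trivial r≤d i)
        (h (inject≤ i r≤d)))

not-described : ∀ d → 1 ℕ.≤ d → d ℕ.≤ 4 → (X : LatticeSet d) → Finite X → FullDimensional X →
                ∀ r → r ℕ.≤ d → ¬ DescribedBy r X
not-described d 1≤d d≤4 X (xs , mem) full r r≤d (A , b , l , U , v , describes) =
  independent-points X full (suc d) ℕ.≤-refl λ (y , y∈X , indep) →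
  too-few-inequalities d 1≤d d≤4 rows (List.map lift xs) complete (λ i → δ zero , one-pos i)
    (lift ∘ y) (λ k → lift∈ (y k) (y∈X k)) (λ c h → indep c (h ∘ suc))
  where
  open System r≤d A b
  -- The equations hold on X, hence everywhere, so the inequalities alone carve X out of the
  -- lattice.
  equations : ∀ x → U · ι x ≋ v
  equations x i = aff-extend X full (U i) (v i) (λ x x∈X → proj₂ (Equivalence.to (describes x) x∈X) i) (ι x)
  lift∈ : ∀ x → X x → Polyhedron.X rows (lift x)
  lift∈ x x∈X = (refl , refl) , rows∋ x (proj₁ (Equivalence.to (describes x) x∈X))
  complete : Polyhedron.Complete rows (List.map lift xs)
  complete u (pt , u∈) = Any.map (λ eq j → trans (u≗ j) (cong (λ t → t j) eq))
      (Mem.∈-map⁺ lift (Equivalence.to (mem x) x∈X))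
    where
    x : LatticePoint d
    x = tabulate (λ j → u (suc (suc j)))
    u≗ : u ≗ lift x
    u≗ zero          = Pt.unit pt
    u≗ (suc zero)    = Pt.level pt
    u≗ (suc (suc j)) = sym (lookup∘tabulate (λ j → u (suc (suc j))) j)
    x∈X : X x
    x∈X = Equivalence.from (describes x) (∋rows x (λ i → Cone.resp (rows i) u≗ (u∈ i)) , equations x)

corollary3p7 : ∀ (d : ℕ) → 1 ℕ.≤ d → d ℕ.≤ 4 →
    ∀ (X : LatticeSet d) → Finite X → LatticeConvex X → FullDimensional X →
    ∀ (r : ℕ) → IsRC X r → suc d ℕ.≤ r
corollary3p7 d 1≤d d≤4 X finite _ full r (described , _) =
  ℕ.≰⇒> λ r≤d → not-described d 1≤d d≤4 X finite full r r≤d described
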